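{- Let $p$ be an odd prime. Then $$\sum_{k=0}^{p-1}(4k+1)\frac{\binom{2k}{k}^3}{(-64)^k}\equiv\sum_{k=0}^{(p-1)/2}(4k+1)\frac{\binom{2k}{k}^3}{(-64)^k}\equiv p\left(\frac{ -1}{p}\right)+p^3E_{p-3}\pmod{p^4},$$ where $\left(\frac{\cdot}{p}\right)$ is the Legendre symbol and $E_n$ denotes the $n$-th Euler number.
   Context: The Euler numbers $E_0,E_1,E_2,\ldots$ are the integers defined by $E_0=1$ and $\sum_{0\le k\le n,\ 2\mid k}\binom{n}{k}E_{n-k}=0$ for $n=1,2,3,\ldots$ (equivalently, $\frac{2e^x}{e^{2x}+1}=\sum_{n\ge 0}E_n\frac{x^n}{n!}$ for $|x|<\pi/2$). For rational numbers $a,b$ whose denominators are prime to $p$, $a\equiv b\pmod{p^r}$ means that $a-b$ is $p^r$ times a rational number with denominator prime to $p$. One has $\left(\frac{ -1}{p}\right)=(-1)^{(p-1)/2}$.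
   Formalization: The second congruence is stated only for p ≠ 3, since it fails at p = 3: the half sum is 3/8, the right side is 24, and their difference −189/8 is not divisible by 3^4. The first congruence is stated for every odd prime. -}

module Defs where

open import Algebra.Definitions.RawMonoid using (sum)
open import Data.Bool.Base using (if_then_else_)
open import Data.Fin.Base using (Fin; zero; suc; toℕ)
open import Data.Fin.Properties using (any?)
open import Data.Integer.Base as ℤ using (ℤ; +_; -[1+_]; 0ℤ; 1ℤ; -1ℤ)
open import Data.Integer.Divisibility.Signed using (_∣?_)
open import Data.Integer.GCD using (gcd)
import Data.Integer.Properties as ℤ
open import Data.Nat.Base as ℕ using (ℕ; zero; suc; _∸_)
open import Data.Nat.Combinatorics using (_C_)
open import Data.Nat.Coprimality using (Coprime)
import Data.Nat.Divisibility as ℕ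
open import Data.Rational.Base as ℚ using (ℚ; 0ℚ; _/_; _÷_; ↥_; ↧ₙ_)
import Data.Rational.Properties as ℚ
open import Data.Vec.Base using (Vec; []; _∷_; lookup)
open import Algebra.Properties.CommutativeMonoid.Sum ℤ.+-0-commutativeMonoid
  using (sum-cong-≗)
open import Relation.Binary.PropositionalEquality
  using (_≡_; refl; sym; trans; cong; cong₂)
open import Relation.Nullary.Decidable.Core using (does)
open import Relation.Nullary.Negation.Core using (contradiction)

-- Sums over 0 ≤ k ≤ n, upper bound included.
∑ℤ[k≤_] : ℕ → (ℕ → ℤ) → ℤ
∑ℤ[k≤ n ] f = sum ℤ.+-0-rawMonoid {suc n} λ k → f (toℕ k)

∑ℚ[k≤_] : ℕ → (ℕ → ℚ) → ℚ
∑ℚ[k≤ n ] f = sum ℚ.+-0-rawMonoid {suc n} λ k → f (toℕ k)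

fromℤ : ℤ → ℚ
fromℤ i = i / 1

ifEven : ℕ → ℤ → ℤ
ifEven k x = if does (2 ℕ.∣? k) then x else 0ℤ

-- The part Σ_{1 ≤ k ≤ n+1, 2 ∣ k} C(n+1, k) E_{n+1-k} of the recurrence, given
-- es = E n ∷ E (n ∸ 1) ∷ ⋯ ∷ E 0 ∷ [] (position i carries k = suc i).
lowerSum : ∀ n → Vec ℤ (suc n) → ℤ
lowerSum n es = sum ℤ.+-0-rawMonoid λ (i : Fin (suc n)) →
  ifEven (suc (toℕ i)) (+ (suc n C suc (toℕ i)) ℤ.* lookup es i)

eulers : ∀ n → Vec ℤ (suc n)
eulers zero    = 1ℤ ∷ []
eulers (suc n) = ℤ.- lowerSum n (eulers n) ∷ eulers n

E : ℕ → ℤ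
E n = lookup (eulers n) zero

lookup-eulers : ∀ n (i : Fin (suc n)) → lookup (eulers n) i ≡ E (n ∸ toℕ i)
lookup-eulers n       zero    = refl
lookup-eulers (suc n) (suc i) = lookup-eulers n i

-- Together with E 0 ≡ 1ℤ (which holds by refl) this is the defining property
-- of the Euler numbers.
E-recurrence : ∀ n → .{{ℕ.NonZero n}} →
  ∑ℤ[k≤ n ] (λ k → ifEven k (+ (n C k) ℤ.* E (n ∸ k))) ≡ 0ℤ
E-recurrence (suc n) =
  trans (cong₂ ℤ._+_ (ℤ.*-identityˡ (E (suc n))) (sum-cong-≗ tail≗))
        (ℤ.+-inverseˡ (lowerSum n (eulers n)))
  where
  tail≗ : ∀ (i : Fin (suc n)) →
    ifEven (suc (toℕ i)) (+ (suc n C suc (toℕ i)) ℤ.* E (n ∸ toℕ i)) ≡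
    ifEven (suc (toℕ i)) (+ (suc n C suc (toℕ i)) ℤ.* lookup (eulers n) i)
  tail≗ i = cong
    (λ e → ifEven (suc (toℕ i)) (+ (suc n C suc (toℕ i)) ℤ.* e))
    (sym (lookup-eulers n i))

-- The Legendre symbol (a / p); meaningful for p an odd prime.
legendre : ℤ → ℕ → ℤ
legendre a p =
  if does (+ p ∣? a) then 0ℤ
  else if does (any? λ (x : Fin p) → + p ∣? (+ toℕ x) ℤ.^ 2 ℤ.- a) then 1ℤ
  else -1ℤ

-- ↧ₙ_ is the denominator in lowest terms.
Integral : ℕ → ℚ → Set
Integral p a = Coprime (↧ₙ a) p

record _≈_[mod_^_] (a b : ℚ) (p r : ℕ) : Set where
  field
    integralˡ        : Integral p a
    integralʳ        : Integral p b
    quotient         : ℚ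
    integralQuotient : Integral p quotient
    equality         : a ℚ.- b ≡ fromℤ (+ (p ℕ.^ r)) ℚ.* quotient

infix 4 _≈_[mod_^_]

-64^_ : ℕ → ℤ
-64^ k = -[1+ 63 ] ℤ.^ k

fromℤ-injective₀ : ∀ i → fromℤ i ≡ 0ℚ → i ≡ 0ℤ
fromℤ-injective₀ i eq =
  trans (sym (ℚ.↥-/ i 1)) (cong (λ q → ↥ q ℤ.* gcd i (+ 1)) eq)

nonZero-64^ : ∀ k → ℚ.NonZero (fromℤ (-64^ k))
nonZero-64^ k = ℚ.≢-nonZero λ eq →
  contradiction (ℤ.i^n≡0⇒i≡0 -[1+ 63 ] k (fromℤ-injective₀ (-64^ k) eq)) λ ()

term : ℕ → ℚ
term k = (fromℤ (+ ((4 ℕ.* k ℕ.+ 1) ℕ.* ((2 ℕ.* k) C k) ℕ.^ 3))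
          ÷ fromℤ (-64^ k)) {{ nonZero-64^ k }}

{-# OPTIONS --safe #-}

-- Put t(n) = C(2n,n)³/(-64)ⁿ and p = 2N + 1. A WZ pair turns the half sum into
-- the exact identity Σ_{n≤N} (4n+1) t(n) = p³ t(N) Σ_{k≤N} g(k), where g(0) = 1,
-- g(k+1) = - (p+2k+2)(p-1-2k) g(k) / (2k+3)².
--
-- Only g(N) has a denominator divisible by p; rewriting it gives
-- p³ t(N) g(N) = p (-1)^N Π_{0<k≤N} (1 - p²/(2k)²), which is p (-1)^N modulo p⁴
-- because Σ_{0<k≤N} 1/k² ≡ 0 (mod p) for p > 3. For k < N, modulo p,
-- 4 g(k) ≡ (-1)^N (-1)^j / (j² C(N,j)) with j = N - k, and
-- Σ_{0<j≤N} (-1)^j / (j² C(N,j)) = Σ_{0<j≤N} (1 + 2(-1)^j) / j². By Fermat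
-- 1/j² ≡ 4 (2j)^(p-3), and Σ (-1)^j (2j)^(p-3) telescopes through the Appell
-- polynomials Σ C(r,j) E_j y^(r-j), whose value at y = ± p is E_r modulo p.
--
-- In the upper range t(N+1+i) is p³ times a unit congruent to a constant over
-- C(N-1,i)³, while 4(N+1+i)+1 changes sign modulo p under i ↦ N-1-i, so the
-- upper range contributes 0 modulo p⁴.


module Submission where

open import Defs
import Algebra.Solver.Ring as RingSolver
open import Algebra.Definitions.RawMonoid using (sum)
open import Algebra.Solver.Ring.AlmostCommutativeRing
  using (AlmostCommutativeRing; fromCommutativeRing; _-Raw-AlmostCommutative⟶_)
open import Algebra.Structures using (IsCommutativeMonoid)
open import Data.Bool.Base using (if_then_else_)
open import Data.Fin.Base using (Fin; toℕ; fromℕ<)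
open import Data.Fin.Properties using (any?; toℕ-fromℕ<)
open import Data.Integer.Base as ℤ using (ℤ; +_; -[1+_]; 0ℤ; 1ℤ; -1ℤ)
import Data.Integer.Divisibility.Signed as ℤ∣
import Data.Integer.Properties as ℤ
open import Data.Maybe.Base using (Maybe; just; nothing)
open import Data.Nat.Base as ℕ using (ℕ; zero; suc; _∸_; z≤n; s≤s)
open import Data.Nat.Combinatorics using (_C_; nCk+nC[k+1]≡[n+1]C[k+1]; k>n⇒nCk≡0; nCn≡1; nCk≡nC[n∸k])
open import Data.Nat.Coprimality using (coprime-divisor) renaming (sym to coprime-sym; recompute to coprime-recompute)
open import Data.Nat.Divisibility using (_∣_; _∣?_; divides; ∣-trans; ∣1⇒≡1; ∣⇒≤; ∣n⇒∣m*n)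
open import Data.Nat.DivMod using (_%_; m%n<n; m≡m%n+[m/n]*n; m*n/n≡m)
open import Data.Nat.Primality using (Prime; euclidsLemma; prime⇒irreducible; ¬prime[1])
import Data.Nat.Properties as ℕ
open import Data.Product.Base using (∃; _×_; _,_; proj₁; proj₂)
open import Data.Rational.Base as ℚ using (ℚ; 0ℚ; 1ℚ)
import Data.Rational.Properties as ℚ
import Data.Rational.Unnormalised.Base as ℚᵘ
import Data.Rational.Unnormalised.Properties as ℚᵘ
open import Data.Sum.Base using (_⊎_; inj₁; inj₂; [_,_]′)
open import Function.Base using (_∘_)
open import Level using (0ℓ)
open import Relation.Binary.Bundles using (Setoid)
open import Relation.Binary.PropositionalEquality
  using (_≡_; _≢_; refl; sym; trans; cong; cong₂; subst; subst₂; module ≡-Reasoning)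
open import Relation.Nullary.Decidable.Core using (Dec; yes; no; does)
open import Relation.Nullary.Negation.Core using (¬_; contradiction)

-- The factor p³ in the exact identity shapes everything. Congruences are only ever taken modulo p:
-- a claim modulo p⁴ is reached by writing both sides exactly as c + p³ x and c + p³ y and comparing
-- x with y modulo p. So the work splits into exact identities over ℚ that mention no prime, and
-- congruences modulo p between p-integral rationals.
--
-- The obstacle is g(N): its denominator contains p², which uses up two of the three powers of p. It
-- must be rewritten exactly and expanded past its leading term before anything is reduced.
--
-- The WZ identity telescopes twice, in n and then in k. It is finite because F(n,k) contains the
-- factor 2n - 2j for every j < k, hence vanishes for k > n.
--
-- The bound p > 3 is genuine. For p = 3 the half sum is 3/8 and the right-hand side is 24; the
-- difference -189/8 is divisible by 27 but not by 81.

-- The embedding of ℤ in ℚ and a ring solver for ℚ with integer coefficients.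

module _ where
  open import Data.Rational.Base using (_+_; _*_; _-_; -_)

  -- Abstract, so that type checking never unfolds the gcd normalisation of ℚ.
  abstract
    ι : ℤ → ℚ
    ι = fromℤ

    ι≡fromℤ : ∀ i → ι i ≡ fromℤ i
    ι≡fromℤ i = refl

    private
      toℚᵘ-ι : ∀ i → ℚ.toℚᵘ (ι i) ℚᵘ.≃ ℚᵘ.mkℚᵘ i 0
      toℚᵘ-ι i = ℚ.toℚᵘ-fromℚᵘ (ℚᵘ.mkℚᵘ i 0)

    ι-+ : ∀ i j → ι (i ℤ.+ j) ≡ ι i + ι j
    ι-+ i j = ℚ.toℚᵘ-injective (begin
      ℚ.toℚᵘ (ι (i ℤ.+ j))                  ≈⟨ toℚᵘ-ι (i ℤ.+ j) ⟩
      ℚᵘ.mkℚᵘ (i ℤ.+ j) 0                   ≈⟨ ℚᵘ.*≡* (cong (ℤ._* + 1)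
                                                 (cong₂ ℤ._+_ (sym (ℤ.*-identityʳ i)) (sym (ℤ.*-identityʳ j)))) ⟩
      ℚᵘ.mkℚᵘ i 0 ℚᵘ.+ ℚᵘ.mkℚᵘ j 0          ≈⟨ ℚᵘ.+-cong (toℚᵘ-ι i) (toℚᵘ-ι j) ⟨
      ℚ.toℚᵘ (ι i) ℚᵘ.+ ℚ.toℚᵘ (ι j)        ≈⟨ ℚ.toℚᵘ-homo-+ (ι i) (ι j) ⟨
      ℚ.toℚᵘ (ι i + ι j)                    ∎)
      where open ℚᵘ.≃-Reasoning

    ι-* : ∀ i j → ι (i ℤ.* j) ≡ ι i * ι j
    ι-* i j = ℚ.toℚᵘ-injective (begin
      ℚ.toℚᵘ (ι (i ℤ.* j))                  ≈⟨ toℚᵘ-ι (i ℤ.* j) ⟩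
      ℚᵘ.mkℚᵘ i 0 ℚᵘ.* ℚᵘ.mkℚᵘ j 0          ≈⟨ ℚᵘ.*-cong (toℚᵘ-ι i) (toℚᵘ-ι j) ⟨
      ℚ.toℚᵘ (ι i) ℚᵘ.* ℚ.toℚᵘ (ι j)        ≈⟨ ℚ.toℚᵘ-homo-* (ι i) (ι j) ⟨
      ℚ.toℚᵘ (ι i * ι j)                    ∎)
      where open ℚᵘ.≃-Reasoning

    ι-neg : ∀ i → ι (ℤ.- i) ≡ - ι i
    ι-neg i = ℚ.toℚᵘ-injective (begin
      ℚ.toℚᵘ (ι (ℤ.- i))    ≈⟨ toℚᵘ-ι (ℤ.- i) ⟩
      ℚᵘ.- ℚᵘ.mkℚᵘ i 0      ≈⟨ ℚᵘ.-‿cong (toℚᵘ-ι i) ⟨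
      ℚᵘ.- ℚ.toℚᵘ (ι i)     ≈⟨ ℚᵘ.≃-sym (ℚ.toℚᵘ-homo‿- (ι i)) ⟩
      ℚ.toℚᵘ (- ι i)        ∎)
      where open ℚᵘ.≃-Reasoning

    ι-0 : ι 0ℤ ≡ 0ℚ
    ι-0 = refl

    ι-1 : ι 1ℤ ≡ 1ℚ
    ι-1 = refl

    -- inv 0 is the junk value 0.
    inv : ℕ → ℚ
    inv zero    = 0ℚ
    inv (suc n) = 1ℤ ℚ./ suc n

    *-inv : ∀ n .{{_ : ℕ.NonZero n}} → ι (+ n) * inv n ≡ ι 1ℤ
    *-inv (suc n) = ℚ.toℚᵘ-injective (begin
      ℚ.toℚᵘ (ι (+ suc n) * inv (suc n))              ≈⟨ ℚ.toℚᵘ-homo-* (ι (+ suc n)) (inv (suc n)) ⟩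
      ℚ.toℚᵘ (ι (+ suc n)) ℚᵘ.* ℚ.toℚᵘ (inv (suc n))  ≈⟨ ℚᵘ.*-cong (toℚᵘ-ι (+ suc n)) (ℚ.toℚᵘ-fromℚᵘ (ℚᵘ.mkℚᵘ 1ℤ n)) ⟩
      ℚᵘ.mkℚᵘ (+ suc n) 0 ℚᵘ.* ℚᵘ.mkℚᵘ 1ℤ n           ≈⟨ ℚᵘ.*≡* (trans (ℤ.*-identityʳ (+ suc n ℤ.* 1ℤ)) (trans (ℤ.*-identityʳ (+ suc n)) (sym (trans (ℤ.*-identityˡ (+ (1 ℕ.* suc n))) (cong +_ (ℕ.*-identityˡ (suc n))))))) ⟩
      ℚᵘ.1ℚᵘ                                          ∎)
      where open ℚᵘ.≃-Reasoning

    ι-injective₀ : ∀ {i} → ι i ≡ ι 0ℤ → i ≡ 0ℤ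
    ι-injective₀ {i} = fromℤ-injective₀ i

    *-denominator : ∀ a → a * ι (ℚ.↧ a) ≡ ι (ℚ.↥ a)
    *-denominator a@(ℚ.mkℚ n d _) = ℚ.toℚᵘ-injective (begin
      ℚ.toℚᵘ (a * ι (+ suc d))               ≈⟨ ℚ.toℚᵘ-homo-* a (ι (+ suc d)) ⟩
      ℚᵘ.mkℚᵘ n d ℚᵘ.* ℚ.toℚᵘ (ι (+ suc d))  ≈⟨ ℚᵘ.*-congˡ {ℚᵘ.mkℚᵘ n d} (toℚᵘ-ι (+ suc d)) ⟩
      ℚᵘ.mkℚᵘ n d ℚᵘ.* ℚᵘ.mkℚᵘ (+ suc d) 0   ≈⟨ ℚᵘ.*≡* (trans (ℤ.*-identityʳ (n ℤ.* + suc d))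
                                                  (cong (λ m → n ℤ.* + m) (sym (ℕ.*-identityʳ (suc d))))) ⟩
      ℚᵘ.mkℚᵘ n 0                            ≈⟨ toℚᵘ-ι n ⟨
      ℚ.toℚᵘ (ι n)                           ∎)
      where open ℚᵘ.≃-Reasoning

  ⟦_⟧ : ℕ → ℚ
  ⟦ n ⟧ = ι (+ n)

  private
    ℚ-ring : AlmostCommutativeRing 0ℓ 0ℓ
    ℚ-ring = fromCommutativeRing ℚ.+-*-commutativeRing

    -- Coefficients live in ℤ, where arithmetic computes, while `ι` stays opaque. The solver
    -- constant `con (+ n)` then denotes exactly `⟦ n ⟧`.
    ℤ-coefficients : ℤ.+-*-rawRing -Raw-AlmostCommutative⟶ ℚ-ring
    ℤ-coefficients = record
      { ⟦_⟧ = ι ; +-homo = ι-+ ; *-homo = ι-* ; -‿homo = ι-neg ; 0-homo = ι-0 ; 1-homo = ι-1 }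

    ι-≟ : ∀ i j → Maybe (ι i ≡ ι j)
    ι-≟ i j with i ℤ.≟ j
    ... | yes refl = just refl
    ... | no _     = nothing

  open RingSolver ℤ.+-*-rawRing ℚ-ring ℤ-coefficients ι-≟ public
    using (solve; _:=_; _:+_; _:*_; _:-_; :-_; con)

  pattern k0 = con (+ 0)
  pattern k1 = con (+ 1)

  ⟨+⟩ : ∀ m n → ⟦ m ℕ.+ n ⟧ ≡ ⟦ m ⟧ + ⟦ n ⟧
  ⟨+⟩ m n = ι-+ (+ m) (+ n)

  ⟨*⟩ : ∀ m n → ⟦ m ℕ.* n ⟧ ≡ ⟦ m ⟧ * ⟦ n ⟧
  ⟨*⟩ m n = trans (cong ι (ℤ.pos-* m n)) (ι-* (+ m) (+ n))

  ⟨suc⟩ : ∀ n → ⟦ suc n ⟧ ≡ ⟦ 1 ⟧ + ⟦ n ⟧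
  ⟨suc⟩ n = ⟨+⟩ 1 n

  ⟨∸⟩ : ∀ {m n} → n ℕ.≤ m → ⟦ m ∸ n ⟧ ≡ ⟦ m ⟧ - ⟦ n ⟧
  ⟨∸⟩ {m} {n} n≤m = begin
    ⟦ m ∸ n ⟧                    ≡⟨ solve 2 (λ a b → a := (a :+ b) :- b) refl ⟦ m ∸ n ⟧ ⟦ n ⟧ ⟩
    ⟦ m ∸ n ⟧ + ⟦ n ⟧ - ⟦ n ⟧    ≡⟨ cong (_- ⟦ n ⟧) (⟨+⟩ (m ∸ n) n) ⟨
    ⟦ m ∸ n ℕ.+ n ⟧ - ⟦ n ⟧      ≡⟨ cong (λ k → ⟦ k ⟧ - ⟦ n ⟧) (ℕ.m∸n+n≡m n≤m) ⟩
    ⟦ m ⟧ - ⟦ n ⟧                ∎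
    where open ≡-Reasoning

  ⟨0⟩ : ⟦ 0 ⟧ ≡ 0ℚ
  ⟨0⟩ = ι-0

  ⟨1⟩ : ⟦ 1 ⟧ ≡ 1ℚ
  ⟨1⟩ = ι-1

  ι-injective : ∀ {i j} → ι i ≡ ι j → i ≡ j
  ι-injective {i} {j} eq = ℤ.i-j≡0⇒i≡j i j (ι-injective₀ (begin
    ι (i ℤ.- j)        ≡⟨ ι-+ i (ℤ.- j) ⟩
    ι i + ι (ℤ.- j)    ≡⟨ cong₂ _+_ eq (ι-neg j) ⟩
    ι j - ι j          ≡⟨ solve 1 (λ j → j :- j := k0) refl (ι j) ⟩
    ι 0ℤ               ∎))
    where open ≡-Reasoning

-- Finite sums and products over k < n.

module _ where
  open import Data.Rational.Base using (_+_; _*_; _-_; -_)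
  open ≡-Reasoning

  module BigOp (_∙_ : ℚ → ℚ → ℚ) (ε : ℚ) (isCM : IsCommutativeMonoid _≡_ _∙_ ε) where
    open IsCommutativeMonoid isCM using (assoc; comm; identityˡ; identityʳ)

    big : ℕ → (ℕ → ℚ) → ℚ
    big zero    f = ε
    big (suc n) f = big n f ∙ f n

    big-cong : ∀ n {f g : ℕ → ℚ} → (∀ k → k ℕ.< n → f k ≡ g k) → big n f ≡ big n g
    big-cong zero    f≗g = refl
    big-cong (suc n) f≗g =
      cong₂ _∙_ (big-cong n λ k k<n → f≗g k (ℕ.m<n⇒m<1+n k<n)) (f≗g n (ℕ.n<1+n n))

    big-∙ : ∀ n (f g : ℕ → ℚ) → big n (λ k → f k ∙ g k) ≡ big n f ∙ big n g
    big-∙ zero    f g = sym (identityˡ ε)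
    big-∙ (suc n) f g = begin
      big n (λ k → f k ∙ g k) ∙ (f n ∙ g n)    ≡⟨ cong (_∙ (f n ∙ g n)) (big-∙ n f g) ⟩
      (big n f ∙ big n g) ∙ (f n ∙ g n)        ≡⟨ assoc (big n f) (big n g) (f n ∙ g n) ⟩
      big n f ∙ (big n g ∙ (f n ∙ g n))        ≡⟨ cong (big n f ∙_) (assoc (big n g) (f n) (g n)) ⟨
      big n f ∙ ((big n g ∙ f n) ∙ g n)        ≡⟨ cong (λ x → big n f ∙ (x ∙ g n)) (comm (big n g) (f n)) ⟩
      big n f ∙ ((f n ∙ big n g) ∙ g n)        ≡⟨ cong (big n f ∙_) (assoc (f n) (big n g) (g n)) ⟩
      big n f ∙ (f n ∙ (big n g ∙ g n))        ≡⟨ assoc (big n f) (f n) (big n g ∙ g n) ⟨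
      (big n f ∙ f n) ∙ (big n g ∙ g n)        ∎

    big-head : ∀ n (f : ℕ → ℚ) → big (suc n) f ≡ f 0 ∙ big n (f ∘ suc)
    big-head zero    f = comm ε (f 0)
    big-head (suc n) f = begin
      big (suc n) f ∙ f (suc n)                ≡⟨ cong (_∙ f (suc n)) (big-head n f) ⟩
      (f 0 ∙ big n (f ∘ suc)) ∙ f (suc n)      ≡⟨ assoc (f 0) (big n (f ∘ suc)) (f (suc n)) ⟩
      f 0 ∙ (big n (f ∘ suc) ∙ f (suc n))      ∎

    big-++ : ∀ m n (f : ℕ → ℚ) → big (m ℕ.+ n) f ≡ big m f ∙ big n (λ k → f (m ℕ.+ k))
    big-++ zero    n f = sym (identityˡ (big n f))
    big-++ (suc m) n f = begin
      big (suc (m ℕ.+ n)) f                                             ≡⟨ big-head (m ℕ.+ n) f ⟩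
      f 0 ∙ big (m ℕ.+ n) (f ∘ suc)                                     ≡⟨ cong (f 0 ∙_) (big-++ m n (f ∘ suc)) ⟩
      f 0 ∙ (big m (f ∘ suc) ∙ big n (λ k → f (suc m ℕ.+ k)))           ≡⟨ assoc (f 0) (big m (f ∘ suc)) _ ⟨
      (f 0 ∙ big m (f ∘ suc)) ∙ big n (λ k → f (suc m ℕ.+ k))           ≡⟨ cong (_∙ big n (λ k → f (suc m ℕ.+ k))) (big-head m f) ⟨
      big (suc m) f ∙ big n (λ k → f (suc m ℕ.+ k))                     ∎

    big-reverse : ∀ n (f : ℕ → ℚ) → big n f ≡ big n (λ k → f (n ∸ suc k))
    big-reverse zero    f = refl
    big-reverse (suc n) f = begin
      big n f ∙ f n                             ≡⟨ comm (big n f) (f n) ⟩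
      f n ∙ big n f                             ≡⟨ cong (f n ∙_) (big-reverse n f) ⟩
      f n ∙ big n (λ k → f (n ∸ suc k))         ≡⟨ big-head n (λ k → f (n ∸ k)) ⟨
      big (suc n) (λ k → f (n ∸ k))             ∎

    big-double : ∀ n (f : ℕ → ℚ) → big (2 ℕ.* n) f ≡ big n (λ k → f (2 ℕ.* k) ∙ f (suc (2 ℕ.* k)))
    big-double zero    f = refl
    big-double (suc n) f = begin
      big (2 ℕ.* suc n) f                                          ≡⟨ cong (λ m → big m f) (ℕ.*-suc 2 n) ⟩
      (big (2 ℕ.* n) f ∙ f (2 ℕ.* n)) ∙ f (suc (2 ℕ.* n))          ≡⟨ assoc (big (2 ℕ.* n) f) (f (2 ℕ.* n)) (f (suc (2 ℕ.* n))) ⟩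
      big (2 ℕ.* n) f ∙ (f (2 ℕ.* n) ∙ f (suc (2 ℕ.* n)))          ≡⟨ cong (_∙ (f (2 ℕ.* n) ∙ f (suc (2 ℕ.* n)))) (big-double n f) ⟩
      big (suc n) (λ k → f (2 ℕ.* k) ∙ f (suc (2 ℕ.* k)))          ∎

  -- The units are `⟦ 0 ⟧` and `⟦ 1 ⟧` rather than 0ℚ and 1ℚ, so that empty sums and products are
  -- literally the solver's constants; the monoid laws are transported accordingly.
  open BigOp _+_ ⟦ 0 ⟧ (subst (IsCommutativeMonoid _≡_ _+_) (sym ⟨0⟩) ℚ.+-0-isCommutativeMonoid) public
    renaming (big to Σ; big-cong to Σ-cong; big-∙ to Σ-+; big-head to Σ-head; big-++ to Σ-++; big-reverse to Σ-reverse; big-double to Σ-double)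
  open BigOp _*_ ⟦ 1 ⟧ (subst (IsCommutativeMonoid _≡_ _*_) (sym ⟨1⟩) ℚ.*-1-isCommutativeMonoid) public
    renaming (big to Π; big-cong to Π-cong; big-∙ to Π-*; big-head to Π-head; big-reverse to Π-reverse; big-double to Π-double)

  Σ-*ˡ : ∀ n c (f : ℕ → ℚ) → Σ n (λ k → c * f k) ≡ c * Σ n f
  Σ-*ˡ zero    c f = solve 1 (λ c → k0 := c :* k0) refl c
  Σ-*ˡ (suc n) c f = begin
    Σ n (λ k → c * f k) + c * f n    ≡⟨ cong (_+ c * f n) (Σ-*ˡ n c f) ⟩
    c * Σ n f + c * f n              ≡⟨ ℚ.*-distribˡ-+ c (Σ n f) (f n) ⟨
    c * (Σ n f + f n)                ∎

  Σ-telescope : ∀ n (f : ℕ → ℚ) → Σ n (λ k → f k - f (suc k)) ≡ f 0 - f n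
  Σ-telescope zero    f = solve 1 (λ x → k0 := x :- x) refl (f 0)
  Σ-telescope (suc n) f = trans (cong (_+ (f n - f (suc n))) (Σ-telescope n f))
    (solve 3 (λ x y z → (x :- y) :+ (y :- z) := x :- z) refl (f 0) (f n) (f (suc n)))

  -- The WZ pair and the exact evaluation of the half sum.

  odd : ℕ → ℚ
  odd k = ⟦ 1 ⟧ + ⟦ 2 ⟧ * ⟦ k ⟧

  odd⁻¹ : ℕ → ℚ
  odd⁻¹ k = inv (suc (2 ℕ.* k))

  ⟨odd⟩ : ∀ k → ⟦ suc (2 ℕ.* k) ⟧ ≡ odd k
  ⟨odd⟩ k = trans (⟨suc⟩ (2 ℕ.* k)) (cong (λ s → ⟦ 1 ⟧ + s) (⟨*⟩ 2 k))

  odd-inv : ∀ k → odd k * (odd⁻¹ k) ≡ ⟦ 1 ⟧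
  odd-inv k = trans (cong (_* (odd⁻¹ k)) (sym (⟨odd⟩ k))) (*-inv (suc (2 ℕ.* k)))

  even⁻¹ : ℕ → ℚ
  even⁻¹ k = inv (2 ℕ.* suc k)

  even : ℕ → ℚ
  even k = ⟦ 2 ⟧ + ⟦ 2 ⟧ * ⟦ k ⟧

  ⟨even⟩ : ∀ k → ⟦ 2 ℕ.* suc k ⟧ ≡ even k
  ⟨even⟩ k = trans (⟨*⟩ 2 (suc k)) (trans (cong (⟦ 2 ⟧ *_) (⟨suc⟩ k))
     (solve 1 (λ k → con (+ 2) :* (k1 :+ k) := con (+ 2) :+ con (+ 2) :* k) refl ⟦ k ⟧))

  even-inv : ∀ k → even k * even⁻¹ k ≡ ⟦ 1 ⟧
  even-inv k = trans (cong (_* even⁻¹ k) (sym (⟨even⟩ k))) (*-inv (2 ℕ.* suc k))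

  cube : ℚ → ℚ
  cube x = x * x * x

  -- A quarter of the ratio C(2k+2,k+1) / C(2k,k), as `central` shows; the cube of 4 against -64
  -- leaves the sign in `t`.
  ρ : ℕ → ℚ
  ρ k = odd k * even⁻¹ k

  t : ℕ → ℚ
  t zero    = ⟦ 1 ⟧
  t (suc k) = - cube (ρ k) * t k

  -- The WZ pair is F(n,k) = (4n+1) t(n) wzF (2n) k and
  -- G(n+1,k+1) = t(n) (2n+1)³ wzG (2n) k, with F(n,k) - F(n,k+1) = G(n+1,k+1) - G(n,k+1);
  -- stated in x = 2n, the products below are polynomials in x.
  wzF : ℚ → ℕ → ℚ
  wzF x zero    = ⟦ 1 ⟧
  wzF x (suc k) = - ((x + odd k) * (x - ⟦ 2 ⟧ * ⟦ k ⟧) * ((odd⁻¹ k) * (odd⁻¹ k))) * wzF x k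

  wzG : ℚ → ℕ → ℚ
  wzG x zero    = ⟦ 1 ⟧
  wzG x (suc k) = - ((x + odd (suc k)) * (x - ⟦ 2 ⟧ * ⟦ k ⟧) * ((odd⁻¹ (suc k)) * (odd⁻¹ (suc k)))) * wzG x k

  odd⁻¹0 : odd⁻¹ 0 ≡ ⟦ 1 ⟧
  odd⁻¹0 = trans (solve 1 (λ i → i := k1 :* i) refl (inv 1)) (*-inv 1)

  -- The factors of `wzG x` are those of `wzF x` with `odd k` advanced to `odd (suc k)`, both in the
  -- numerator and in the inverse squares, so the quotient of the two products telescopes.
  wzG-wzF : ∀ x k → (x + ⟦ 1 ⟧) * wzG x k ≡ (x + odd k) * ((odd⁻¹ k) * (odd⁻¹ k)) * wzF x k
  wzG-wzF x zero    = trans (solve 1 (λ x → (x :+ k1) :* k1 := (x :+ (k1 :+ con (+ 2) :* k0)) :* (k1 :* k1) :* k1) refl x)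
    (cong (λ i → (x + odd 0) * (i * i) * ⟦ 1 ⟧) (sym odd⁻¹0))
  wzG-wzF x (suc k) = begin
    (x + ⟦ 1 ⟧) * (- (y' * z * i') * wzG x k)
      ≡⟨ solve 5 (λ a y z i h → a :* (:- (y :* z :* i) :* h) := :- (y :* z :* i) :* (a :* h)) refl (x + ⟦ 1 ⟧) y' z i' (wzG x k) ⟩
    - (y' * z * i') * ((x + ⟦ 1 ⟧) * wzG x k)  ≡⟨ cong (- (y' * z * i') *_) (wzG-wzF x k) ⟩
    - (y' * z * i') * (y * i * wzF x k)
      ≡⟨ solve 6 (λ y' z i' y i f → :- (y' :* z :* i') :* (y :* i :* f) := y' :* i' :* (:- (y :* z :* i) :* f)) refl y' z i' y i (wzF x k) ⟩
    y' * i' * (- (y * z * i) * wzF x k)        ∎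
    where
    y = x + odd k
    y' = x + odd (suc k)
    z = x - ⟦ 2 ⟧ * ⟦ k ⟧
    i = (odd⁻¹ k) * (odd⁻¹ k)
    i' = (odd⁻¹ (suc k)) * (odd⁻¹ (suc k))

  -- At x - 2 the factor x - 2 + `odd (suc k)` is again x + `odd k`, while x - 2k becomes x -
  -- 2(k+1). Now the even factor and the inverse squares are the ones that telescope.
  wzG-wzF-shifted : ∀ x k → x * wzG (x - ⟦ 2 ⟧) k ≡ (x - ⟦ 2 ⟧ * ⟦ k ⟧) * ((odd⁻¹ k) * (odd⁻¹ k)) * wzF x k
  wzG-wzF-shifted x zero    = trans (solve 1 (λ x → x :* k1 := (x :- con (+ 2) :* k0) :* (k1 :* k1) :* k1) refl x)
    (cong (λ i → (x - ⟦ 2 ⟧ * ⟦ 0 ⟧) * (i * i) * ⟦ 1 ⟧) (sym odd⁻¹0))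
  wzG-wzF-shifted x (suc k) = begin
    x * (- ((x - ⟦ 2 ⟧ + odd (suc k)) * (x - ⟦ 2 ⟧ - ⟦ 2 ⟧ * ⟦ k ⟧) * i') * wzG (x - ⟦ 2 ⟧) k)
      ≡⟨ cong (λ s → x * (- ((x - ⟦ 2 ⟧ + (⟦ 1 ⟧ + ⟦ 2 ⟧ * s)) * (x - ⟦ 2 ⟧ - ⟦ 2 ⟧ * ⟦ k ⟧) * i') * wzG (x - ⟦ 2 ⟧) k)) (⟨suc⟩ k) ⟩
    x * (- ((x - ⟦ 2 ⟧ + (⟦ 1 ⟧ + ⟦ 2 ⟧ * (⟦ 1 ⟧ + ⟦ k ⟧))) * (x - ⟦ 2 ⟧ - ⟦ 2 ⟧ * ⟦ k ⟧) * i') * wzG (x - ⟦ 2 ⟧) k)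
      ≡⟨ solve 4 (λ x k i h → x :* (:- ((x :- con (+ 2) :+ (k1 :+ con (+ 2) :* (k1 :+ k))) :* (x :- con (+ 2) :- con (+ 2) :* k) :* i) :* h)
            := :- ((x :+ (k1 :+ con (+ 2) :* k)) :* (x :- con (+ 2) :* (k1 :+ k)) :* i) :* (x :* h)) refl x ⟦ k ⟧ i' (wzG (x - ⟦ 2 ⟧) k) ⟩
    - (y * (x - ⟦ 2 ⟧ * (⟦ 1 ⟧ + ⟦ k ⟧)) * i') * (x * wzG (x - ⟦ 2 ⟧) k)
      ≡⟨ cong₂ (λ s e → - (y * (x - ⟦ 2 ⟧ * s) * i') * e) (sym (⟨suc⟩ k)) (wzG-wzF-shifted x k) ⟩
    - (y * z' * i') * (z * i * wzF x k)
      ≡⟨ solve 6 (λ z' y i' z i f → :- (y :* z' :* i') :* (z :* i :* f) := z' :* i' :* (:- (y :* z :* i) :* f)) refl z' y i' z i (wzF x k) ⟩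
    z' * i' * (- (y * z * i) * wzF x k)        ∎
    where
    y = x + odd k
    z = x - ⟦ 2 ⟧ * ⟦ k ⟧
    z' = x - ⟦ 2 ⟧ * ⟦ suc k ⟧
    i = (odd⁻¹ k) * (odd⁻¹ k)
    i' = (odd⁻¹ (suc k)) * (odd⁻¹ (suc k))

  -- Once `wzG` is expressed through `wzF`, everything is a multiple of `wzF x k` times the square
  -- of `odd⁻¹ k`. With b = 2k + 1 the cofactors are (2x+1)(x²+x+b) = (x+1)²(x+b) + x²(x-2k).
  wz : ∀ x k → (⟦ 2 ⟧ * x + ⟦ 1 ⟧) * (wzF x k - wzF x (suc k)) ≡
               cube (x + ⟦ 1 ⟧) * wzG x k + cube x * wzG (x - ⟦ 2 ⟧) k
  wz x k = begin
    (⟦ 2 ⟧ * x + ⟦ 1 ⟧) * (f - - (y * z * (i * i)) * f)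
      ≡⟨ cong (λ c → (⟦ 2 ⟧ * x + ⟦ 1 ⟧) * (c - - (y * z * (i * i)) * f)) f≡ ⟩
    (⟦ 2 ⟧ * x + ⟦ 1 ⟧) * (odd k * odd k * (i * i) * f - - (y * z * (i * i)) * f)
      ≡⟨ solve 4 (λ x k i f → let b = k1 :+ con (+ 2) :* k in
            (con (+ 2) :* x :+ k1) :* (b :* b :* (i :* i) :* f :- :- ((x :+ b) :* (x :- con (+ 2) :* k) :* (i :* i)) :* f)
            := (x :+ k1) :* (x :+ k1) :* ((x :+ b) :* (i :* i) :* f) :+ x :* x :* ((x :- con (+ 2) :* k) :* (i :* i) :* f)) refl x ⟦ k ⟧ i f ⟩
    (x + ⟦ 1 ⟧) * (x + ⟦ 1 ⟧) * (y * (i * i) * f) + x * x * (z * (i * i) * f)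
      ≡⟨ cong₂ (λ a b → (x + ⟦ 1 ⟧) * (x + ⟦ 1 ⟧) * a + x * x * b) (sym (wzG-wzF x k)) (sym (wzG-wzF-shifted x k)) ⟩
    (x + ⟦ 1 ⟧) * (x + ⟦ 1 ⟧) * ((x + ⟦ 1 ⟧) * wzG x k) + x * x * (x * wzG (x - ⟦ 2 ⟧) k)
      ≡⟨ cong₂ _+_ (sym (ℚ.*-assoc ((x + ⟦ 1 ⟧) * (x + ⟦ 1 ⟧)) (x + ⟦ 1 ⟧) (wzG x k))) (sym (ℚ.*-assoc (x * x) x (wzG (x - ⟦ 2 ⟧) k))) ⟩
    cube (x + ⟦ 1 ⟧) * wzG x k + cube x * wzG (x - ⟦ 2 ⟧) k ∎
    where
    y = x + odd k
    z = x - ⟦ 2 ⟧ * ⟦ k ⟧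
    i = odd⁻¹ k
    f = wzF x k
    f≡ : f ≡ odd k * odd k * (i * i) * f
    f≡ = begin
      f                                  ≡⟨ solve 1 (λ f → f := k1 :* k1 :* f) refl f ⟩
      ⟦ 1 ⟧ * ⟦ 1 ⟧ * f                  ≡⟨ cong (λ c → c * c * f) (sym (odd-inv k)) ⟩
      (odd k * i) * (odd k * i) * f      ≡⟨ solve 3 (λ o i f → (o :* i) :* (o :* i) :* f := o :* o :* (i :* i) :* f) refl (odd k) i f ⟩
      odd k * odd k * (i * i) * f        ∎

  dbl : ℕ → ℚ
  dbl n = ⟦ 2 ⟧ * ⟦ n ⟧

  -- Makes the second term of `wz` at n + 1, weighted by t(n+1), the negative of the first term at n
  -- weighted by t(n). This is the cancellation behind `wz-telescope`.
  t-rec : ∀ n → cube (dbl (suc n)) * t (suc n) ≡ - (cube (odd n) * t n)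
  t-rec n = begin
    cube (dbl (suc n)) * (- cube (ρ n) * t n)     ≡⟨ cong (λ e → cube e * (- cube (ρ n) * t n)) dbl-suc ⟩
    cube (even n) * (- cube (ρ n) * t n)
      ≡⟨ solve 4 (λ e o i t → (e :* e :* e) :* (:- ((o :* i) :* (o :* i) :* (o :* i)) :* t) := :- (((o :* o :* o) :* ((e :* i) :* (e :* i) :* (e :* i))) :* t)) refl (even n) (odd n) (even⁻¹ n) (t n) ⟩
    - (cube (odd n) * cube (even n * even⁻¹ n) * t n) ≡⟨ cong (λ c → - (cube (odd n) * cube c * t n)) (even-inv n) ⟩
    - (cube (odd n) * cube ⟦ 1 ⟧ * t n)
      ≡⟨ solve 2 (λ o t → :- (o :* (k1 :* k1 :* k1) :* t) := :- (o :* t)) refl (cube (odd n)) (t n) ⟩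
    - (cube (odd n) * t n) ∎
    where
    dbl-suc : dbl (suc n) ≡ even n
    dbl-suc = trans (cong (⟦ 2 ⟧ *_) (⟨suc⟩ n)) (solve 1 (λ k → con (+ 2) :* (k1 :+ k) := con (+ 2) :+ con (+ 2) :* k) refl ⟦ n ⟧)

  [4n+1]t : ℕ → ℚ
  [4n+1]t n = (⟦ 2 ⟧ * dbl n + ⟦ 1 ⟧) * t n

  wz-telescope : ∀ M k → Σ (suc M) (λ n → [4n+1]t n * (wzF (dbl n) k - wzF (dbl n) (suc k))) ≡ t M * cube (odd M) * wzG (dbl M) k
  wz-telescope zero k = begin
    ⟦ 0 ⟧ + [4n+1]t 0 * (wzF (dbl 0) k - wzF (dbl 0) (suc k))
      ≡⟨ solve 2 (λ a b → k0 :+ (a :* k1) :* b := a :* b) refl (⟦ 2 ⟧ * dbl 0 + ⟦ 1 ⟧) (wzF (dbl 0) k - wzF (dbl 0) (suc k)) ⟩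
    (⟦ 2 ⟧ * dbl 0 + ⟦ 1 ⟧) * (wzF (dbl 0) k - wzF (dbl 0) (suc k))
      ≡⟨ wz (dbl 0) k ⟩
    cube (dbl 0 + ⟦ 1 ⟧) * wzG (dbl 0) k + cube (dbl 0) * wzG (dbl 0 - ⟦ 2 ⟧) k
      -- The lower boundary term carries the factor (2n)³, which is 0 at n = 0.
      ≡⟨ solve 2 (λ a b → let d = con (+ 2) :* k0 ; c = λ x → x :* x :* x in c (d :+ k1) :* a :+ c d :* b := k1 :* c (k1 :+ d) :* a) refl (wzG (dbl 0) k) (wzG (dbl 0 - ⟦ 2 ⟧) k) ⟩
    ⟦ 1 ⟧ * cube (odd 0) * wzG (dbl 0) k ∎
  wz-telescope (suc M) k = begin
    Σ (suc M) F + [4n+1]t (suc M) * (wzF x k - wzF x (suc k))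
      ≡⟨ cong₂ _+_ (wz-telescope M k) (trans (solve 3 (λ a b c → a :* b :* c := b :* (a :* c)) refl (⟦ 2 ⟧ * x + ⟦ 1 ⟧) (t (suc M)) (wzF x k - wzF x (suc k)))
           (cong (t (suc M) *_) (wz x k))) ⟩
    t M * cube (odd M) * wzG (dbl M) k + t (suc M) * (cube (x + ⟦ 1 ⟧) * wzG x k + cube x * wzG (x - ⟦ 2 ⟧) k)
      ≡⟨ solve 7 (λ tM o h t' a b c → tM :* o :* h :+ t' :* (a :+ b :* c) := o :* tM :* h :+ b :* t' :* c :+ t' :* a) refl
           (t M) (cube (odd M)) (wzG (dbl M) k) (t (suc M)) (cube (x + ⟦ 1 ⟧) * wzG x k) (cube x) (wzG (x - ⟦ 2 ⟧) k) ⟩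
    cube (odd M) * t M * wzG (dbl M) k + cube x * t (suc M) * wzG (x - ⟦ 2 ⟧) k + t (suc M) * (cube (x + ⟦ 1 ⟧) * wzG x k)
      ≡⟨ cong₂ (λ a b → cube (odd M) * t M * wzG (dbl M) k + a * wzG b k + t (suc M) * (cube (x + ⟦ 1 ⟧) * wzG x k)) (t-rec M) x-2 ⟩
    cube (odd M) * t M * wzG (dbl M) k + - (cube (odd M) * t M) * wzG (dbl M) k + t (suc M) * (cube (x + ⟦ 1 ⟧) * wzG x k)
      ≡⟨ solve 5 (λ a b c d e → a :* b :+ :- a :* b :+ c :* (d :* e) := c :* d :* e) refl (cube (odd M) * t M) (wzG (dbl M) k) (t (suc M)) (cube (x + ⟦ 1 ⟧)) (wzG x k) ⟩
    t (suc M) * cube (x + ⟦ 1 ⟧) * wzG x k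
      ≡⟨ cong (λ e → t (suc M) * cube e * wzG x k) (ℚ.+-comm x ⟦ 1 ⟧) ⟩
    t (suc M) * cube (odd (suc M)) * wzG x k ∎
    where
    x = dbl (suc M)
    F : ℕ → ℚ
    F n = [4n+1]t n * (wzF (dbl n) k - wzF (dbl n) (suc k))
    x-2 : x - ⟦ 2 ⟧ ≡ dbl M
    x-2 = trans (cong (λ s → ⟦ 2 ⟧ * s - ⟦ 2 ⟧) (⟨suc⟩ M)) (solve 1 (λ k → con (+ 2) :* (k1 :+ k) :- con (+ 2) := con (+ 2) :* k) refl ⟦ M ⟧)

  -- At x = 2n the factor x - 2j with j = n is zero, and it occurs in the product as soon as k > n.
  wzF-zero : ∀ n k → n ℕ.< k → wzF (dbl n) k ≡ ⟦ 0 ⟧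
  wzF-zero n (suc k) (s≤s n≤k) with n ℕ.≟ k
  ... | yes refl = solve 3 (λ n i f → :- ((con (+ 2) :* n :+ (k1 :+ con (+ 2) :* n)) :* (con (+ 2) :* n :- con (+ 2) :* n) :* i) :* f := k0) refl ⟦ n ⟧ ((odd⁻¹ n) * (odd⁻¹ n)) (wzF (dbl n) n)
  ... | no n≢k   = trans (cong (c *_) (wzF-zero n k (ℕ.≤∧≢⇒< n≤k n≢k))) (solve 1 (λ c → c :* k0 := k0) refl c)
    where c = - ((dbl n + odd k) * (dbl n - ⟦ 2 ⟧ * ⟦ k ⟧) * ((odd⁻¹ k) * (odd⁻¹ k)))

  -- The second telescoping: summing `wz-telescope` over k < K leaves only the ends `wzF x 0`, which
  -- is 1, and `wzF x K`.
  wz-sum : ∀ M K → Σ (suc M) (λ n → [4n+1]t n * (⟦ 1 ⟧ - wzF (dbl n) K)) ≡ t M * cube (odd M) * Σ K (wzG (dbl M))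
  wz-sum M zero    = begin
    Σ (suc M) (λ n → [4n+1]t n * (⟦ 1 ⟧ - ⟦ 1 ⟧))   ≡⟨ Σ-cong (suc M) (λ n _ → solve 1 (λ a → a :* (k1 :- k1) := k0 :* a) refl ([4n+1]t n)) ⟩
    Σ (suc M) (λ n → ⟦ 0 ⟧ * [4n+1]t n)             ≡⟨ Σ-*ˡ (suc M) ⟦ 0 ⟧ [4n+1]t ⟩
    ⟦ 0 ⟧ * Σ (suc M) [4n+1]t                       ≡⟨ solve 2 (λ a b → k0 :* a := b :* k0) refl (Σ (suc M) [4n+1]t) (t M * cube (odd M)) ⟩
    t M * cube (odd M) * ⟦ 0 ⟧ ∎
  wz-sum M (suc K) = begin
    Σ (suc M) (λ n → [4n+1]t n * (⟦ 1 ⟧ - wzF (dbl n) (suc K)))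
      ≡⟨ Σ-cong (suc M) (λ n _ → solve 3 (λ a b c → a :* (k1 :- c) := a :* (k1 :- b) :+ a :* (b :- c)) refl ([4n+1]t n) (wzF (dbl n) K) (wzF (dbl n) (suc K))) ⟩
    Σ (suc M) (λ n → [4n+1]t n * (⟦ 1 ⟧ - wzF (dbl n) K) + [4n+1]t n * (wzF (dbl n) K - wzF (dbl n) (suc K)))
      ≡⟨ Σ-+ (suc M) (λ n → [4n+1]t n * (⟦ 1 ⟧ - wzF (dbl n) K)) (λ n → [4n+1]t n * (wzF (dbl n) K - wzF (dbl n) (suc K))) ⟩
    Σ (suc M) (λ n → [4n+1]t n * (⟦ 1 ⟧ - wzF (dbl n) K)) + Σ (suc M) (λ n → [4n+1]t n * (wzF (dbl n) K - wzF (dbl n) (suc K)))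
      ≡⟨ cong₂ _+_ (wz-sum M K) (wz-telescope M K) ⟩
    t M * cube (odd M) * Σ K (wzG (dbl M)) + t M * cube (odd M) * wzG (dbl M) K
      ≡⟨ ℚ.*-distribˡ-+ (t M * cube (odd M)) (Σ K (wzG (dbl M))) (wzG (dbl M) K) ⟨
    t M * cube (odd M) * Σ (suc K) (wzG (dbl M)) ∎

  -- K = M + 1 is the first value for which `wzF (dbl n) K` vanishes for every n ≤ M.
  Σ-[4n+1]t : ∀ M → Σ (suc M) [4n+1]t ≡ t M * cube (odd M) * Σ (suc M) (wzG (dbl M))
  Σ-[4n+1]t M = trans (Σ-cong (suc M) λ n n<1+M → trans (solve 1 (λ a → a := a :* (k1 :- k0)) refl ([4n+1]t n))
      (cong (λ c → [4n+1]t n * (⟦ 1 ⟧ - c)) (sym (wzF-zero n (suc M) n<1+M))))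
    (wz-sum M (suc M))

  -- Binomial coefficients and the summands of the statement.

  *-cancel : ∀ a b c → a * b ≡ ⟦ 1 ⟧ → ∀ {x} → b * x ≡ c → x ≡ a * c
  *-cancel a b c ab≡1 {x} bx≡c = begin
    x              ≡⟨ solve 1 (λ x → x := k1 :* x) refl x ⟩
    ⟦ 1 ⟧ * x      ≡⟨ cong (_* x) ab≡1 ⟨
    a * b * x      ≡⟨ ℚ.*-assoc a b x ⟩
    a * (b * x)    ≡⟨ cong (a *_) bx≡c ⟩
    a * c          ∎

  B : ℕ → ℕ → ℚ
  B n k = ⟦ n C k ⟧

  B-pascal : ∀ n k → B (suc n) (suc k) ≡ B n k + B n (suc k)
  B-pascal n k = trans (cong ⟦_⟧ (sym (nCk+nC[k+1]≡[n+1]C[k+1] n k))) (⟨+⟩ (n C k) (n C suc k))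

  B-> : ∀ {n k} → n ℕ.< k → B n k ≡ ⟦ 0 ⟧
  B-> n<k = cong ⟦_⟧ (k>n⇒nCk≡0 n<k)

  -- Mutual induction with `B-absorb`: absorption at n follows from Pascal's rule and `B-suc` at n,
  -- and `B-suc` at n + 1 from both at n. The subtraction is in ℚ, so for k > n the identity reads 0
  -- = 0.
  B-suc : ∀ n k → ⟦ suc k ⟧ * B n (suc k) ≡ (⟦ n ⟧ - ⟦ k ⟧) * B n k
  B-absorb : ∀ n k → ⟦ suc k ⟧ * B (suc n) (suc k) ≡ ⟦ suc n ⟧ * B n k

  B-absorb n k = begin
    ⟦ suc k ⟧ * B (suc n) (suc k)                     ≡⟨ cong (⟦ suc k ⟧ *_) (B-pascal n k) ⟩
    ⟦ suc k ⟧ * (B n k + B n (suc k))                 ≡⟨ ℚ.*-distribˡ-+ ⟦ suc k ⟧ (B n k) (B n (suc k)) ⟩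
    ⟦ suc k ⟧ * B n k + ⟦ suc k ⟧ * B n (suc k)       ≡⟨ cong₂ (λ s b → s * B n k + b) (⟨suc⟩ k) (B-suc n k) ⟩
    (⟦ 1 ⟧ + ⟦ k ⟧) * B n k + (⟦ n ⟧ - ⟦ k ⟧) * B n k
      ≡⟨ solve 3 (λ k n b → (k1 :+ k) :* b :+ (n :- k) :* b := (k1 :+ n) :* b) refl ⟦ k ⟧ ⟦ n ⟧ (B n k) ⟩
    (⟦ 1 ⟧ + ⟦ n ⟧) * B n k                           ≡⟨ cong (_* B n k) (⟨suc⟩ n) ⟨
    ⟦ suc n ⟧ * B n k                                 ∎

  B-suc zero zero = solve 0 (k1 :* k0 := (k0 :- k0) :* k1) refl
  B-suc zero (suc k) = trans (cong (⟦ suc (suc k) ⟧ *_) (B-> {0} {suc (suc k)} (s≤s z≤n)))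
    (trans (solve 2 (λ a b → a :* k0 := b :* k0) refl ⟦ suc (suc k) ⟧ (⟦ 0 ⟧ - ⟦ suc k ⟧))
           (cong ((⟦ 0 ⟧ - ⟦ suc k ⟧) *_) (sym (B-> {0} {suc k} (s≤s z≤n)))))
  B-suc (suc n) zero = trans (B-absorb n 0) (solve 1 (λ n → n :* k1 := (n :- k0) :* k1) refl ⟦ suc n ⟧)
  B-suc (suc n) (suc k) = begin
    ⟦ suc (suc k) ⟧ * B (suc n) (suc (suc k))   ≡⟨ B-absorb n (suc k) ⟩
    ⟦ suc n ⟧ * B n (suc k)                     ≡⟨ cong (_* B n (suc k)) (⟨suc⟩ n) ⟩
    (⟦ 1 ⟧ + ⟦ n ⟧) * B n (suc k)
      ≡⟨ solve 3 (λ k n b → (k1 :+ n) :* b := (k1 :+ k) :* b :+ (n :- k) :* b) refl ⟦ k ⟧ ⟦ n ⟧ (B n (suc k)) ⟩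
    (⟦ 1 ⟧ + ⟦ k ⟧) * B n (suc k) + (⟦ n ⟧ - ⟦ k ⟧) * B n (suc k)
      ≡⟨ cong (_+ (⟦ n ⟧ - ⟦ k ⟧) * B n (suc k)) (trans (cong (_* B n (suc k)) (sym (⟨suc⟩ k))) (B-suc n k)) ⟩
    (⟦ n ⟧ - ⟦ k ⟧) * B n k + (⟦ n ⟧ - ⟦ k ⟧) * B n (suc k)
      ≡⟨ solve 4 (λ n k a b → (n :- k) :* a :+ (n :- k) :* b := (k1 :+ n :- (k1 :+ k)) :* (a :+ b)) refl ⟦ n ⟧ ⟦ k ⟧ (B n k) (B n (suc k)) ⟩
    (⟦ 1 ⟧ + ⟦ n ⟧ - (⟦ 1 ⟧ + ⟦ k ⟧)) * (B n k + B n (suc k))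
      ≡⟨ cong₂ (λ a b → a * b) (cong₂ _-_ (sym (⟨suc⟩ n)) (sym (⟨suc⟩ k))) (sym (B-pascal n k)) ⟩
    (⟦ suc n ⟧ - ⟦ suc k ⟧) * B (suc n) (suc k) ∎

  -- C(2k+2,k+1) is the sum of the two middle entries x and y of row 2k + 1. Multiplied by k + 1
  -- each of them is (2k+1) C(2k,k): y by absorption, x because it agrees with y.
  central : ∀ k → B (2 ℕ.* suc k) (suc k) ≡ ⟦ 4 ⟧ * ρ k * B (2 ℕ.* k) k
  central k = begin
    B (2 ℕ.* suc k) (suc k)                     ≡⟨ *-cancel (even⁻¹ k) (even k) (⟦ 4 ⟧ * (odd k * b)) (trans (ℚ.*-comm (even⁻¹ k) (even k)) (even-inv k)) even*B ⟩
    even⁻¹ k * (⟦ 4 ⟧ * (odd k * b))            ≡⟨ solve 3 (λ e o b → e :* (con (+ 4) :* (o :* b)) := con (+ 4) :* (o :* e) :* b) refl (even⁻¹ k) (odd k) b ⟩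
    ⟦ 4 ⟧ * ρ k * b                             ∎
    where
    m = 2 ℕ.* k
    b = B m k
    x = B (suc m) k
    y = B (suc m) (suc k)
    s = ⟦ suc k ⟧
    s≡ : s ≡ ⟦ 1 ⟧ + ⟦ k ⟧
    s≡ = ⟨suc⟩ k
    sy≡sx : s * y ≡ s * x
    sy≡sx = trans (B-suc (suc m) k) (cong (_* x) (begin
      ⟦ suc m ⟧ - ⟦ k ⟧       ≡⟨ cong (_- ⟦ k ⟧) (⟨odd⟩ k) ⟩
      odd k - ⟦ k ⟧           ≡⟨ solve 1 (λ k → k1 :+ con (+ 2) :* k :- k := k1 :+ k) refl ⟦ k ⟧ ⟩
      ⟦ 1 ⟧ + ⟦ k ⟧           ≡⟨ s≡ ⟨
      s                       ∎))
    sy≡ : s * y ≡ odd k * b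
    sy≡ = trans (B-absorb m k) (cong (_* b) (⟨odd⟩ k))
    even*B : even k * B (2 ℕ.* suc k) (suc k) ≡ ⟦ 4 ⟧ * (odd k * b)
    even*B = begin
      even k * B (2 ℕ.* suc k) (suc k)
        ≡⟨ cong (λ n → even k * B n (suc k)) (ℕ.*-suc 2 k) ⟩
      even k * B (suc (suc m)) (suc k)         ≡⟨ cong (even k *_) (B-pascal (suc m) k) ⟩
      even k * (x + y)
        ≡⟨ solve 3 (λ k x y → (con (+ 2) :+ con (+ 2) :* k) :* (x :+ y) := con (+ 2) :* ((k1 :+ k) :* x :+ (k1 :+ k) :* y)) refl ⟦ k ⟧ x y ⟩
      ⟦ 2 ⟧ * ((⟦ 1 ⟧ + ⟦ k ⟧) * x + (⟦ 1 ⟧ + ⟦ k ⟧) * y)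
        ≡⟨ cong (λ s → ⟦ 2 ⟧ * (s * x + s * y)) s≡ ⟨
      ⟦ 2 ⟧ * (s * x + s * y)                  ≡⟨ cong₂ (λ a b → ⟦ 2 ⟧ * (a + b)) (trans (sym sy≡sx) sy≡) sy≡ ⟩
      ⟦ 2 ⟧ * (odd k * b + odd k * b)          ≡⟨ solve 1 (λ z → con (+ 2) :* (z :+ z) := con (+ 4) :* z) refl (odd k * b) ⟩
      ⟦ 4 ⟧ * (odd k * b)                      ∎

  t-central : ∀ k → t k * ι (-64^ k) ≡ cube (B (2 ℕ.* k) k)
  t-central zero    = solve 0 (k1 :* k1 := k1 :* k1 :* k1) refl
  t-central (suc k) = begin
    - cube r * t k * ι (-64^ suc k)        ≡⟨ cong (- cube r * t k *_) (ι-* -[1+ 63 ] (-64^ k)) ⟩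
    - cube r * t k * (ι -[1+ 63 ] * ι (-64^ k))
      ≡⟨ solve 3 (λ r t z → let c = λ x → x :* x :* x in :- c r :* t :* (con -[1+ 63 ] :* z) := con (+ 64) :* c r :* (t :* z)) refl r (t k) (ι (-64^ k)) ⟩
    ⟦ 64 ⟧ * cube r * (t k * ι (-64^ k))   ≡⟨ cong (⟦ 64 ⟧ * cube r *_) (t-central k) ⟩
    ⟦ 64 ⟧ * cube r * cube b
      ≡⟨ solve 2 (λ r b → let c = λ x → x :* x :* x in con (+ 64) :* c r :* c b := c (con (+ 4) :* r :* b)) refl r b ⟩
    cube (⟦ 4 ⟧ * r * b)                   ≡⟨ cong cube (sym (central k)) ⟩
    cube (B (2 ℕ.* suc k) (suc k))         ∎
    where
    r = ρ k
    b = B (2 ℕ.* k) k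

  [4n+1]t-central : ∀ k → [4n+1]t k * ι (-64^ k) ≡ ι (+ ((4 ℕ.* k ℕ.+ 1) ℕ.* ((2 ℕ.* k) C k) ℕ.^ 3))
  [4n+1]t-central k = begin
    (⟦ 2 ⟧ * (⟦ 2 ⟧ * ⟦ k ⟧) + ⟦ 1 ⟧) * t k * ι (-64^ k)
      ≡⟨ solve 3 (λ k t z → (con (+ 2) :* (con (+ 2) :* k) :+ k1) :* t :* z := (con (+ 4) :* k :+ k1) :* (t :* z)) refl ⟦ k ⟧ (t k) (ι (-64^ k)) ⟩
    (⟦ 4 ⟧ * ⟦ k ⟧ + ⟦ 1 ⟧) * (t k * ι (-64^ k))
      ≡⟨ cong₂ _*_ (trans (cong (_+ ⟦ 1 ⟧) (sym (⟨*⟩ 4 k))) (sym (⟨+⟩ (4 ℕ.* k) 1))) (t-central k) ⟩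
    ⟦ 4 ℕ.* k ℕ.+ 1 ⟧ * cube ⟦ c ⟧
      ≡⟨ cong (⟦ 4 ℕ.* k ℕ.+ 1 ⟧ *_) ⟨c³⟩ ⟨
    ⟦ 4 ℕ.* k ℕ.+ 1 ⟧ * ⟦ c ℕ.^ 3 ⟧
      ≡⟨ ⟨*⟩ (4 ℕ.* k ℕ.+ 1) (c ℕ.^ 3) ⟨
    ⟦ (4 ℕ.* k ℕ.+ 1) ℕ.* c ℕ.^ 3 ⟧ ∎
    where
    c = (2 ℕ.* k) C k
    ⟨c³⟩ : ⟦ c ℕ.^ 3 ⟧ ≡ cube ⟦ c ⟧
    ⟨c³⟩ = trans (⟨*⟩ c (c ℕ.* (c ℕ.* 1))) (trans (cong (⟦ c ⟧ *_) (trans (⟨*⟩ c (c ℕ.* 1)) (cong (⟦ c ⟧ *_) (⟨*⟩ c 1))))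
      (solve 1 (λ c → c :* (c :* (c :* k1)) := c :* c :* c) refl ⟦ c ⟧))

  term≡[4n+1]t : ∀ k → term k ≡ [4n+1]t k
  term≡[4n+1]t k = begin
    fromℤ m * w                          ≡⟨ cong (_* w) (ι≡fromℤ m) ⟨
    ι m * w                              ≡⟨ cong (_* w) ([4n+1]t-central k) ⟨
    [4n+1]t k * ι (-64^ k) * w                ≡⟨ ℚ.*-assoc ([4n+1]t k) (ι (-64^ k)) w ⟩
    [4n+1]t k * (ι (-64^ k) * w)              ≡⟨ cong (λ z → [4n+1]t k * (z * w)) (ι≡fromℤ (-64^ k)) ⟩
    [4n+1]t k * (fromℤ (-64^ k) * w)          ≡⟨ cong ([4n+1]t k *_) (ℚ.*-inverseʳ (fromℤ (-64^ k)) {{nonZero-64^ k}}) ⟩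
    [4n+1]t k * 1ℚ                            ≡⟨ ℚ.*-identityʳ ([4n+1]t k) ⟩
    [4n+1]t k                                 ∎
    where
    m = + ((4 ℕ.* k ℕ.+ 1) ℕ.* ((2 ℕ.* k) C k) ℕ.^ 3)
    w = (ℚ.1/ fromℤ (-64^ k)) {{nonZero-64^ k}}

  sum≡Σ : ∀ n (f : ℕ → ℚ) → sum ℚ.+-0-rawMonoid {n} (f ∘ toℕ) ≡ Σ n f
  sum≡Σ zero    f = sym ⟨0⟩
  sum≡Σ (suc n) f = trans (cong (λ s → f 0 + s) (sum≡Σ n (f ∘ suc))) (sym (Σ-head n f))

  ∑term : ∀ n → ∑ℚ[k≤ n ] term ≡ Σ (suc n) [4n+1]t
  ∑term n = trans (sum≡Σ (suc n) term) (Σ-cong (suc n) λ k _ → term≡[4n+1]t k)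

  -- Powers and signs.

  pow : ℚ → ℕ → ℚ
  pow x zero    = ⟦ 1 ⟧
  pow x (suc n) = x * pow x n

  sgn : ℕ → ℚ
  sgn = pow (- ⟦ 1 ⟧)

  sgn-suc : ∀ n → sgn (suc n) ≡ - sgn n
  sgn-suc n = solve 1 (λ s → :- k1 :* s := :- s) refl (sgn n)

  pow-one : ∀ n → pow ⟦ 1 ⟧ n ≡ ⟦ 1 ⟧
  pow-one zero    = refl
  pow-one (suc n) = trans (cong (⟦ 1 ⟧ *_) (pow-one n)) (solve 0 (k1 :* k1 := k1) refl)

  pow-+ : ∀ x m n → pow x (m ℕ.+ n) ≡ pow x m * pow x n
  pow-+ x zero    n = solve 1 (λ y → y := k1 :* y) refl (pow x n)
  pow-+ x (suc m) n = trans (cong (x *_) (pow-+ x m n)) (sym (ℚ.*-assoc x (pow x m) (pow x n)))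

  pow-* : ∀ x y n → pow (x * y) n ≡ pow x n * pow y n
  pow-* x y zero    = solve 0 (k1 := k1 :* k1) refl
  pow-* x y (suc n) = trans (cong (x * y *_) (pow-* x y n))
    (solve 4 (λ x y a b → x :* y :* (a :* b) := x :* a :* (y :* b)) refl x y (pow x n) (pow y n))

  pow-neg-even : ∀ x n → pow (- x) (2 ℕ.* n) ≡ pow x (2 ℕ.* n)
  pow-neg-even x zero    = refl
  pow-neg-even x (suc n) = begin
    pow (- x) (2 ℕ.* suc n)             ≡⟨ cong (pow (- x)) (ℕ.*-suc 2 n) ⟩
    - x * (- x * pow (- x) (2 ℕ.* n))   ≡⟨ cong (λ e → - x * (- x * e)) (pow-neg-even x n) ⟩
    - x * (- x * pow x (2 ℕ.* n))       ≡⟨ solve 2 (λ x y → :- x :* (:- x :* y) := x :* (x :* y)) refl x (pow x (2 ℕ.* n)) ⟩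
    pow x (2 ℕ.+ 2 ℕ.* n)               ≡⟨ cong (pow x) (ℕ.*-suc 2 n) ⟨
    pow x (2 ℕ.* suc n)                 ∎

  sgn-even : ∀ n → sgn (2 ℕ.* n) ≡ ⟦ 1 ⟧
  sgn-even n = trans (pow-neg-even ⟦ 1 ⟧ n) (pow-one (2 ℕ.* n))

  sgn² : ∀ n → sgn n * sgn n ≡ ⟦ 1 ⟧
  sgn² n = trans (sym (pow-+ (- ⟦ 1 ⟧) n n)) (trans (cong sgn (cong (n ℕ.+_) (sym (ℕ.+-identityʳ n)))) (sgn-even n))

  -- Alternating sums of reciprocal binomial coefficients.

  C≢0 : ∀ {n k} → k ℕ.≤ n → ℕ.NonZero (n C k)
  C≢0 {n}     {zero}  _           = _
  C≢0 {suc n} {suc k} (s≤s k≤n) = subst ℕ.NonZero (nCk+nC[k+1]≡[n+1]C[k+1] n k) (nonZero-+ (n C k) {{C≢0 k≤n}})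
    where
    nonZero-+ : ∀ a {b} .{{_ : ℕ.NonZero a}} → ℕ.NonZero (a ℕ.+ b)
    nonZero-+ (suc a) = _

  -- With j = k + 1, v n k is (-1)^j / (j² C(n,j)); its difference in n telescopes
  -- in k with primitive w n k / (n+1)².
  w : ℕ → ℕ → ℚ
  w n k = sgn k * inv (n C k)

  v : ℕ → ℕ → ℚ
  v n k = sgn (suc k) * (inv (suc k) * inv (suc k) * inv (n C suc k))

  -- Pascal's rule and absorption give (1/C(n,k+1) - 1/C(n+1,k+1)) / (k+1)² = (1/C(n,k) +
  -- 1/C(n,k+1)) / (n+1)², which is `key`. The alternating sign turns the sum of neighbours into a
  -- difference of `w`.
  v-step : ∀ {n k} → k ℕ.< n → v (suc n) k ≡ v n k + inv (suc n) * inv (suc n) * (w n k - w n (suc k))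
  v-step {n} {k} k<n = begin
    sgn (suc k) * (ik * ik * ic)
      ≡⟨ cong (_* (ik * ik * ic)) (sgn-suc k) ⟩
    - s * (ik * ik * ic)
      ≡⟨ solve 4 (λ s ik ib ic → :- s :* (ik :* ik :* ic) := :- s :* (ik :* ik :* ib) :+ s :* (ik :* ik :* (ib :- ic))) refl s ik ib ic ⟩
    - s * (ik * ik * ib) + s * (ik * ik * (ib - ic))
      ≡⟨ cong (λ e → - s * (ik * ik * ib) + s * e) key ⟩
    - s * (ik * ik * ib) + s * (i * i * (ia + ib))
      ≡⟨ cong (λ e → - s * (ik * ik * ib) + e) (solve 4 (λ s i ia ib → s :* (i :* i :* (ia :+ ib)) := i :* i :* (s :* ia :- :- s :* ib)) refl s i ia ib) ⟩
    - s * (ik * ik * ib) + i * i * (s * ia - - s * ib)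
      ≡⟨ cong (λ e → e * (ik * ik * ib) + i * i * (s * ia - e * ib)) (sgn-suc k) ⟨
    v n k + i * i * (w n k - w n (suc k)) ∎
    where
    s = sgn k
    a = n C k
    b = n C suc k
    c = suc n C suc k
    ia = inv a
    ib = inv b
    ic = inv c
    ik = inv (suc k)
    i = inv (suc n)
    instance
      _ = C≢0 {n} {k} (ℕ.<⇒≤ k<n)
      _ = C≢0 {n} {suc k} k<n
      _ = C≢0 {suc n} {suc k} (s≤s (ℕ.<⇒≤ k<n))
    ic≡ : i * ⟦ c ⟧ ≡ ⟦ a ⟧ * ik
    ic≡ = begin
      i * ⟦ c ⟧                              ≡⟨ solve 2 (λ i c → i :* c := i :* c :* k1) refl i ⟦ c ⟧ ⟩
      i * ⟦ c ⟧ * ⟦ 1 ⟧                      ≡⟨ cong (i * ⟦ c ⟧ *_) (*-inv (suc k)) ⟨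
      i * ⟦ c ⟧ * (⟦ suc k ⟧ * ik)           ≡⟨ solve 4 (λ i c s k → i :* c :* (s :* k) := i :* k :* (s :* c)) refl i ⟦ c ⟧ ⟦ suc k ⟧ ik ⟩
      i * ik * (⟦ suc k ⟧ * ⟦ c ⟧)           ≡⟨ cong (i * ik *_) (B-absorb n k) ⟩
      i * ik * (⟦ suc n ⟧ * ⟦ a ⟧)           ≡⟨ solve 4 (λ i k n a → i :* k :* (n :* a) := n :* i :* (a :* k)) refl i ik ⟦ suc n ⟧ ⟦ a ⟧ ⟩
      ⟦ suc n ⟧ * i * (⟦ a ⟧ * ik)           ≡⟨ cong (_* (⟦ a ⟧ * ik)) (*-inv (suc n)) ⟩
      ⟦ 1 ⟧ * (⟦ a ⟧ * ik)                   ≡⟨ solve 1 (λ x → k1 :* x := x) refl (⟦ a ⟧ * ik) ⟩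
      ⟦ a ⟧ * ik                             ∎
    ib-ic : ib - ic ≡ ⟦ a ⟧ * ib * ic
    ib-ic = begin
      ib - ic                                          ≡⟨ solve 2 (λ x y → x :- y := x :* k1 :- y :* k1) refl ib ic ⟩
      ib * ⟦ 1 ⟧ - ic * ⟦ 1 ⟧                          ≡⟨ cong₂ (λ x y → ib * x - ic * y) (*-inv c) (*-inv b) ⟨
      ib * (⟦ c ⟧ * ic) - ic * (⟦ b ⟧ * ib)            ≡⟨ cong (λ x → ib * (x * ic) - ic * (⟦ b ⟧ * ib)) (B-pascal n k) ⟩
      ib * ((⟦ a ⟧ + ⟦ b ⟧) * ic) - ic * (⟦ b ⟧ * ib)  ≡⟨ solve 4 (λ a b x y → x :* ((a :+ b) :* y) :- y :* (b :* x) := a :* x :* y) refl ⟦ a ⟧ ⟦ b ⟧ ib ic ⟩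
      ⟦ a ⟧ * ib * ic                                  ∎
    ia+ib : ia + ib ≡ ⟦ c ⟧ * ia * ib
    ia+ib = begin
      ia + ib                                          ≡⟨ solve 2 (λ x y → x :+ y := x :* k1 :+ y :* k1) refl ia ib ⟩
      ia * ⟦ 1 ⟧ + ib * ⟦ 1 ⟧                          ≡⟨ cong₂ (λ x y → ia * x + ib * y) (*-inv b) (*-inv a) ⟨
      ia * (⟦ b ⟧ * ib) + ib * (⟦ a ⟧ * ia)            ≡⟨ solve 4 (λ a b x y → x :* (b :* y) :+ y :* (a :* x) := (a :+ b) :* x :* y) refl ⟦ a ⟧ ⟦ b ⟧ ia ib ⟩
      (⟦ a ⟧ + ⟦ b ⟧) * ia * ib                        ≡⟨ cong (λ x → x * ia * ib) (B-pascal n k) ⟨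
      ⟦ c ⟧ * ia * ib                                  ∎
    key : ik * ik * (ib - ic) ≡ i * i * (ia + ib)
    key = begin
      ik * ik * (ib - ic)                       ≡⟨ cong (ik * ik *_) ib-ic ⟩
      ik * ik * (⟦ a ⟧ * ib * ic)               ≡⟨ solve 4 (λ k a b c → k :* k :* (a :* b :* c) := k :* (a :* k) :* b :* c) refl ik ⟦ a ⟧ ib ic ⟩
      ik * (⟦ a ⟧ * ik) * ib * ic               ≡⟨ cong (λ e → ik * e * ib * ic) ic≡ ⟨
      ik * (i * ⟦ c ⟧) * ib * ic                ≡⟨ solve 5 (λ k i c b d → k :* (i :* c) :* b :* d := k :* i :* b :* (c :* d)) refl ik i ⟦ c ⟧ ib ic ⟩
      ik * i * ib * (⟦ c ⟧ * ic)                ≡⟨ cong (ik * i * ib *_) (trans (*-inv c) (sym (*-inv a))) ⟩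
      ik * i * ib * (⟦ a ⟧ * ia)                ≡⟨ solve 5 (λ k i a b x → k :* i :* b :* (a :* x) := (a :* k) :* i :* x :* b) refl ik i ⟦ a ⟧ ib ia ⟩
      ⟦ a ⟧ * ik * i * ia * ib                  ≡⟨ cong (λ e → e * i * ia * ib) ic≡ ⟨
      i * ⟦ c ⟧ * i * ia * ib                   ≡⟨ solve 4 (λ i c a b → i :* c :* i :* a :* b := i :* i :* (c :* a :* b)) refl i ⟦ c ⟧ ia ib ⟩
      i * i * (⟦ c ⟧ * ia * ib)                 ≡⟨ cong (i * i *_) ia+ib ⟨
      i * i * (ia + ib)                         ∎

  inv²-alt : ℕ → ℚ
  inv²-alt k = (⟦ 1 ⟧ + ⟦ 2 ⟧ * sgn (suc k)) * (inv (suc k) * inv (suc k))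

  inv1 : inv 1 ≡ ⟦ 1 ⟧
  inv1 = odd⁻¹0

  w-0 : ∀ n → w n 0 ≡ ⟦ 1 ⟧
  w-0 n = trans (cong (⟦ 1 ⟧ *_) inv1) (solve 0 (k1 :* k1 := k1) refl)

  w-n : ∀ n → w n n ≡ sgn n
  w-n n = trans (cong (λ c → sgn n * inv c) (nCn≡1 n)) (trans (cong (sgn n *_) inv1) (solve 1 (λ s → s :* k1 := s) refl (sgn n)))

  -- From n to n + 1 the old terms change by (1 - (-1)^n) / (n+1)² after telescoping, and the new
  -- last term is -(-1)^n / (n+1)². Together they are (1 + 2(-1)^(n+1)) / (n+1)².
  Σ-v : ∀ n → Σ n (v n) ≡ Σ n inv²-alt
  Σ-v zero    = refl
  Σ-v (suc n) = begin
    Σ n (v (suc n)) + v (suc n) n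
      ≡⟨ cong₂ _+_ (Σ-cong n λ k k<n → v-step k<n) v-last ⟩
    Σ n (λ k → v n k + i * i * (w n k - w n (suc k))) + - sgn n * (i * i)
      ≡⟨ cong (_+ - sgn n * (i * i)) (Σ-+ n (v n) (λ k → i * i * (w n k - w n (suc k)))) ⟩
    Σ n (v n) + Σ n (λ k → i * i * (w n k - w n (suc k))) + - sgn n * (i * i)
      ≡⟨ cong₂ (λ a b → a + b + - sgn n * (i * i)) (Σ-v n)
           (trans (Σ-*ˡ n (i * i) (λ k → w n k - w n (suc k))) (cong (i * i *_)
             (trans (Σ-telescope n (w n)) (cong₂ _-_ (w-0 n) (w-n n))))) ⟩
    Σ n inv²-alt + i * i * (⟦ 1 ⟧ - sgn n) + - sgn n * (i * i)
      ≡⟨ solve 3 (λ a i s → a :+ i :* i :* (k1 :- s) :+ :- s :* (i :* i) := a :+ (k1 :+ con (+ 2) :* :- s) :* (i :* i)) refl (Σ n inv²-alt) i (sgn n) ⟩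
    Σ n inv²-alt + (⟦ 1 ⟧ + ⟦ 2 ⟧ * - sgn n) * (i * i)
      ≡⟨ cong (λ s → Σ n inv²-alt + (⟦ 1 ⟧ + ⟦ 2 ⟧ * s) * (i * i)) (sgn-suc n) ⟨
    Σ (suc n) inv²-alt ∎
    where
    i = inv (suc n)
    v-last : v (suc n) n ≡ - sgn n * (i * i)
    v-last = begin
      sgn (suc n) * (i * i * inv (suc n C suc n)) ≡⟨ cong₂ (λ s c → s * (i * i * inv c)) (sgn-suc n) (nCn≡1 (suc n)) ⟩
      - sgn n * (i * i * inv 1)                   ≡⟨ cong (λ c → - sgn n * (i * i * c)) inv1 ⟩
      - sgn n * (i * i * ⟦ 1 ⟧)                   ≡⟨ solve 2 (λ s i → :- s :* (i :* i :* k1) := :- s :* (i :* i)) refl (sgn n) i ⟩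
      - sgn n * (i * i)                           ∎

  -- Umbral calculus for Euler numbers

  -- T^ y r a t = L(xᵗ (x + y)ʳ) for the linear functional L with L(xᵗ) = a t.
  T^ : ℚ → ℕ → (ℕ → ℚ) → ℕ → ℚ
  T^ y zero    a t = a t
  T^ y (suc r) a t = T^ y r a (suc t) + y * T^ y r a t

  T^-cong : ∀ y r {a b : ℕ → ℚ} → (∀ t → a t ≡ b t) → ∀ t → T^ y r a t ≡ T^ y r b t
  T^-cong y zero    a≗b t = a≗b t
  T^-cong y (suc r) a≗b t = cong₂ (λ a b → a + y * b) (T^-cong y r a≗b (suc t)) (T^-cong y r a≗b t)

  T^-linear : ∀ y r c (a b : ℕ → ℚ) t → T^ y r (λ t → a t + c * b t) t ≡ T^ y r a t + c * T^ y r b t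
  T^-linear y zero    c a b t = refl
  T^-linear y (suc r) c a b t = trans
    (cong₂ (λ a b → a + y * b) (T^-linear y r c a b (suc t)) (T^-linear y r c a b t))
    (solve 6 (λ y c d e f g → d :+ c :* e :+ y :* (f :+ c :* g) := d :+ y :* f :+ c :* (e :+ y :* g)) refl
      y c (T^ y r a (suc t)) (T^ y r b (suc t)) (T^ y r a t) (T^ y r b t))

  T^-comm : ∀ y r a t → T^ y (suc r) a t ≡ T^ y r (T^ y 1 a) t
  T^-comm y zero    a t = refl
  T^-comm y (suc r) a t = cong₂ (λ a b → a + y * b) (T^-comm y r a (suc t)) (T^-comm y r a t)

  -- Under L this is the split of one factor x + y + z into (x + z) + y. It carries an identity
  -- about powers of x + z to all translates by induction on r.
  T^-shift : ∀ y z r s a → T^ (y + z) (suc r) (T^ z s a) 0 ≡ T^ (y + z) r (T^ z (suc s) a) 0 + y * T^ (y + z) r (T^ z s a) 0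
  T^-shift y z r s a = begin
    T^ (y + z) (suc r) c 0                            ≡⟨ T^-comm (y + z) r c 0 ⟩
    T^ (y + z) r (T^ (y + z) 1 c) 0
      ≡⟨ T^-cong (y + z) r (λ t → solve 4 (λ y z b c → b :+ (y :+ z) :* c := b :+ z :* c :+ y :* c) refl y z (c (suc t)) (c t)) 0 ⟩
    T^ (y + z) r (λ t → T^ z (suc s) a t + y * c t) 0 ≡⟨ T^-linear (y + z) r y (T^ z (suc s) a) c 0 ⟩
    T^ (y + z) r (T^ z (suc s) a) 0 + y * T^ (y + z) r c 0 ∎
    where c = T^ z s a

  pascal-sum : ∀ r (f : ℕ → ℚ) → Σ (suc (suc r)) (λ k → B (suc r) k * f k) ≡
               Σ (suc r) (λ k → B r k * f k) + Σ (suc r) (λ k → B r k * f (suc k))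
  pascal-sum r f = begin
    Σ (suc (suc r)) (λ k → B (suc r) k * f k)
      ≡⟨ Σ-head (suc r) (λ k → B (suc r) k * f k) ⟩
    B (suc r) 0 * f 0 + Σ (suc r) (λ k → B (suc r) (suc k) * f (suc k))
      ≡⟨ cong (λ e → B r 0 * f 0 + e) (trans (Σ-cong (suc r) λ k _ → trans (cong (_* f (suc k)) (B-pascal r k)) (ℚ.*-distribʳ-+ (f (suc k)) (B r k) (B r (suc k))))
           (Σ-+ (suc r) (λ k → B r k * f (suc k)) (λ k → B r (suc k) * f (suc k)))) ⟩
    B r 0 * f 0 + (Σ (suc r) (λ k → B r k * f (suc k)) + Σ (suc r) (λ k → B r (suc k) * f (suc k)))
      ≡⟨ solve 3 (λ a b c → a :+ (b :+ c) := (a :+ c) :+ b) refl (B r 0 * f 0) (Σ (suc r) (λ k → B r k * f (suc k))) (Σ (suc r) (λ k → B r (suc k) * f (suc k))) ⟩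
    (B r 0 * f 0 + Σ (suc r) (λ k → B r (suc k) * f (suc k))) + Σ (suc r) (λ k → B r k * f (suc k))
      ≡⟨ cong (_+ Σ (suc r) (λ k → B r k * f (suc k))) (trans (sym (Σ-head (suc r) (λ k → B r k * f k)))
           (trans (cong (λ b → Σ (suc r) (λ k → B r k * f k) + b * f (suc r)) (B-> (ℕ.n<1+n r)))
                  (solve 2 (λ a b → a :+ k0 :* b := a) refl (Σ (suc r) (λ k → B r k * f k)) (f (suc r))))) ⟩
    Σ (suc r) (λ k → B r k * f k) + Σ (suc r) (λ k → B r k * f (suc k)) ∎

  T^-binomial : ∀ y r a t → T^ y r a t ≡ Σ (suc r) (λ k → B r k * (pow y k * a (t ℕ.+ (r ∸ k))))
  T^-binomial y zero    a t = trans (cong a (sym (ℕ.+-identityʳ t))) (solve 1 (λ x → x := k0 :+ k1 :* (k1 :* x)) refl (a (t ℕ.+ 0)))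
  T^-binomial y (suc r) a t = begin
    T^ y r a (suc t) + y * T^ y r a t
      ≡⟨ cong₂ (λ a b → a + y * b) (T^-binomial y r a (suc t)) (T^-binomial y r a t) ⟩
    Σ (suc r) (λ k → B r k * (pow y k * a (suc t ℕ.+ (r ∸ k)))) + y * Σ (suc r) (λ k → B r k * (pow y k * a (t ℕ.+ (r ∸ k))))
      ≡⟨ cong₂ _+_ (Σ-cong (suc r) λ k k<1+r → cong (λ e → B r k * (pow y k * a e))
             (trans (sym (ℕ.+-suc t (r ∸ k))) (cong (t ℕ.+_) (sym (ℕ.+-∸-assoc 1 (ℕ.≤-pred k<1+r))))))
           (trans (sym (Σ-*ˡ (suc r) y (λ k → B r k * (pow y k * a (t ℕ.+ (r ∸ k))))))
             (Σ-cong (suc r) λ k _ → solve 4 (λ y b p a → y :* (b :* (p :* a)) := b :* (y :* p :* a)) refl y (B r k) (pow y k) (a (t ℕ.+ (r ∸ k))))) ⟩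
    Σ (suc r) (λ k → B r k * f k) + Σ (suc r) (λ k → B r k * f (suc k))
      ≡⟨ pascal-sum r f ⟨
    Σ (suc (suc r)) (λ k → B (suc r) k * f k) ∎
    where
    f : ℕ → ℚ
    f k = pow y k * a (t ℕ.+ (suc r ∸ k))

  -- The case where L is evaluation at the number x. Together with `T^-binomial` it is the binomial
  -- theorem.
  T^-pow : ∀ x y r t → T^ y r (pow x) t ≡ pow (x + y) r * pow x t
  T^-pow x y zero    t = solve 1 (λ a → a := k1 :* a) refl (pow x t)
  T^-pow x y (suc r) t = trans (cong₂ (λ a b → a + y * b) (T^-pow x y r (suc t)) (T^-pow x y r t))
    (solve 4 (λ x y a b → a :* (x :* b) :+ y :* (a :* b) := (x :+ y) :* a :* b) refl x y (pow (x + y) r) (pow x t))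

  parity : ∀ n → (∃ λ m → n ≡ 2 ℕ.* m) ⊎ (∃ λ m → n ≡ suc (2 ℕ.* m))
  parity zero    = inj₁ (0 , refl)
  parity (suc n) with parity n
  ... | inj₁ (m , eq) = inj₂ (m , cong suc eq)
  ... | inj₂ (m , eq) = inj₁ (suc m , trans (cong suc eq) (sym (ℕ.*-suc 2 m)))

  -- The indicator of even k is (1 + (-1)^k) / 2. Doubled, it splits the defining recurrence of E
  -- into binomial sums with shifts 1 and -1.
  ι-ifEven : ∀ k x → ⟦ 2 ⟧ * ι (ifEven k x) ≡ (⟦ 1 ⟧ + sgn k) * ι x
  ι-ifEven k x = split (2 ∣? k)
    where
    split : (2∣k? : Dec (2 ∣ k)) → ⟦ 2 ⟧ * ι (if does 2∣k? then x else 0ℤ) ≡ (⟦ 1 ⟧ + sgn k) * ι x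
    split (yes (divides q eq)) = trans (solve 1 (λ x → con (+ 2) :* x := (k1 :+ k1) :* x) refl (ι x))
      (cong (λ s → (⟦ 1 ⟧ + s) * ι x) (sym (trans (cong sgn (trans eq (ℕ.*-comm q 2))) (sgn-even q))))
    split (no 2∤k) with parity k
    ... | inj₁ (m , eq) = contradiction (divides m (trans eq (ℕ.*-comm 2 m))) 2∤k
    ... | inj₂ (m , eq) = trans (solve 1 (λ x → con (+ 2) :* k0 := (k1 :+ :- k1 :* k1) :* x) refl (ι x))
      (cong (λ s → (⟦ 1 ⟧ + s) * ι x) (sym (trans (cong sgn eq) (cong (- ⟦ 1 ⟧ *_) (sgn-even m)))))

  ι-sum : ∀ n (f : ℕ → ℤ) → ι (sum ℤ.+-0-rawMonoid {n} (f ∘ toℕ)) ≡ Σ n (ι ∘ f)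
  ι-sum zero    f = refl
  ι-sum (suc n) f = trans (ι-+ (f 0) (sum ℤ.+-0-rawMonoid {n} (f ∘ suc ∘ toℕ)))
    (trans (cong (λ s → ι (f 0) + s) (ι-sum n (f ∘ suc))) (sym (Σ-head n (ι ∘ f))))

  Eℚ : ℕ → ℚ
  Eℚ n = ι (E n)

  -- The defining recurrence in umbral form: (E+1)^n + (E-1)^n = 0 for n ≥ 1, where powers of E
  -- stand for Euler numbers.
  T^±1-E : ∀ s → T^ ⟦ 1 ⟧ (suc s) Eℚ 0 + T^ (- ⟦ 1 ⟧) (suc s) Eℚ 0 ≡ ⟦ 0 ⟧
  T^±1-E s = begin
    T^ ⟦ 1 ⟧ n Eℚ 0 + T^ (- ⟦ 1 ⟧) n Eℚ 0
      ≡⟨ cong₂ _+_ (T^-binomial ⟦ 1 ⟧ n Eℚ 0) (T^-binomial (- ⟦ 1 ⟧) n Eℚ 0) ⟩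
    Σ (suc n) (λ k → B n k * (pow ⟦ 1 ⟧ k * Eℚ (n ∸ k))) + Σ (suc n) (λ k → B n k * (sgn k * Eℚ (n ∸ k)))
      ≡⟨ Σ-+ (suc n) (λ k → B n k * (pow ⟦ 1 ⟧ k * Eℚ (n ∸ k))) (λ k → B n k * (sgn k * Eℚ (n ∸ k))) ⟨
    Σ (suc n) (λ k → B n k * (pow ⟦ 1 ⟧ k * Eℚ (n ∸ k)) + B n k * (sgn k * Eℚ (n ∸ k)))
      ≡⟨ Σ-cong (suc n) (λ k _ → summand k) ⟩
    Σ (suc n) (λ k → ⟦ 2 ⟧ * ι (g k))    ≡⟨ Σ-*ˡ (suc n) ⟦ 2 ⟧ (ι ∘ g) ⟩
    ⟦ 2 ⟧ * Σ (suc n) (ι ∘ g)            ≡⟨ cong (⟦ 2 ⟧ *_) (trans (sym (ι-sum (suc n) g)) (cong ι (E-recurrence n))) ⟩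
    ⟦ 2 ⟧ * ⟦ 0 ⟧                        ≡⟨ solve 0 (con (+ 2) :* k0 := k0) refl ⟩
    ⟦ 0 ⟧ ∎
    where
    n = suc s
    g : ℕ → ℤ
    g k = ifEven k (+ (n C k) ℤ.* E (n ∸ k))
    summand : ∀ k → B n k * (pow ⟦ 1 ⟧ k * Eℚ (n ∸ k)) + B n k * (sgn k * Eℚ (n ∸ k)) ≡ ⟦ 2 ⟧ * ι (g k)
    summand k = begin
      B n k * (pow ⟦ 1 ⟧ k * Eℚ (n ∸ k)) + B n k * (sgn k * Eℚ (n ∸ k))
        ≡⟨ cong (λ o → B n k * (o * Eℚ (n ∸ k)) + B n k * (sgn k * Eℚ (n ∸ k))) (pow-one k) ⟩
      B n k * (⟦ 1 ⟧ * Eℚ (n ∸ k)) + B n k * (sgn k * Eℚ (n ∸ k))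
        ≡⟨ solve 3 (λ b s e → b :* (k1 :* e) :+ b :* (s :* e) := (k1 :+ s) :* (b :* e)) refl (B n k) (sgn k) (Eℚ (n ∸ k)) ⟩
      (⟦ 1 ⟧ + sgn k) * (B n k * Eℚ (n ∸ k))
        ≡⟨ cong ((⟦ 1 ⟧ + sgn k) *_) (ι-* (+ (n C k)) (E (n ∸ k))) ⟨
      (⟦ 1 ⟧ + sgn k) * ι (+ (n C k) ℤ.* E (n ∸ k))
        ≡⟨ ι-ifEven k (+ (n C k) ℤ.* E (n ∸ k)) ⟨
      ⟦ 2 ⟧ * ι (g k) ∎

  -- e r y = Σ C(r,j) E_j y^(r-j), which is 2ʳ times the Euler polynomial at (y+1)/2.
  e : ℕ → ℚ → ℚ
  e r y = T^ y r Eℚ 0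

  -- The exponent s is general for the sake of the induction on r: `T^-shift` trades a factor E + y
  -- ± 1 for E ± 1, which raises s, plus y. The base case is the recurrence.
  e-sum′ : ∀ y r s → T^ (y + ⟦ 1 ⟧) r (T^ ⟦ 1 ⟧ (suc s) Eℚ) 0 + T^ (y + - ⟦ 1 ⟧) r (T^ (- ⟦ 1 ⟧) (suc s) Eℚ) 0 ≡ ⟦ 0 ⟧
  e-sum′ y zero    s = T^±1-E s
  e-sum′ y (suc r) s = begin
    T^ (y + ⟦ 1 ⟧) (suc r) (T^ ⟦ 1 ⟧ (suc s) Eℚ) 0 + T^ (y + - ⟦ 1 ⟧) (suc r) (T^ (- ⟦ 1 ⟧) (suc s) Eℚ) 0
      ≡⟨ cong₂ _+_ (T^-shift y ⟦ 1 ⟧ r (suc s) Eℚ) (T^-shift y (- ⟦ 1 ⟧) r (suc s) Eℚ) ⟩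
    (a + y * b) + (c + y * d)
      ≡⟨ solve 5 (λ y a b c d → (a :+ y :* b) :+ (c :+ y :* d) := (a :+ c) :+ y :* (b :+ d)) refl y a b c d ⟩
    (a + c) + y * (b + d)       ≡⟨ cong₂ (λ p q → p + y * q) (e-sum′ y r (suc s)) (e-sum′ y r s) ⟩
    ⟦ 0 ⟧ + y * ⟦ 0 ⟧           ≡⟨ solve 1 (λ y → k0 :+ y :* k0 := k0) refl y ⟩
    ⟦ 0 ⟧ ∎
    where
    a = T^ (y + ⟦ 1 ⟧) r (T^ ⟦ 1 ⟧ (suc (suc s)) Eℚ) 0
    b = T^ (y + ⟦ 1 ⟧) r (T^ ⟦ 1 ⟧ (suc s) Eℚ) 0
    c = T^ (y + - ⟦ 1 ⟧) r (T^ (- ⟦ 1 ⟧) (suc (suc s)) Eℚ) 0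
    d = T^ (y + - ⟦ 1 ⟧) r (T^ (- ⟦ 1 ⟧) (suc s) Eℚ) 0

  -- The equation E_r(x+1) + E_r(x) = 2 x^r of the Euler polynomials, in the variable y = 2x. In the
  -- step the part with an extra factor E ± 1 vanishes by `e-sum′`, and the other part contributes
  -- y.
  e-sum : ∀ r y → e r (y + ⟦ 1 ⟧) + e r (y + - ⟦ 1 ⟧) ≡ ⟦ 2 ⟧ * pow y r
  e-sum zero    y = solve 0 (k1 :+ k1 := con (+ 2) :* k1) refl
  e-sum (suc r) y = begin
    e (suc r) (y + ⟦ 1 ⟧) + e (suc r) (y + - ⟦ 1 ⟧)
      ≡⟨ cong₂ _+_ (T^-shift y ⟦ 1 ⟧ r 0 Eℚ) (T^-shift y (- ⟦ 1 ⟧) r 0 Eℚ) ⟩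
    (a + y * b) + (c + y * d)
      ≡⟨ solve 5 (λ y a b c d → (a :+ y :* b) :+ (c :+ y :* d) := (a :+ c) :+ y :* (b :+ d)) refl y a b c d ⟩
    (a + c) + y * (b + d)       ≡⟨ cong₂ (λ p q → p + y * q) (e-sum′ y r 0) (e-sum r y) ⟩
    ⟦ 0 ⟧ + y * (⟦ 2 ⟧ * pow y r)  ≡⟨ solve 2 (λ y z → k0 :+ y :* (con (+ 2) :* z) := con (+ 2) :* (y :* z)) refl y (pow y r) ⟩
    ⟦ 2 ⟧ * (y * pow y r) ∎
    where
    a = T^ (y + ⟦ 1 ⟧) r (T^ ⟦ 1 ⟧ 1 Eℚ) 0
    b = e r (y + ⟦ 1 ⟧)
    c = T^ (y + - ⟦ 1 ⟧) r (T^ (- ⟦ 1 ⟧) 1 Eℚ) 0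
    d = e r (y + - ⟦ 1 ⟧)

  -- Adding `e-sum` at y = 2n + 2 and at -y, which have the same even power r, gives a telescoping
  -- sum. Pairing y with -y makes the lower boundary e(1) + e(-1) = 2 · 0^r, which is zero because r
  -- > 0.
  alternating-powers : ∀ m n → let r = 2 ℕ.* suc m in
    Σ n (λ k → sgn (suc k) * (⟦ 4 ⟧ * pow (even k) r)) ≡ sgn n * (e r (odd n) + e r (- odd n))
  alternating-powers m zero = sym (begin
    ⟦ 1 ⟧ * (e r (odd 0) + e r (- odd 0))
      ≡⟨ cong₂ (λ a b → ⟦ 1 ⟧ * (e r a + e r b)) (solve 0 (k1 :+ con (+ 2) :* k0 := k0 :+ k1) refl) (solve 0 (:- (k1 :+ con (+ 2) :* k0) := k0 :+ :- k1) refl) ⟩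
    ⟦ 1 ⟧ * (e r (⟦ 0 ⟧ + ⟦ 1 ⟧) + e r (⟦ 0 ⟧ + - ⟦ 1 ⟧))  ≡⟨ cong (⟦ 1 ⟧ *_) (e-sum r ⟦ 0 ⟧) ⟩
    ⟦ 1 ⟧ * (⟦ 2 ⟧ * (⟦ 0 ⟧ * pow ⟦ 0 ⟧ (m ℕ.+ 1 ℕ.* suc m))) ≡⟨ solve 1 (λ z → k1 :* (con (+ 2) :* (k0 :* z)) := k0) refl (pow ⟦ 0 ⟧ (m ℕ.+ 1 ℕ.* suc m)) ⟩
    ⟦ 0 ⟧ ∎)
    where r = 2 ℕ.* suc m
  alternating-powers m (suc n) = begin
    Σ n (λ k → sgn (suc k) * (⟦ 4 ⟧ * pow (even k) r)) + sgn (suc n) * (⟦ 4 ⟧ * pow y r)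
      ≡⟨ cong₂ _+_ (alternating-powers m n) (cong (sgn (suc n) *_) (sym 4y)) ⟩
    sgn n * (e r (odd n) + e r (- odd n)) + - ⟦ 1 ⟧ * sgn n * (e r (odd (suc n)) + e r (odd n) + (e r (- odd n) + e r (- odd (suc n))))
      ≡⟨ solve 5 (λ s a b c d → s :* (a :+ b) :+ :- k1 :* s :* (c :+ a :+ (b :+ d)) := :- k1 :* s :* (c :+ d)) refl
           (sgn n) (e r (odd n)) (e r (- odd n)) (e r (odd (suc n))) (e r (- odd (suc n))) ⟩
    sgn (suc n) * (e r (odd (suc n)) + e r (- odd (suc n))) ∎
    where
    r = 2 ℕ.* suc m
    y = even n
    y+1 : y + ⟦ 1 ⟧ ≡ odd (suc n)
    y+1 = trans (solve 1 (λ k → con (+ 2) :+ con (+ 2) :* k :+ k1 := k1 :+ con (+ 2) :* (k1 :+ k)) refl ⟦ n ⟧) (cong (λ s → ⟦ 1 ⟧ + ⟦ 2 ⟧ * s) (sym (⟨suc⟩ n)))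
    y-1 : y + - ⟦ 1 ⟧ ≡ odd n
    y-1 = solve 1 (λ k → con (+ 2) :+ con (+ 2) :* k :+ :- k1 := k1 :+ con (+ 2) :* k) refl ⟦ n ⟧
    -y+1 : - y + ⟦ 1 ⟧ ≡ - odd n
    -y+1 = trans (solve 1 (λ y → :- y :+ k1 := :- (y :+ :- k1)) refl y) (cong -_ y-1)
    -y-1 : - y + - ⟦ 1 ⟧ ≡ - odd (suc n)
    -y-1 = trans (solve 1 (λ y → :- y :+ :- k1 := :- (y :+ k1)) refl y) (cong -_ y+1)
    4y : e r (odd (suc n)) + e r (odd n) + (e r (- odd n) + e r (- odd (suc n))) ≡ ⟦ 4 ⟧ * pow y r
    4y = begin
      e r (odd (suc n)) + e r (odd n) + (e r (- odd n) + e r (- odd (suc n)))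
        ≡⟨ cong₂ _+_ (cong₂ (λ a b → e r a + e r b) (sym y+1) (sym y-1)) (cong₂ (λ a b → e r a + e r b) (sym -y+1) (sym -y-1)) ⟩
      e r (y + ⟦ 1 ⟧) + e r (y + - ⟦ 1 ⟧) + (e r (- y + ⟦ 1 ⟧) + e r (- y + - ⟦ 1 ⟧))
        ≡⟨ cong₂ _+_ (e-sum r y) (trans (e-sum r (- y)) (cong (⟦ 2 ⟧ *_) (pow-neg-even y (suc m)))) ⟩
      ⟦ 2 ⟧ * pow y r + ⟦ 2 ⟧ * pow y r    ≡⟨ solve 1 (λ z → con (+ 2) :* z :+ con (+ 2) :* z := con (+ 4) :* z) refl (pow y r) ⟩
      ⟦ 4 ⟧ * pow y r ∎

  -- Finite differences of powers, for Wilson's theorem.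

  -- One step of `T^ y` sends a(t) to a(t+1) + y a(t), so y = -1 is the forward difference.
  Δ^ : ℕ → (ℕ → ℚ) → ℕ → ℚ
  Δ^ = T^ (- ⟦ 1 ⟧)

  -- Leibniz rule for the factor t, which has first difference 1 and no higher ones.
  Δ^-id* : ∀ r f s → Δ^ (suc r) (λ t → ⟦ t ⟧ * f t) s ≡
           (⟦ s ⟧ + ⟦ suc r ⟧) * Δ^ (suc r) f s + ⟦ suc r ⟧ * Δ^ r f s
  Δ^-id* zero f s = trans (cong (λ c → c * f (suc s) + - ⟦ 1 ⟧ * (⟦ s ⟧ * f s)) (⟨suc⟩ s))
    (solve 3 (λ s a b → (k1 :+ s) :* a :+ :- k1 :* (s :* b) := (s :+ k1) :* (a :+ :- k1 :* b) :+ k1 :* b) refl ⟦ s ⟧ (f (suc s)) (f s))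
  Δ^-id* (suc r) f s = trans (cong₂ (λ a b → a + - ⟦ 1 ⟧ * b) (Δ^-id* r f (suc s)) (Δ^-id* r f s))
    (trans (cong₂ (λ c d → (c + d) * X′ + d * Y′ + - ⟦ 1 ⟧ * ((⟦ s ⟧ + d) * (Y′ + - ⟦ 1 ⟧ * Y) + d * Y)) (⟨suc⟩ s) (⟨suc⟩ r))
    (trans (solve 5 (λ s r X′ Y′ Y → let d = k1 :+ r ; X = Y′ :+ :- k1 :* Y in
              ((k1 :+ s) :+ d) :* X′ :+ d :* Y′ :+ :- k1 :* ((s :+ d) :* X :+ d :* Y)
              := (s :+ (k1 :+ d)) :* (X′ :+ :- k1 :* X) :+ (k1 :+ d) :* X) refl ⟦ s ⟧ ⟦ r ⟧ X′ Y′ Y)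
      (cong (λ d → (⟦ s ⟧ + d) * Δ^ (suc (suc r)) f s + d * Δ^ (suc r) f s)
         (sym (trans (⟨suc⟩ (suc r)) (cong (λ d → ⟦ 1 ⟧ + d) (⟨suc⟩ r)))))))
    where
    X′ = Δ^ (suc r) f (suc s)
    Y′ = Δ^ r f (suc s)
    Y  = Δ^ r f s

  Δ^-pow-0 : ∀ {m r} → m ℕ.< r → ∀ s → Δ^ r (λ t → pow ⟦ t ⟧ m) s ≡ ⟦ 0 ⟧
  Δ^-pow-0 {zero}  {suc r} _         s = trans (cong (_+ - ⟦ 1 ⟧ * Δ^ r (λ _ → ⟦ 1 ⟧) s) (constant r s))
    (solve 1 (λ x → x :+ :- k1 :* x := k0) refl (Δ^ r (λ _ → ⟦ 1 ⟧) s))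
    where
    constant : ∀ r s → Δ^ r (λ _ → ⟦ 1 ⟧) (suc s) ≡ Δ^ r (λ _ → ⟦ 1 ⟧) s
    constant zero    s = refl
    constant (suc r) s = cong₂ (λ a b → a + - ⟦ 1 ⟧ * b) (constant r (suc s)) (constant r s)
  Δ^-pow-0 {suc m} {suc r} (s≤s m<r) s = trans (Δ^-id* r (λ t → pow ⟦ t ⟧ m) s)
    (trans (cong₂ (λ a b → (⟦ s ⟧ + ⟦ suc r ⟧) * a + ⟦ suc r ⟧ * b) (Δ^-pow-0 (ℕ.m<n⇒m<1+n m<r) s) (Δ^-pow-0 m<r s))
           (solve 2 (λ a b → a :* k0 :+ b :* k0 := k0) refl (⟦ s ⟧ + ⟦ suc r ⟧) ⟦ suc r ⟧))

  fac : ℕ → ℚ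
  fac n = Π n (λ k → ⟦ suc k ⟧)

  Δ^-pow-fac : ∀ r s → Δ^ r (λ t → pow ⟦ t ⟧ r) s ≡ fac r
  Δ^-pow-fac zero    s = refl
  Δ^-pow-fac (suc r) s = trans (Δ^-id* r (λ t → pow ⟦ t ⟧ r) s)
    (trans (cong₂ (λ a b → (⟦ s ⟧ + ⟦ suc r ⟧) * a + ⟦ suc r ⟧ * b) (Δ^-pow-0 (ℕ.n<1+n r) s) (Δ^-pow-fac r s))
           (solve 3 (λ a b c → a :* k0 :+ b :* c := c :* b) refl (⟦ s ⟧ + ⟦ suc r ⟧) ⟦ suc r ⟧ (fac r)))

  -- Constant sums, closed products, and a descent for `v`.

  Σ-const : ∀ n c → Σ n (λ _ → c) ≡ ⟦ n ⟧ * c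
  Σ-const zero    c = solve 1 (λ c → k0 := k0 :* c) refl c
  Σ-const (suc n) c = trans (cong (_+ c) (Σ-const n c))
    (trans (solve 2 (λ n c → n :* c :+ c := (k1 :+ n) :* c) refl ⟦ n ⟧ c) (cong (_* c) (sym (⟨suc⟩ n))))

  Π-const : ∀ n c → Π n (λ _ → c) ≡ pow c n
  Π-const zero    c = refl
  Π-const (suc n) c = trans (cong (_* c) (Π-const n c)) (ℚ.*-comm (pow c n) c)

  C-absorb : ∀ n k → suc k ℕ.* (suc n C suc k) ≡ suc n ℕ.* (n C k)
  C-absorb n k = ℤ.+-injective (ι-injective
    (trans (⟨*⟩ (suc k) (suc n C suc k)) (trans (B-absorb n k) (sym (⟨*⟩ (suc n) (n C k))))))

  t-product : ∀ n → t n ≡ sgn n * cube (Π n ρ)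
  t-product zero    = solve 0 (k1 := k1 :* (k1 :* k1 :* k1)) refl
  t-product (suc n) = trans (cong (- cube (ρ n) *_) (t-product n))
    (solve 3 (λ r s x → let c = λ x → x :* x :* x in :- c r :* (s :* c x) := :- k1 :* s :* c (x :* r)) refl (ρ n) (sgn n) (Π n ρ))

  Π-inverse : ∀ n {f g : ℕ → ℚ} → (∀ k → f k * g k ≡ ⟦ 1 ⟧) → Π n f * Π n g ≡ ⟦ 1 ⟧
  Π-inverse n {f} {g} fg≡1 = trans (sym (Π-* n f g))
    (trans (Π-cong n λ k _ → fg≡1 k) (trans (Π-const n ⟦ 1 ⟧) (pow-one n)))

  Π-ℕ : ∀ n (f : ℕ → ℕ) → ∃ λ m → Π n (λ k → ⟦ f k ⟧) ≡ ⟦ m ⟧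
  Π-ℕ zero    f = 1 , refl
  Π-ℕ (suc n) f with Π-ℕ n f
  ... | m , eq = m ℕ.* f n , trans (cong (_* ⟦ f n ⟧) eq) (sym (⟨*⟩ m (f n)))

  sgn-odd : ∀ n → sgn (suc (2 ℕ.* n)) ≡ - ⟦ 1 ⟧
  sgn-odd n = trans (cong (- ⟦ 1 ⟧ *_) (sgn-even n)) (solve 0 (:- k1 :* k1 := :- k1) refl)

  wzG-product : ∀ x n → wzG x n ≡ Π n (λ k → - ((x + odd (suc k)) * (x - ⟦ 2 ⟧ * ⟦ k ⟧) * (odd⁻¹ (suc k) * odd⁻¹ (suc k))))
  wzG-product x zero    = refl
  wzG-product x (suc n) = trans (cong (c *_) (wzG-product x n)) (ℚ.*-comm c (Π n (λ k → - ((x + odd (suc k)) * (x - ⟦ 2 ⟧ * ⟦ k ⟧) * (odd⁻¹ (suc k) * odd⁻¹ (suc k))))))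
    where c = - ((x + odd (suc n)) * (x - ⟦ 2 ⟧ * ⟦ n ⟧) * (odd⁻¹ (suc n) * odd⁻¹ (suc n)))

  -- The ratio of consecutive values of `v`, cleared of denominators. Read downwards from the top
  -- index it matches, modulo p, the ratio of consecutive values of `wzG`; this is its use in `α∼v`.
  v-descend : ∀ {n k} → suc k ℕ.< n →
    ⟦ suc k ⟧ * ⟦ suc k ⟧ * v n k ≡ - ((⟦ n ⟧ - ⟦ suc k ⟧) * ⟦ suc (suc k) ⟧ * v n (suc k))
  v-descend {n} {k} 1+k<n = begin
    s * s * (sgn (suc k) * (i * i * ia))
      ≡⟨ solve 4 (λ s g i a → s :* s :* (g :* (i :* i :* a)) := g :* ((s :* i) :* (s :* i)) :* a) refl s (sgn (suc k)) i ia ⟩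
    sgn (suc k) * ((s * i) * (s * i)) * ia    ≡⟨ cong (λ e → sgn (suc k) * (e * e) * ia) (*-inv (suc k)) ⟩
    sgn (suc k) * (⟦ 1 ⟧ * ⟦ 1 ⟧) * ia        ≡⟨ cong (sgn (suc k) * (⟦ 1 ⟧ * ⟦ 1 ⟧) *_) ia≡ ⟩
    sgn (suc k) * (⟦ 1 ⟧ * ⟦ 1 ⟧) * (d * j * ib)
      ≡⟨ solve 4 (λ g d j b → g :* (k1 :* k1) :* (d :* j :* b) := g :* d :* k1 :* j :* b) refl (sgn (suc k)) d j ib ⟩
    sgn (suc k) * d * ⟦ 1 ⟧ * j * ib          ≡⟨ cong (λ e → sgn (suc k) * d * e * j * ib) (*-inv (suc (suc k))) ⟨
    sgn (suc k) * d * (r * j) * j * ib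
      ≡⟨ solve 5 (λ g d r j b → g :* d :* (r :* j) :* j :* b := :- (d :* r :* ((:- k1 :* g) :* (j :* j :* b)))) refl (sgn (suc k)) d r j ib ⟩
    - (d * r * v n (suc k))                   ∎
    where
    s = ⟦ suc k ⟧
    r = ⟦ suc (suc k) ⟧
    i = inv (suc k)
    j = inv (suc (suc k))
    d = ⟦ n ⟧ - ⟦ suc k ⟧
    a = n C suc k
    b = n C suc (suc k)
    ia = inv a
    ib = inv b
    instance
      _ = C≢0 {n} {suc k} (ℕ.<⇒≤ 1+k<n)
      _ = C≢0 {n} {suc (suc k)} 1+k<n
    ia≡ : ia ≡ d * j * ib
    ia≡ = begin
      ia                                    ≡⟨ solve 1 (λ a → a := a :* k1 :* k1) refl ia ⟩
      ia * ⟦ 1 ⟧ * ⟦ 1 ⟧                    ≡⟨ cong₂ (λ x y → ia * x * y) (*-inv b) (*-inv (suc (suc k))) ⟨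
      ia * (⟦ b ⟧ * ib) * (r * j)           ≡⟨ solve 5 (λ a b c r j → a :* (b :* c) :* (r :* j) := a :* c :* j :* (r :* b)) refl ia ⟦ b ⟧ ib r j ⟩
      ia * ib * j * (r * ⟦ b ⟧)             ≡⟨ cong (ia * ib * j *_) (B-suc n (suc k)) ⟩
      ia * ib * j * (d * ⟦ a ⟧)             ≡⟨ solve 5 (λ x c j d a → x :* c :* j :* (d :* a) := d :* j :* c :* (a :* x)) refl ia ib j d ⟦ a ⟧ ⟩
      d * j * ib * (⟦ a ⟧ * ia)             ≡⟨ cong (d * j * ib *_) (*-inv a) ⟩
      d * j * ib * ⟦ 1 ⟧                    ≡⟨ solve 1 (λ x → x :* k1 := x) refl (d * j * ib) ⟩
      d * j * ib                            ∎

  inv-suc≡even⁻¹ : ∀ k → inv (suc k) ≡ ⟦ 2 ⟧ * even⁻¹ k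
  inv-suc≡even⁻¹ k = begin
    i                                 ≡⟨ solve 1 (λ i → i := i :* k1) refl i ⟩
    i * ⟦ 1 ⟧                         ≡⟨ cong (i *_) (*-inv (2 ℕ.* suc k)) ⟨
    i * (⟦ 2 ℕ.* suc k ⟧ * even⁻¹ k)  ≡⟨ cong (λ e → i * (e * even⁻¹ k)) (⟨*⟩ 2 (suc k)) ⟩
    i * (⟦ 2 ⟧ * ⟦ suc k ⟧ * even⁻¹ k) ≡⟨ solve 3 (λ i s e → i :* (con (+ 2) :* s :* e) := s :* i :* (con (+ 2) :* e)) refl i ⟦ suc k ⟧ (even⁻¹ k) ⟩
    ⟦ suc k ⟧ * i * (⟦ 2 ⟧ * even⁻¹ k) ≡⟨ cong (_* (⟦ 2 ⟧ * even⁻¹ k)) (*-inv (suc k)) ⟩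
    ⟦ 1 ⟧ * (⟦ 2 ⟧ * even⁻¹ k)        ≡⟨ solve 1 (λ x → k1 :* x := x) refl (⟦ 2 ⟧ * even⁻¹ k) ⟩
    ⟦ 2 ⟧ * even⁻¹ k                  ∎
    where
    i = inv (suc k)

-- p-integral rationals and congruence modulo p.

module Local (p : ℕ) (p-prime : Prime p) where
  open import Data.Rational.Base using (_+_; _*_; _-_; -_)
  open ≡-Reasoning

  Unit : ℕ → Set
  Unit n = ¬ p ∣ n

  unit-1 : Unit 1
  unit-1 p∣1 = ¬prime[1] (subst Prime (∣1⇒≡1 p∣1) p-prime)

  unit-* : ∀ {m n} → Unit m → Unit n → Unit (m ℕ.* n)
  unit-* {m} {n} um un p∣mn = [ um , un ]′ (euclidsLemma m n p-prime p∣mn)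

  unit-nonZero : ∀ {n} → Unit n → ℕ.NonZero n
  unit-nonZero {zero}  u = contradiction (divides 0 refl) u
  unit-nonZero {suc n} u = _

  -- Any denominator prime to p is accepted, not just the one in lowest terms, so that sums and
  -- products need no cancellation. `int⇒integral` recovers the reduced form.
  record Int (a : ℚ) : Set where
    constructor mkInt
    field
      den      : ℕ
      num      : ℤ
      unit     : Unit den
      fraction : a * ⟦ den ⟧ ≡ ι num

  int-ι : ∀ i → Int (ι i)
  int-ι i = mkInt 1 i unit-1 (solve 1 (λ i → i :* k1 := i) refl (ι i))

  int-+ : ∀ {a b} → Int a → Int b → Int (a + b)
  int-+ {a} {b} (mkInt d m u e) (mkInt d′ m′ u′ e′) =
    mkInt (d ℕ.* d′) (m ℤ.* + d′ ℤ.+ m′ ℤ.* + d) (unit-* u u′) (begin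
      (a + b) * ⟦ d ℕ.* d′ ⟧                       ≡⟨ cong ((a + b) *_) (⟨*⟩ d d′) ⟩
      (a + b) * (⟦ d ⟧ * ⟦ d′ ⟧)
        ≡⟨ solve 4 (λ a b d e → (a :+ b) :* (d :* e) := a :* d :* e :+ b :* e :* d) refl a b ⟦ d ⟧ ⟦ d′ ⟧ ⟩
      a * ⟦ d ⟧ * ⟦ d′ ⟧ + b * ⟦ d′ ⟧ * ⟦ d ⟧      ≡⟨ cong₂ (λ x y → x * ⟦ d′ ⟧ + y * ⟦ d ⟧) e e′ ⟩
      ι m * ⟦ d′ ⟧ + ι m′ * ⟦ d ⟧                  ≡⟨ cong₂ _+_ (ι-* m (+ d′)) (ι-* m′ (+ d)) ⟨
      ι (m ℤ.* + d′) + ι (m′ ℤ.* + d)              ≡⟨ ι-+ (m ℤ.* + d′) (m′ ℤ.* + d) ⟨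
      ι (m ℤ.* + d′ ℤ.+ m′ ℤ.* + d)                ∎)

  int-* : ∀ {a b} → Int a → Int b → Int (a * b)
  int-* {a} {b} (mkInt d m u e) (mkInt d′ m′ u′ e′) =
    mkInt (d ℕ.* d′) (m ℤ.* m′) (unit-* u u′) (begin
      a * b * ⟦ d ℕ.* d′ ⟧              ≡⟨ cong (a * b *_) (⟨*⟩ d d′) ⟩
      a * b * (⟦ d ⟧ * ⟦ d′ ⟧)
        ≡⟨ solve 4 (λ a b d e → a :* b :* (d :* e) := a :* d :* (b :* e)) refl a b ⟦ d ⟧ ⟦ d′ ⟧ ⟩
      a * ⟦ d ⟧ * (b * ⟦ d′ ⟧)          ≡⟨ cong₂ _*_ e e′ ⟩
      ι m * ι m′                        ≡⟨ ι-* m m′ ⟨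
      ι (m ℤ.* m′)                      ∎)

  int-neg : ∀ {a} → Int a → Int (- a)
  int-neg {a} (mkInt d m u e) = mkInt d (ℤ.- m) u (begin
    - a * ⟦ d ⟧      ≡⟨ ℚ.neg-distribˡ-* a ⟦ d ⟧ ⟨
    - (a * ⟦ d ⟧)    ≡⟨ cong -_ e ⟩
    - ι m            ≡⟨ ι-neg m ⟨
    ι (ℤ.- m)        ∎)

  int-⟨⟩ : ∀ n → Int ⟦ n ⟧
  int-⟨⟩ n = int-ι (+ n)

  int-inv : ∀ {n} → Unit n → Int (inv n)
  int-inv {n} u = mkInt n 1ℤ u (trans (ℚ.*-comm (inv n) ⟦ n ⟧) (*-inv n {{unit-nonZero u}}))

  int-Σ : ∀ n {f : ℕ → ℚ} → (∀ k → k ℕ.< n → Int (f k)) → Int (Σ n f)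
  int-Σ zero    int = int-⟨⟩ 0
  int-Σ (suc n) int = int-+ (int-Σ n λ k k<n → int k (ℕ.m<n⇒m<1+n k<n)) (int n (ℕ.n<1+n n))

  int-Π : ∀ n {f : ℕ → ℚ} → (∀ k → k ℕ.< n → Int (f k)) → Int (Π n f)
  int-Π zero    int = int-⟨⟩ 1
  int-Π (suc n) int = int-* (int-Π n λ k k<n → int k (ℕ.m<n⇒m<1+n k<n)) (int n (ℕ.n<1+n n))

  int-cube : ∀ {a} → Int a → Int (cube a)
  int-cube a = int-* (int-* a a) a

  -- The reduced denominator d divides the given denominator e, because n e = m d with n and d
  -- coprime. A common divisor of d and p is therefore 1, or it is p and would divide e.
  int⇒integral : ∀ {a} → Int a → Integral p a
  int⇒integral {a@(ℚ.mkℚ n d-1 c)} (mkInt e m u eq) {k} (k∣d , k∣p) with prime⇒irreducible p-prime k∣p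
  ... | inj₁ k≡1  = k≡1
  ... | inj₂ refl = contradiction (∣-trans k∣d d∣e) u
    where
    d = suc d-1
    cross : ι (n ℤ.* + e) ≡ ι (m ℤ.* + d)
    cross = begin
      ι (n ℤ.* + e)        ≡⟨ ι-* n (+ e) ⟩
      ι n * ⟦ e ⟧          ≡⟨ cong (_* ⟦ e ⟧) (*-denominator a) ⟨
      a * ⟦ d ⟧ * ⟦ e ⟧    ≡⟨ solve 3 (λ a d e → a :* d :* e := a :* e :* d) refl a ⟦ d ⟧ ⟦ e ⟧ ⟩
      a * ⟦ e ⟧ * ⟦ d ⟧    ≡⟨ cong (_* ⟦ d ⟧) eq ⟩
      ι m * ⟦ d ⟧          ≡⟨ ι-* m (+ d) ⟨
      ι (m ℤ.* + d)        ∎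
    ne≡md : ℤ.∣ n ∣ ℕ.* e ≡ ℤ.∣ m ∣ ℕ.* d
    ne≡md = trans (sym (ℤ.abs-* n (+ e))) (trans (cong ℤ.∣_∣ (ι-injective cross)) (ℤ.abs-* m (+ d)))
    d∣e : d ∣ e
    d∣e = coprime-divisor (coprime-sym (coprime-recompute c)) (divides ℤ.∣ m ∣ ne≡md)

  P : ℚ
  P = ⟦ p ⟧

  infix 4 _∼_
  -- A condition on the difference alone; integrality of the terms is a separate argument wherever
  -- products are formed.
  record _∼_ (x y : ℚ) : Set where
    constructor mk∼
    field
      quot : ℚ
      int  : Int quot
      diff : x - y ≡ P * quot

  ≡⇒∼ : ∀ {x y} → x ≡ y → x ∼ y
  ≡⇒∼ {x} refl = mk∼ ⟦ 0 ⟧ (int-⟨⟩ 0) (solve 2 (λ x p → x :- x := p :* k0) refl x P)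

  ∼-refl : ∀ {x} → x ∼ x
  ∼-refl = ≡⇒∼ refl

  ∼-sym : ∀ {x y} → x ∼ y → y ∼ x
  ∼-sym {x} {y} (mk∼ q i e) = mk∼ (- q) (int-neg i)
    (trans (solve 2 (λ x y → y :- x := :- (x :- y)) refl x y)
    (trans (cong -_ e) (ℚ.neg-distribʳ-* P q)))

  ∼-trans : ∀ {x y z} → x ∼ y → y ∼ z → x ∼ z
  ∼-trans {x} {y} {z} (mk∼ q i e) (mk∼ r j f) = mk∼ (q + r) (int-+ i j)
    (trans (solve 3 (λ x y z → x :- z := (x :- y) :+ (y :- z)) refl x y z)
    (trans (cong₂ _+_ e f) (sym (ℚ.*-distribˡ-+ P q r))))

  ∼-+ : ∀ {x y x′ y′} → x ∼ x′ → y ∼ y′ → x + y ∼ x′ + y′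
  ∼-+ {x} {y} {x′} {y′} (mk∼ q i e) (mk∼ r j f) = mk∼ (q + r) (int-+ i j)
    (trans (solve 4 (λ x y z w → x :+ y :- (z :+ w) := (x :- z) :+ (y :- w)) refl x y x′ y′)
    (trans (cong₂ _+_ e f) (sym (ℚ.*-distribˡ-+ P q r))))

  ∼-*ˡ : ∀ {c x y} → Int c → x ∼ y → c * x ∼ c * y
  ∼-*ˡ {c} {x} {y} k (mk∼ q i e) = mk∼ (c * q) (int-* k i)
    (trans (solve 3 (λ c x y → c :* x :- c :* y := c :* (x :- y)) refl c x y)
    (trans (cong (c *_) e) (solve 3 (λ c p q → c :* (p :* q) := p :* (c :* q)) refl c P q)))

  ∼-*ʳ : ∀ {c x y} → Int c → x ∼ y → x * c ∼ y * c
  ∼-*ʳ {c} {x} {y} k x∼y = subst₂ _∼_ (ℚ.*-comm c x) (ℚ.*-comm c y) (∼-*ˡ k x∼y)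

  ∼-neg : ∀ {x y} → x ∼ y → - x ∼ - y
  ∼-neg {x} {y} (mk∼ q i e) = mk∼ (- q) (int-neg i)
    (trans (solve 2 (λ x y → :- x :- :- y := :- (x :- y)) refl x y)
    (trans (cong -_ e) (ℚ.neg-distribʳ-* P q)))

  ∼-int : ∀ {x y} → x ∼ y → Int y → Int x
  ∼-int {x} {y} (mk∼ q i e) j = subst Int (trans (cong (λ z → y + z) (sym e)) (solve 2 (λ x y → y :+ (x :- y) := x) refl x y))
    (int-+ j (int-* (int-⟨⟩ p) i))

  ∼-* : ∀ {x y x′ y′} → Int x′ → Int y′ → x ∼ x′ → y ∼ y′ → x * y ∼ x′ * y′
  ∼-* i j x∼x′ y∼y′ = ∼-trans (∼-*ˡ (∼-int x∼x′ i) y∼y′) (∼-*ʳ j x∼x′)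

  ∼-cube : ∀ {x y} → Int y → x ∼ y → cube x ∼ cube y
  ∼-cube i x∼y = ∼-* (int-* i i) i (∼-* i i x∼y x∼y) x∼y

  ∼-Σ : ∀ n {f g : ℕ → ℚ} → (∀ k → k ℕ.< n → f k ∼ g k) → Σ n f ∼ Σ n g
  ∼-Σ zero    f∼g = ∼-refl
  ∼-Σ (suc n) f∼g = ∼-+ (∼-Σ n λ k k<n → f∼g k (ℕ.m<n⇒m<1+n k<n)) (f∼g n (ℕ.n<1+n n))

  ∼-Π : ∀ n {f g : ℕ → ℚ} → (∀ k → k ℕ.< n → Int (g k)) → (∀ k → k ℕ.< n → f k ∼ g k) → Π n f ∼ Π n g
  ∼-Π zero    i f∼g = ∼-refl
  ∼-Π (suc n) i f∼g = ∼-* (int-Π n λ k k<n → i k (ℕ.m<n⇒m<1+n k<n)) (i n (ℕ.n<1+n n))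
    (∼-Π n (λ k k<n → i k (ℕ.m<n⇒m<1+n k<n)) (λ k k<n → f∼g k (ℕ.m<n⇒m<1+n k<n))) (f∼g n (ℕ.n<1+n n))

  ∼-cancel : ∀ a b {x y} → Int b → a * b ≡ ⟦ 1 ⟧ → a * x ∼ a * y → x ∼ y
  ∼-cancel a b {x} {y} i ab≡1 ax∼ay = subst₂ _∼_ (strip x) (strip y) (∼-*ˡ i ax∼ay)
    where
    strip : ∀ z → b * (a * z) ≡ z
    strip z = trans (solve 3 (λ a b z → b :* (a :* z) := (a :* b) :* z) refl a b z)
      (trans (cong (_* z) ab≡1) (solve 1 (λ z → k1 :* z := z) refl z))

  ∼-cancel-unit : ∀ {n x y} → Unit n → ⟦ n ⟧ * x ∼ ⟦ n ⟧ * y → x ∼ y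
  ∼-cancel-unit {n} u = ∼-cancel ⟦ n ⟧ (inv n) (int-inv u) (*-inv n {{unit-nonZero u}})

  P∼0 : P ∼ ⟦ 0 ⟧
  P∼0 = mk∼ ⟦ 1 ⟧ (int-⟨⟩ 1) (solve 1 (λ p → p :- k0 := p :* k1) refl P)

  P*∼0 : ∀ {x} → Int x → P * x ∼ ⟦ 0 ⟧
  P*∼0 {x} i = mk∼ x i (solve 1 (λ p → p :- k0 := p) refl (P * x))

  ∼-setoid : Setoid 0ℓ 0ℓ
  ∼-setoid = record { _≈_ = _∼_ ; isEquivalence = record { refl = ∼-refl ; sym = ∼-sym ; trans = ∼-trans } }

-- Arithmetic modulo the odd prime p = 2N + 1.

module OddPrime (N : ℕ) (p-prime : Prime (suc (2 ℕ.* N))) where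
  open import Data.Rational.Base using (_+_; _*_; _-_; -_)
  open Local (suc (2 ℕ.* N)) p-prime
  open import Relation.Binary.Reasoning.Setoid ∼-setoid
  private module R = ≡-Reasoning

  p q : ℕ
  p = suc (2 ℕ.* N)
  q = 2 ℕ.* N

  N≢0 : ℕ.NonZero N
  N≢0 = ℕ.≢-nonZero λ N≡0 → ¬prime[1] (subst (λ n → Prime (suc (2 ℕ.* n))) N≡0 p-prime)

  P≡odd : P ≡ odd N
  P≡odd = ⟨odd⟩ N

  unit-< : ∀ {n} .{{_ : ℕ.NonZero n}} → n ℕ.< p → Unit n
  unit-< n<p p∣n = ℕ.<⇒≱ n<p (∣⇒≤ p∣n)

  q≢0 : ℕ.NonZero q
  q≢0 = ℕ.m*n≢0 2 N {{_}} {{N≢0}}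

  unit-2 : Unit 2
  unit-2 = unit-< (s≤s (ℕ.m≤m*n 2 N {{N≢0}}))

  unit-odd : ∀ {k} → k ℕ.< N → Unit (suc (2 ℕ.* k))
  unit-odd k<N = unit-< (s≤s (ℕ.*-monoʳ-< 2 k<N))

  unit-even : ∀ {k} → k ℕ.< N → Unit (2 ℕ.* suc k)
  unit-even {k} k<N = unit-< {2 ℕ.* suc k} (s≤s (ℕ.*-monoʳ-≤ 2 k<N))

  unit-suc : ∀ {k} → k ℕ.< q → Unit (suc k)
  unit-suc k<q = unit-< (s≤s k<q)

  N≤q : N ℕ.≤ q
  N≤q = ℕ.m≤m+n N (N ℕ.+ 0)

  -- If p divided C(n+1,k+1), it would divide (n+1) C(n,k) by absorption, whose factors are prime to
  -- p by the bound and by induction.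
  unit-C : ∀ {n k} → k ℕ.≤ n → n ℕ.< p → Unit (n C k)
  unit-C {n}     {zero}  _         _       = unit-1
  unit-C {suc n} {suc k} (s≤s k≤n) 1+n<p p∣C =
    unit-* (unit-< 1+n<p) (unit-C k≤n (ℕ.<⇒≤ 1+n<p)) (subst (p ∣_) (C-absorb n k) (∣n⇒∣m*n (suc k) p∣C))

  int-odd : ∀ k → Int (odd k)
  int-odd k = subst Int (⟨odd⟩ k) (int-⟨⟩ (suc (2 ℕ.* k)))

  int-even : ∀ k → Int (even k)
  int-even k = subst Int (⟨even⟩ k) (int-⟨⟩ (2 ℕ.* suc k))

  int-odd⁻¹ : ∀ {k} → k ℕ.< N → Int (odd⁻¹ k)
  int-odd⁻¹ k<N = int-inv (unit-odd k<N)

  int-even⁻¹ : ∀ {k} → k ℕ.< N → Int (even⁻¹ k)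
  int-even⁻¹ k<N = int-inv (unit-even k<N)

  int-1 : Int ⟦ 1 ⟧
  int-1 = int-⟨⟩ 1

  int-pow : ∀ {x} → Int x → ∀ n → Int (pow x n)
  int-pow i zero    = int-1
  int-pow i (suc n) = int-* i (int-pow i n)

  int-sgn : ∀ n → Int (sgn n)
  int-sgn = int-pow (int-neg int-1)

  P+ : ∀ {x} → P + x ∼ x
  P+ {x} = mk∼ ⟦ 1 ⟧ int-1 (solve 2 (λ p x → p :+ x :- x := p :* k1) refl P x)

  -- Fermat and Wilson

  Bp∼0 : ∀ {k} → k ℕ.< q → B p (suc k) ∼ ⟦ 0 ⟧
  Bp∼0 {k} k<q = ∼-cancel-unit (unit-suc k<q) (begin
    ⟦ suc k ⟧ * B p (suc k)   ≡⟨ B-absorb q k ⟩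
    P * B q k                 ≈⟨ P*∼0 (int-⟨⟩ (q C k)) ⟩
    ⟦ 0 ⟧                     ≡⟨ solve 1 (λ k → k0 := k :* k0) refl ⟦ suc k ⟧ ⟩
    ⟦ suc k ⟧ * ⟦ 0 ⟧         ∎)

  fermat : ∀ a → pow ⟦ a ⟧ p ∼ ⟦ a ⟧
  fermat zero    = ≡⇒∼ (solve 1 (λ x → k0 :* x := k0) refl (pow ⟦ 0 ⟧ q))
  fermat (suc a) = begin
    pow ⟦ suc a ⟧ p                                   ≡⟨ cong (λ x → pow x p) (⟨suc⟩ a) ⟩
    pow (⟦ 1 ⟧ + ⟦ a ⟧) p                             ≡⟨ solve 1 (λ x → x := x :* k1) refl (pow (⟦ 1 ⟧ + ⟦ a ⟧) p) ⟩
    pow (⟦ 1 ⟧ + ⟦ a ⟧) p * pow ⟦ 1 ⟧ 0               ≡⟨ T^-pow ⟦ 1 ⟧ ⟦ a ⟧ p 0 ⟨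
    T^ ⟦ a ⟧ p (pow ⟦ 1 ⟧) 0                          ≡⟨ T^-binomial ⟦ a ⟧ p (pow ⟦ 1 ⟧) 0 ⟩
    Σ (suc p) (λ k → B p k * (pow ⟦ a ⟧ k * pow ⟦ 1 ⟧ (p ∸ k)))
      ≡⟨ Σ-cong (suc p) (λ k _ → cong (B p k *_) (trans (cong (pow ⟦ a ⟧ k *_) (pow-one (p ∸ k))) (solve 1 (λ x → x :* k1 := x) refl (pow ⟦ a ⟧ k)))) ⟩
    Σ p f + f p                                       ≡⟨ cong (_+ f p) (Σ-head q f) ⟩
    f 0 + Σ q (f ∘ suc) + f p
      ≈⟨ ∼-+ (∼-+ (∼-refl {f 0}) (∼-Σ q {f ∘ suc} λ k k<q → ∼-*ʳ (int-pow (int-⟨⟩ a) (suc k)) (Bp∼0 k<q))) ∼-refl ⟩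
    f 0 + Σ q (λ k → ⟦ 0 ⟧ * pow ⟦ a ⟧ (suc k)) + f p
      ≡⟨ cong₂ (λ x y → f 0 + x + y) (Σ-*ˡ q ⟦ 0 ⟧ (pow ⟦ a ⟧ ∘ suc)) (cong (λ c → ⟦ c ⟧ * pow ⟦ a ⟧ p) (nCn≡1 p)) ⟩
    ⟦ 1 ⟧ * ⟦ 1 ⟧ + ⟦ 0 ⟧ * Σ q (pow ⟦ a ⟧ ∘ suc) + ⟦ 1 ⟧ * pow ⟦ a ⟧ p
      ≡⟨ solve 2 (λ x y → k1 :* k1 :+ k0 :* x :+ k1 :* y := k1 :+ y) refl (Σ q (pow ⟦ a ⟧ ∘ suc)) (pow ⟦ a ⟧ p) ⟩
    ⟦ 1 ⟧ + pow ⟦ a ⟧ p                               ≈⟨ ∼-+ (∼-refl {⟦ 1 ⟧}) (fermat a) ⟩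
    ⟦ 1 ⟧ + ⟦ a ⟧                                     ≡⟨ ⟨suc⟩ a ⟨
    ⟦ suc a ⟧                                         ∎
    where
    f : ℕ → ℚ
    f k = B p k * pow ⟦ a ⟧ k

  fermat-unit : ∀ {a} → Unit a → pow ⟦ a ⟧ q ∼ ⟦ 1 ⟧
  fermat-unit {a} u = ∼-cancel-unit u (∼-trans (fermat a) (≡⇒∼ (solve 1 (λ x → x := x :* k1) refl ⟦ a ⟧)))

  Bq∼sgn : ∀ k → k ℕ.≤ q → B q k ∼ sgn k
  Bq∼sgn zero    _   = ∼-refl
  Bq∼sgn (suc k) k<q = begin
    B q (suc k)                      ≡⟨ solve 2 (λ a b → b := a :+ b :- a) refl (B q k) (B q (suc k)) ⟩
    B q k + B q (suc k) - B q k      ≡⟨ cong (_- B q k) (B-pascal q k) ⟨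
    B p (suc k) - B q k              ≈⟨ ∼-+ (Bp∼0 k<q) (∼-neg (Bq∼sgn k (ℕ.<⇒≤ k<q))) ⟩
    ⟦ 0 ⟧ - sgn k                    ≡⟨ solve 1 (λ s → k0 :- s := :- k1 :* s) refl (sgn k) ⟩
    sgn (suc k)                      ∎

  -- p - 1 differences of x^(p-1) give (p-1)!, and Σ (-1)ᵏ C(p-1,k) (p-1-k)^(p-1) ≡ p - 1 (mod p).
  wilson : fac q ∼ - ⟦ 1 ⟧
  wilson = begin
    fac q                                 ≡⟨ Δ^-pow-fac q 0 ⟨
    Δ^ q (λ t → pow ⟦ t ⟧ q) 0            ≡⟨ T^-binomial (- ⟦ 1 ⟧) q (λ t → pow ⟦ t ⟧ q) 0 ⟩
    Σ q f + f q                           ≈⟨ ∼-+ (∼-Σ q {f} step) (≡⇒∼ last) ⟩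
    Σ q (λ _ → ⟦ 1 ⟧) + ⟦ 0 ⟧             ≡⟨ cong (_+ ⟦ 0 ⟧) (Σ-const q ⟦ 1 ⟧) ⟩
    ⟦ q ⟧ * ⟦ 1 ⟧ + ⟦ 0 ⟧                 ≡⟨ solve 1 (λ q → q :* k1 :+ k0 := k1 :+ q :+ :- k1) refl ⟦ q ⟧ ⟩
    ⟦ 1 ⟧ + ⟦ q ⟧ + - ⟦ 1 ⟧               ≡⟨ cong (_+ - ⟦ 1 ⟧) (⟨suc⟩ q) ⟨
    P + - ⟦ 1 ⟧                           ≈⟨ P+ ⟩
    - ⟦ 1 ⟧                               ∎
    where
    f : ℕ → ℚ
    f k = B q k * (sgn k * pow ⟦ q ∸ k ⟧ q)
    step : ∀ k → k ℕ.< q → f k ∼ ⟦ 1 ⟧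
    step k k<q = ∼-trans
      (∼-* (int-sgn k) (int-* (int-sgn k) int-1) (Bq∼sgn k (ℕ.<⇒≤ k<q))
        (∼-*ˡ (int-sgn k) (fermat-unit {q ∸ k} (unit-< {q ∸ k} {{ℕ.>-nonZero (ℕ.m<n⇒0<n∸m k<q)}} (s≤s (ℕ.m∸n≤m q k))))))
      (≡⇒∼ (trans (solve 1 (λ s → s :* (s :* k1) := s :* s) refl (sgn k)) (sgn² k)))
    pow-0 : ∀ n .{{_ : ℕ.NonZero n}} → pow ⟦ 0 ⟧ n ≡ ⟦ 0 ⟧
    pow-0 (suc n) = solve 1 (λ x → k0 :* x := k0) refl (pow ⟦ 0 ⟧ n)
    -- The term k = q has base 0 and exponent q > 0. Each of the other q terms is congruent to 1.
    last : f q ≡ ⟦ 0 ⟧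
    last = trans (cong (λ z → B q q * (sgn q * z)) (trans (cong (λ n → pow ⟦ n ⟧ q) (ℕ.n∸n≡0 q)) (pow-0 q {{q≢0}})))
      (solve 2 (λ a b → a :* (b :* k0) := k0) refl (B q q) (sgn q))

  -- Reversal of the range k < N, and double factorials.

  ∼-inverse : ∀ a a′ b b′ → Int a′ → Int b′ → a * a′ ≡ ⟦ 1 ⟧ → b * b′ ≡ ⟦ 1 ⟧ → a ∼ b → a′ ∼ b′
  ∼-inverse a a′ b b′ i j aa′≡1 bb′≡1 a∼b = begin
    a′                  ≡⟨ solve 1 (λ x → x := x :* k1) refl a′ ⟩
    a′ * ⟦ 1 ⟧          ≡⟨ cong (a′ *_) bb′≡1 ⟨
    a′ * (b * b′)       ≈⟨ ∼-*ˡ i (∼-*ʳ j (∼-sym a∼b)) ⟩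
    a′ * (a * b′)       ≡⟨ solve 3 (λ a x y → x :* (a :* y) := a :* x :* y) refl a a′ b′ ⟩
    a * a′ * b′         ≡⟨ cong (_* b′) aa′≡1 ⟩
    ⟦ 1 ⟧ * b′          ≡⟨ solve 1 (λ x → k1 :* x := x) refl b′ ⟩
    b′                  ∎

  P-∼ : ∀ {x} → P - x ∼ - x
  P-∼ = P+

  -- Since 2(N-1-k) + 1 = p - (2k+2), reversal turns the odd numbers below p into p minus the even
  -- ones. Modulo p this exchanges odd and even factors up to sign.
  odd-reverse : ∀ {k} → k ℕ.< N → odd (N ∸ suc k) ≡ P - even k
  odd-reverse {k} k<N = trans (cong (λ m → ⟦ 1 ⟧ + ⟦ 2 ⟧ * m) (trans (⟨∸⟩ k<N) (cong (λ s → ⟦ N ⟧ - s) (⟨suc⟩ k))))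
    (trans (solve 2 (λ n k → k1 :+ con (+ 2) :* (n :- (k1 :+ k)) := k1 :+ con (+ 2) :* n :- (con (+ 2) :+ con (+ 2) :* k)) refl ⟦ N ⟧ ⟦ k ⟧)
      (cong (_- even k) (sym P≡odd)))

  even-reverse : ∀ {k} → k ℕ.< N → even (N ∸ suc k) ≡ dbl N - ⟦ 2 ⟧ * ⟦ k ⟧
  even-reverse {k} k<N = trans (cong (λ m → ⟦ 2 ⟧ + ⟦ 2 ⟧ * m) (trans (⟨∸⟩ k<N) (cong (λ s → ⟦ N ⟧ - s) (⟨suc⟩ k))))
    (solve 2 (λ n k → con (+ 2) :+ con (+ 2) :* (n :- (k1 :+ k)) := con (+ 2) :* n :- con (+ 2) :* k) refl ⟦ N ⟧ ⟦ k ⟧)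

  -- The double factorials (p-2)!! and (p-1)!!, and the inverse of the latter.
  O Ev Ev⁻¹ : ℚ
  O = Π N odd
  Ev = Π N even
  Ev⁻¹ = Π N even⁻¹

  int-Ev : Int Ev
  int-Ev = int-Π N λ k _ → int-even k

  int-Ev⁻¹ : Int Ev⁻¹
  int-Ev⁻¹ = int-Π N λ k → int-even⁻¹

  O-reverse : O ≡ Π N (λ k → P - even k)
  O-reverse = trans (Π-reverse N odd) (Π-cong N λ k → odd-reverse)

  O∼Ev : O ∼ sgn N * Ev
  O∼Ev = begin
    O                                ≡⟨ O-reverse ⟩
    Π N (λ k → P - even k)
      ≈⟨ ∼-Π N (λ k _ → int-* (int-neg int-1) (int-even k))
           (λ k _ → ∼-trans P-∼ (≡⇒∼ (solve 1 (λ x → :- x := :- k1 :* x) refl (even k)))) ⟩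
    Π N (λ k → - ⟦ 1 ⟧ * even k)     ≡⟨ Π-* N (λ _ → - ⟦ 1 ⟧) even ⟩
    Π N (λ _ → - ⟦ 1 ⟧) * Ev         ≡⟨ cong (_* Ev) (Π-const N (- ⟦ 1 ⟧)) ⟩
    sgn N * Ev                       ∎

  -- C(2N,N) / 4^N is the quotient of `O` by `Ev`, congruent to (-1)^N; its cube cancels the sign in
  -- front.
  t∼1 : t N ∼ ⟦ 1 ⟧
  t∼1 = begin
    t N                                ≡⟨ t-product N ⟩
    sgn N * cube (Π N ρ)               ≡⟨ cong (λ x → sgn N * cube x) (Π-* N odd even⁻¹) ⟩
    sgn N * cube (O * Ev⁻¹)
      ≈⟨ ∼-*ˡ (int-sgn N) (∼-cube (int-* (int-* (int-sgn N) int-Ev) int-Ev⁻¹) (∼-*ʳ int-Ev⁻¹ O∼Ev)) ⟩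
    sgn N * cube (sgn N * Ev * Ev⁻¹)
      ≡⟨ solve 3 (λ s x y → let c = λ x → x :* x :* x in s :* c (s :* x :* y) := (s :* s) :* (s :* s) :* c (x :* y)) refl (sgn N) Ev Ev⁻¹ ⟩
    sgn N * sgn N * (sgn N * sgn N) * cube (Ev * Ev⁻¹)
      ≡⟨ cong₂ (λ s x → s * s * cube x) (sgn² N) (Π-inverse N even-inv) ⟩
    ⟦ 1 ⟧ * ⟦ 1 ⟧ * cube ⟦ 1 ⟧         ≡⟨ solve 0 (k1 :* k1 :* (k1 :* k1 :* k1) := k1) refl ⟩
    ⟦ 1 ⟧                              ∎

  ∼⇒∣ : ∀ {i} → ι i ∼ ⟦ 0 ⟧ → + p ℤ∣.∣ i
  ∼⇒∣ {i} (mk∼ quot (mkInt d m u eq) diff) = ℤ∣.∣ᵤ⇒∣ (divisor (euclids p∣id))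
    where
    cross : ι (i ℤ.* + d) ≡ ι (m ℤ.* + p)
    cross = trans (ι-* i (+ d)) (trans (cong (_* ⟦ d ⟧) (trans (solve 1 (λ x → x := x :- k0) refl (ι i)) diff))
      (trans (solve 3 (λ p q d → p :* q :* d := q :* d :* p) refl P quot ⟦ d ⟧) (trans (cong (_* P) eq) (sym (ι-* m (+ p))))))
    p∣id : p ∣ ℤ.∣ i ∣ ℕ.* d
    p∣id = divides ℤ.∣ m ∣ (trans (sym (ℤ.abs-* i (+ d))) (trans (cong ℤ.∣_∣ (ι-injective cross)) (ℤ.abs-* m (+ p))))
    euclids : p ∣ ℤ.∣ i ∣ ℕ.* d → (p ∣ ℤ.∣ i ∣) ⊎ (p ∣ d)
    euclids = euclidsLemma ℤ.∣ i ∣ d p-prime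
    divisor : (p ∣ ℤ.∣ i ∣) ⊎ (p ∣ d) → p ∣ ℤ.∣ i ∣
    divisor (inj₁ p∣i) = p∣i
    divisor (inj₂ p∣d) = contradiction p∣d u

  ∣⇒∼ : ∀ {i} → + p ℤ∣.∣ i → ι i ∼ ⟦ 0 ⟧
  ∣⇒∼ {i} (ℤ∣.divides m eq) = ∼-trans (≡⇒∼ (trans (cong ι eq) (trans (ι-* m (+ p)) (ℚ.*-comm (ι m) P)))) (P*∼0 (int-ι m))

  1≁0 : ¬ ⟦ 1 ⟧ ∼ ⟦ 0 ⟧
  1≁0 1∼0 = unit-1 (ℤ∣.∣⇒∣ᵤ (∼⇒∣ 1∼0))

  -- The Legendre symbol of -1

  residue : ℕ → ℤ
  residue x = (+ x) ℤ.^ 2 ℤ.- -[1+ 0 ]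

  ι-residue : ∀ x → ι (residue x) ≡ ⟦ x ⟧ * ⟦ x ⟧ + ⟦ 1 ⟧
  ι-residue x = trans (ι-+ ((+ x) ℤ.^ 2) (+ 1)) (cong (_+ ⟦ 1 ⟧)
    (trans (ι-* (+ x) ((+ x) ℤ.* + 1)) (cong (⟦ x ⟧ *_) (trans (ι-* (+ x) (+ 1)) (solve 1 (λ x → x :* k1 := x) refl ⟦ x ⟧)))))

  -- Wilson's theorem, as `O * Ev` is (p-1)! and `O` is congruent to (-1)^N `Ev`. For even N it
  -- makes `Ev` a square root of -1.
  Ev² : sgn N * (Ev * Ev) ∼ - ⟦ 1 ⟧
  Ev² = begin
    sgn N * (Ev * Ev)                                          ≡⟨ ℚ.*-assoc (sgn N) Ev Ev ⟨
    sgn N * Ev * Ev                                            ≈⟨ ∼-*ʳ int-Ev O∼Ev ⟨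
    O * Ev                                                     ≡⟨ Π-* N odd even ⟨
    Π N (λ k → odd k * even k)
      ≡⟨ Π-cong N (λ k _ → cong₂ _*_ (⟨odd⟩ k) (trans (cong ⟦_⟧ (sym (ℕ.*-suc 2 k))) (⟨even⟩ k))) ⟨
    Π N (λ k → ⟦ suc (2 ℕ.* k) ⟧ * ⟦ suc (suc (2 ℕ.* k)) ⟧)    ≡⟨ Π-double N (λ k → ⟦ suc k ⟧) ⟨
    fac q                                                      ≈⟨ wilson ⟩
    - ⟦ 1 ⟧                                                    ∎

  root : sgn N ≡ ⟦ 1 ⟧ → ∃ λ (x : Fin p) → + p ℤ∣.∣ residue (toℕ x)
  root sgn≡1 with Π-ℕ N (λ k → 2 ℕ.* suc k)
  -- The root is (p-1)!! reduced modulo p, because `legendre` searches only the representatives in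
  -- `Fin p`.
  ... | m , eq = fromℕ< (m%n<n m p) , ∼⇒∣ (begin
    ι (residue (toℕ (fromℕ< (m%n<n m p))))  ≡⟨ cong (ι ∘ residue) (toℕ-fromℕ< (m%n<n m p)) ⟩
    ι (residue (m % p))                     ≡⟨ ι-residue (m % p) ⟩
    ⟦ m % p ⟧ * ⟦ m % p ⟧ + ⟦ 1 ⟧           ≈⟨ ∼-+ (∼-* int-Ev int-Ev x∼Ev x∼Ev) (∼-refl {⟦ 1 ⟧}) ⟩
    Ev * Ev + ⟦ 1 ⟧                         ≡⟨ cong (_+ ⟦ 1 ⟧) (trans (solve 1 (λ x → x := k1 :* x) refl (Ev * Ev)) (cong (_* (Ev * Ev)) (sym sgn≡1))) ⟩
    sgn N * (Ev * Ev) + ⟦ 1 ⟧               ≈⟨ ∼-+ Ev² (∼-refl {⟦ 1 ⟧}) ⟩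
    - ⟦ 1 ⟧ + ⟦ 1 ⟧                         ≡⟨ solve 0 (:- k1 :+ k1 := k0) refl ⟩
    ⟦ 0 ⟧                                   ∎)
    where
    x∼Ev : ⟦ m % p ⟧ ∼ Ev
    x∼Ev = begin
      ⟦ m % p ⟧                             ≈⟨ P*+ (m ℕ./ p) ⟨
      ⟦ m % p ⟧ + P * ⟦ m ℕ./ p ⟧           ≡⟨ cong (λ y → ⟦ m % p ⟧ + y) (trans (ℚ.*-comm P ⟦ m ℕ./ p ⟧) (sym (⟨*⟩ (m ℕ./ p) p))) ⟩
      ⟦ m % p ⟧ + ⟦ m ℕ./ p ℕ.* p ⟧         ≡⟨ ⟨+⟩ (m % p) (m ℕ./ p ℕ.* p) ⟨
      ⟦ m % p ℕ.+ m ℕ./ p ℕ.* p ⟧           ≡⟨ cong ⟦_⟧ (m≡m%n+[m/n]*n m p) ⟨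
      ⟦ m ⟧                                 ≡⟨ eq ⟨
      Π N (λ k → ⟦ 2 ℕ.* suc k ⟧)           ≡⟨ Π-cong N (λ k _ → ⟨even⟩ k) ⟩
      Ev                                    ∎
      where
      P*+ : ∀ n → ⟦ m % p ⟧ + P * ⟦ n ⟧ ∼ ⟦ m % p ⟧
      P*+ n = ∼-trans (∼-+ (∼-refl {⟦ m % p ⟧}) (P*∼0 (int-⟨⟩ n))) (≡⇒∼ (solve 1 (λ x → x :+ k0 := x) refl ⟦ m % p ⟧))

  -- A root x would satisfy x^(p-1) ≡ (-1)^N = -1. Fermat in the form x^p ≡ x then gives x ≡ -x, so
  -- x ≡ 0, and x² + 1 ≡ 0 becomes 1 ≡ 0.
  no-root : sgn N ≡ - ⟦ 1 ⟧ → ¬ ∃ λ (x : Fin p) → + p ℤ∣.∣ residue (toℕ x)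
  no-root sgn≡-1 (i , p∣x²+1) = 1≁0 (begin
    ⟦ 1 ⟧                            ≡⟨ solve 1 (λ x → k1 := x :* x :+ k1 :- x :* x) refl x ⟩
    x * x + ⟦ 1 ⟧ - x * x            ≈⟨ ∼-+ x²+1∼0 (∼-neg (∼-* (int-⟨⟩ 0) (int-⟨⟩ 0) x∼0 x∼0)) ⟩
    ⟦ 0 ⟧ - ⟦ 0 ⟧ * ⟦ 0 ⟧            ≡⟨ solve 0 (k0 :- k0 :* k0 := k0) refl ⟩
    ⟦ 0 ⟧                            ∎)
    where
    x = ⟦ toℕ i ⟧
    x²+1∼0 : x * x + ⟦ 1 ⟧ ∼ ⟦ 0 ⟧
    x²+1∼0 = ∼-trans (≡⇒∼ (sym (ι-residue (toℕ i)))) (∣⇒∼ p∣x²+1)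
    x²∼-1 : x * x ∼ - ⟦ 1 ⟧
    x²∼-1 = ∼-trans (≡⇒∼ (solve 1 (λ y → y := y :+ k1 :+ :- k1) refl (x * x)))
      (∼-trans (∼-+ x²+1∼0 (∼-refl { - ⟦ 1 ⟧})) (≡⇒∼ (solve 0 (k0 :+ :- k1 := :- k1) refl)))
    pow-cong : ∀ {y z} → Int z → y ∼ z → ∀ n → pow y n ∼ pow z n
    pow-cong i y∼z zero    = ∼-refl
    pow-cong i y∼z (suc n) = ∼-* i (int-pow i n) y∼z (pow-cong i y∼z n)
    xq : pow x q ∼ - ⟦ 1 ⟧
    xq = begin
      pow x (2 ℕ.* N)        ≡⟨ cong (pow x) (cong (N ℕ.+_) (ℕ.+-identityʳ N)) ⟩
      pow x (N ℕ.+ N)        ≡⟨ pow-+ x N N ⟩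
      pow x N * pow x N      ≡⟨ pow-* x x N ⟨
      pow (x * x) N          ≈⟨ pow-cong (int-neg int-1) x²∼-1 N ⟩
      sgn N                  ≡⟨ sgn≡-1 ⟩
      - ⟦ 1 ⟧                ∎
    x∼0 : x ∼ ⟦ 0 ⟧
    x∼0 = ∼-cancel-unit unit-2 (begin
      ⟦ 2 ⟧ * x              ≡⟨ solve 1 (λ x → con (+ 2) :* x := x :- x :* :- k1) refl x ⟩
      x - x * - ⟦ 1 ⟧        ≈⟨ ∼-+ (∼-refl {x}) (∼-neg (∼-*ˡ (int-⟨⟩ (toℕ i)) xq)) ⟨
      x - x * pow x q        ≈⟨ ∼-+ (∼-refl {x}) (∼-neg (fermat (toℕ i))) ⟩
      x - x                  ≡⟨ solve 1 (λ x → x :- x := con (+ 2) :* k0) refl x ⟩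
      ⟦ 2 ⟧ * ⟦ 0 ⟧          ∎)

  legendre≡sgn : ι (legendre -[1+ 0 ] p) ≡ sgn N
  legendre≡sgn = split (+ p ℤ∣.∣? -[1+ 0 ]) (any? λ (x : Fin p) → + p ℤ∣.∣? residue (toℕ x)) (parity N)
    where
    -- The decisions are arguments, so that the nested conditionals of `legendre` reduce on
    -- matching.
    split : (d₁ : Dec (+ p ℤ∣.∣ -[1+ 0 ])) (d₂ : Dec (∃ λ (x : Fin p) → + p ℤ∣.∣ residue (toℕ x))) →
      (∃ λ m → N ≡ 2 ℕ.* m) ⊎ (∃ λ m → N ≡ suc (2 ℕ.* m)) →
      ι (if does d₁ then 0ℤ else if does d₂ then 1ℤ else -[1+ 0 ]) ≡ sgn N
    split (yes p∣-1) _       _               = contradiction (ℤ∣.∣⇒∣ᵤ p∣-1) unit-1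
    split (no _)     (yes r) (inj₁ (m , eq)) = sym (trans (cong sgn eq) (sgn-even m))
    split (no _)     (no ¬r) (inj₁ (m , eq)) = contradiction (root (trans (cong sgn eq) (sgn-even m))) ¬r
    split (no _)     (yes r) (inj₂ (m , eq)) = contradiction r (no-root (trans (cong sgn eq) (sgn-odd m)))
    split (no _)     (no ¬r) (inj₂ (m , eq)) = trans (ι-neg (+ 1)) (sym (trans (cong sgn eq) (sgn-odd m)))

  -- The last term of the WZ sum.

  sq : ℚ → ℚ
  sq x = x * x

  -- `I`, the inverse of 3 · 5 ⋯ p, enters squared, and `P * O * I` is 1: this absorbs two powers of
  -- p. In what remains `O`, reversed, supplies the factors p - 2k and `Q` the factors p + 2k.
  last-term : cube P * t N * wzG (dbl N) N ≡ P * (sgn N * Π N (λ k → ⟦ 1 ⟧ - sq P * sq (even⁻¹ k)))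
  last-term = R.begin
    cube P * t N * wzG (dbl N) N
      R.≡⟨ cong₂ (λ a b → cube P * a * b) (trans (t-product N) (cong (λ x → sgn N * cube x) (Π-* N odd even⁻¹))) hN ⟩
    cube P * (sgn N * cube (O * Ev⁻¹)) * (sgn N * (Q * Ev * (I * I)))
      R.≡⟨ solve 7 (λ p s o f q e i → let c = λ x → x :* x :* x in
            c p :* (s :* c (o :* f)) :* (s :* (q :* e :* (i :* i))) :=
            (s :* s) :* ((p :* o :* i) :* (p :* o :* i)) :* (e :* f) :* (p :* (o :* q :* (f :* f)))) refl P (sgn N) O Ev⁻¹ Q Ev I ⟩
    sgn N * sgn N * ((P * O * I) * (P * O * I)) * (Ev * Ev⁻¹) * (P * (O * Q * (Ev⁻¹ * Ev⁻¹)))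
      R.≡⟨ cong₂ (λ a b → a * (b * b) * (Ev * Ev⁻¹) * (P * (O * Q * (Ev⁻¹ * Ev⁻¹)))) (sgn² N) POI ⟩
    ⟦ 1 ⟧ * (⟦ 1 ⟧ * ⟦ 1 ⟧) * (Ev * Ev⁻¹) * (P * (O * Q * (Ev⁻¹ * Ev⁻¹)))
      R.≡⟨ cong₂ (λ a b → ⟦ 1 ⟧ * (⟦ 1 ⟧ * ⟦ 1 ⟧) * a * (P * b)) (Π-inverse N even-inv) OQ ⟩
    ⟦ 1 ⟧ * (⟦ 1 ⟧ * ⟦ 1 ⟧) * ⟦ 1 ⟧ * (P * (sgn N * Π N (λ k → ⟦ 1 ⟧ - sq P * sq (even⁻¹ k))))
      R.≡⟨ solve 1 (λ x → k1 :* (k1 :* k1) :* k1 :* x := x) refl (P * (sgn N * Π N (λ k → ⟦ 1 ⟧ - sq P * sq (even⁻¹ k)))) ⟩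
    P * (sgn N * Π N (λ k → ⟦ 1 ⟧ - sq P * sq (even⁻¹ k))) R.∎
    where
    Q I : ℚ
    Q = Π N (λ k → P + even k)
    I = Π N (odd⁻¹ ∘ suc)
    x+odd : ∀ k → dbl N + odd (suc k) ≡ P + even k
    x+odd k = trans (cong (λ s → dbl N + (⟦ 1 ⟧ + ⟦ 2 ⟧ * s)) (⟨suc⟩ k))
      (trans (solve 2 (λ n k → con (+ 2) :* n :+ (k1 :+ con (+ 2) :* (k1 :+ k)) := k1 :+ con (+ 2) :* n :+ (con (+ 2) :+ con (+ 2) :* k)) refl ⟦ N ⟧ ⟦ k ⟧)
        (cong (_+ even k) (sym P≡odd)))
    hN : wzG (dbl N) N ≡ sgn N * (Q * Ev * (I * I))
    hN = R.begin
      wzG (dbl N) N   R.≡⟨ wzG-product (dbl N) N ⟩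
      Π N (λ k → - ((dbl N + odd (suc k)) * (dbl N - ⟦ 2 ⟧ * ⟦ k ⟧) * (odd⁻¹ (suc k) * odd⁻¹ (suc k))))
        R.≡⟨ Π-cong N (λ k k<N → trans (cong₂ (λ a b → - (a * b * (odd⁻¹ (suc k) * odd⁻¹ (suc k)))) (x+odd k) (sym (even-reverse k<N)))
             (solve 1 (λ x → :- x := :- k1 :* x) refl ((P + even k) * even (N ∸ suc k) * (odd⁻¹ (suc k) * odd⁻¹ (suc k))))) ⟩
      Π N (λ k → - ⟦ 1 ⟧ * ((P + even k) * even (N ∸ suc k) * (odd⁻¹ (suc k) * odd⁻¹ (suc k))))
        R.≡⟨ trans (Π-* N (λ _ → - ⟦ 1 ⟧) (λ k → (P + even k) * even (N ∸ suc k) * (odd⁻¹ (suc k) * odd⁻¹ (suc k))))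
             (cong₂ _*_ (Π-const N (- ⟦ 1 ⟧)) (trans (Π-* N (λ k → (P + even k) * even (N ∸ suc k)) (λ k → odd⁻¹ (suc k) * odd⁻¹ (suc k)))
               (cong₂ _*_ (trans (Π-* N (λ k → P + even k) (λ k → even (N ∸ suc k))) (cong (Q *_) (sym (Π-reverse N even))))
                 (Π-* N (odd⁻¹ ∘ suc) (odd⁻¹ ∘ suc))))) ⟩
      sgn N * (Q * Ev * (I * I)) R.∎
    POI : P * O * I ≡ ⟦ 1 ⟧
    POI = R.begin
      P * O * I                        R.≡⟨ cong (_* I) (trans (cong (_* O) P≡odd) (ℚ.*-comm (odd N) O)) ⟩
      Π (suc N) odd * I                R.≡⟨ cong (_* I) (Π-head N odd) ⟩
      odd 0 * Π N (odd ∘ suc) * I      R.≡⟨ solve 2 (λ x i → (k1 :+ con (+ 2) :* k0) :* x :* i := x :* i) refl (Π N (odd ∘ suc)) I ⟩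
      Π N (odd ∘ suc) * I              R.≡⟨ Π-inverse N (odd-inv ∘ suc) ⟩
      ⟦ 1 ⟧ R.∎
    OQ : O * Q * (Ev⁻¹ * Ev⁻¹) ≡ sgn N * Π N (λ k → ⟦ 1 ⟧ - sq P * sq (even⁻¹ k))
    OQ = R.begin
      O * Q * (Ev⁻¹ * Ev⁻¹)
        R.≡⟨ cong₂ _*_ (trans (cong (_* Q) O-reverse) (sym (Π-* N (λ k → P - even k) (λ k → P + even k)))) (sym (Π-* N even⁻¹ even⁻¹)) ⟩
      Π N (λ k → (P - even k) * (P + even k)) * Π N (λ k → sq (even⁻¹ k))
        R.≡⟨ Π-* N (λ k → (P - even k) * (P + even k)) (λ k → sq (even⁻¹ k)) ⟨
      Π N (λ k → (P - even k) * (P + even k) * sq (even⁻¹ k))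
        R.≡⟨ Π-cong N (λ k _ → trans (solve 3 (λ p e f → (p :- e) :* (p :+ e) :* (f :* f) := :- k1 :* ((e :* f) :* (e :* f) :- p :* p :* (f :* f))) refl P (even k) (even⁻¹ k))
             (trans (cong (λ x → - ⟦ 1 ⟧ * (x * x - sq P * sq (even⁻¹ k))) (even-inv k))
               (solve 1 (λ x → :- k1 :* (k1 :* k1 :- x) := :- k1 :* (k1 :- x)) refl (sq P * sq (even⁻¹ k))))) ⟩
      Π N (λ k → - ⟦ 1 ⟧ * (⟦ 1 ⟧ - sq P * sq (even⁻¹ k)))
        R.≡⟨ trans (Π-* N (λ _ → - ⟦ 1 ⟧) (λ k → ⟦ 1 ⟧ - sq P * sq (even⁻¹ k))) (cong (_* Π N (λ k → ⟦ 1 ⟧ - sq P * sq (even⁻¹ k))) (Π-const N (- ⟦ 1 ⟧))) ⟩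
      sgn N * Π N (λ k → ⟦ 1 ⟧ - sq P * sq (even⁻¹ k)) R.∎

  -- The remainder is kept exact as p² Y, with Y known modulo p. The last term has one more factor p
  -- in front, so this is precisely the accuracy needed modulo p⁴.
  Π-expand : ∀ n (a : ℕ → ℚ) → (∀ k → k ℕ.< n → Int (a k)) →
    ∃ λ Y → Π n (λ k → ⟦ 1 ⟧ - sq P * a k) ≡ ⟦ 1 ⟧ + sq P * Y × Y ∼ - Σ n a
  Π-expand zero    a int = ⟦ 0 ⟧ , solve 1 (λ p → k1 := k1 :+ p :* k0) refl (sq P) , ≡⇒∼ (solve 0 (k0 := :- k0) refl)
  Π-expand (suc n) a int with Π-expand n a (λ k k<n → int k (ℕ.m<n⇒m<1+n k<n))
  ... | Y , eq , Y∼ = Y - a n - P * (P * (Y * a n))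
      , trans (cong (_* (⟦ 1 ⟧ - sq P * a n)) eq)
          (solve 3 (λ p y a → (k1 :+ p :* p :* y) :* (k1 :- p :* p :* a) := k1 :+ p :* p :* (y :- a :- p :* (p :* (y :* a)))) refl P Y (a n))
      , (begin
          Y - a n - P * (P * (Y * a n))
            ≈⟨ ∼-+ (∼-+ Y∼ (∼-refl { - a n})) (∼-neg (P*∼0 (int-* (int-⟨⟩ p) (int-* int-Y (int n (ℕ.n<1+n n)))))) ⟩
          - Σ n a - a n - ⟦ 0 ⟧    ≡⟨ solve 2 (λ s a → :- s :- a :- k0 := :- (s :+ a)) refl (Σ n a) (a n) ⟩
          - (Σ n a + a n)          ∎)
    where
    int-Y : Int Y
    int-Y = ∼-int Y∼ (int-neg (int-Σ n λ k k<n → int k (ℕ.m<n⇒m<1+n k<n)))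

  -- Sums of inverse squares.

  G : ℚ
  G = Σ N (λ k → sq (even⁻¹ k))

  ∼-neg-sq : ∀ {x y} → Int y → x ∼ - y → sq x ∼ sq y
  ∼-neg-sq {x} {y} i x∼-y = ∼-trans (∼-* (int-neg i) (int-neg i) x∼-y x∼-y) (≡⇒∼ (solve 1 (λ y → :- y :* :- y := y :* y) refl y))

  ∸suc< : ∀ {k n} → k ℕ.< n → n ∸ suc k ℕ.< n
  ∸suc< {k} {suc n} (s≤s k≤n) = s≤s (ℕ.m∸n≤m n k)

  odd⁻¹-reverse : ∀ {k} → k ℕ.< N → odd⁻¹ (N ∸ suc k) ∼ - even⁻¹ k
  odd⁻¹-reverse {k} k<N = ∼-inverse (odd (N ∸ suc k)) (odd⁻¹ (N ∸ suc k)) (- even k) (- even⁻¹ k)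
    (int-odd⁻¹ (∸suc< k<N)) (int-neg (int-even⁻¹ k<N)) (odd-inv (N ∸ suc k))
    (trans (solve 2 (λ x y → :- x :* :- y := x :* y) refl (even k) (even⁻¹ k)) (even-inv k))
    (∼-trans (≡⇒∼ (odd-reverse k<N)) P-∼)

  inv-reverse : ∀ {k} → k ℕ.< q → inv (suc (q ∸ suc k)) ∼ - inv (suc k)
  inv-reverse {k} k<q = ∼-inverse ⟦ suc (q ∸ suc k) ⟧ (inv (suc (q ∸ suc k))) (- ⟦ suc k ⟧) (- inv (suc k))
    (int-inv (unit-suc (∸suc< k<q))) (int-neg (int-inv (unit-suc k<q))) (*-inv (suc (q ∸ suc k)))
    (trans (solve 2 (λ x y → :- x :* :- y := x :* y) refl ⟦ suc k ⟧ (inv (suc k))) (*-inv (suc k)))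
    (∼-trans (≡⇒∼ (trans (cong ⟦_⟧ (sym (ℕ.+-∸-assoc 1 k<q))) (⟨∸⟩ (ℕ.m<n⇒m<1+n k<q)))) P-∼)

  inv² : ℕ → ℚ
  inv² k = sq (inv (suc k))

  inv²≡ : ∀ k → inv² k ≡ ⟦ 4 ⟧ * sq (even⁻¹ k)
  inv²≡ k = trans (cong sq (inv-suc≡even⁻¹ k)) (solve 1 (λ x → con (+ 2) :* x :* (con (+ 2) :* x) := con (+ 4) :* (x :* x)) refl (even⁻¹ k))

  Σinv² : Σ N inv² ≡ ⟦ 4 ⟧ * G
  Σinv² = trans (Σ-cong N λ k _ → inv²≡ k) (Σ-*ˡ N ⟦ 4 ⟧ (sq ∘ even⁻¹))

  -- The sum of 1/k² over 0 < k < p is 2G by parity of k, and 8G by k ↦ p - k.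
  full-sum₁ : Σ q inv² ∼ ⟦ 2 ⟧ * G
  full-sum₁ = begin
    Σ q inv²                                                    ≡⟨ Σ-double N inv² ⟩
    Σ N (λ k → sq (odd⁻¹ k) + inv² (suc (2 ℕ.* k)))             ≡⟨ Σ-+ N (sq ∘ odd⁻¹) (λ k → inv² (suc (2 ℕ.* k))) ⟩
    Σ N (sq ∘ odd⁻¹) + Σ N (λ k → inv² (suc (2 ℕ.* k)))
      ≡⟨ cong₂ _+_ (Σ-reverse N (sq ∘ odd⁻¹)) (Σ-cong N λ k _ → cong (sq ∘ inv) (sym (ℕ.*-suc 2 k))) ⟩
    Σ N (λ k → sq (odd⁻¹ (N ∸ suc k))) + G
      ≈⟨ ∼-+ (∼-Σ N λ k k<N → ∼-neg-sq (int-even⁻¹ k<N) (odd⁻¹-reverse k<N)) ∼-refl ⟩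
    G + G                                                       ≡⟨ solve 1 (λ g → g :+ g := con (+ 2) :* g) refl G ⟩
    ⟦ 2 ⟧ * G                                                   ∎

  full-sum₂ : Σ q inv² ∼ ⟦ 8 ⟧ * G
  full-sum₂ = begin
    Σ q inv²                                        ≡⟨ cong (λ n → Σ n inv²) 2N≡N+N ⟩
    Σ (N ℕ.+ N) inv²                                ≡⟨ Σ-++ N N inv² ⟩
    Σ N inv² + Σ N (λ k → inv² (N ℕ.+ k))           ≡⟨ cong (λ x → Σ N inv² + x) (Σ-reverse N (λ k → inv² (N ℕ.+ k))) ⟩
    Σ N inv² + Σ N (λ k → inv² (N ℕ.+ (N ∸ suc k)))
      ≡⟨ cong (λ x → Σ N inv² + x) (Σ-cong N λ k k<N → cong inv² (trans (sym (ℕ.+-∸-assoc N k<N)) (cong (_∸ suc k) (sym 2N≡N+N)))) ⟩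
    Σ N inv² + Σ N (λ k → inv² (q ∸ suc k))
      ≈⟨ ∼-+ (∼-refl {Σ N inv²}) (∼-Σ N λ k k<N → ∼-neg-sq (int-inv (unit-suc (ℕ.<-≤-trans k<N N≤q))) (inv-reverse (ℕ.<-≤-trans k<N N≤q))) ⟩
    Σ N inv² + Σ N inv²                             ≡⟨ cong (λ x → x + x) Σinv² ⟩
    ⟦ 4 ⟧ * G + ⟦ 4 ⟧ * G                           ≡⟨ solve 1 (λ g → con (+ 4) :* g :+ con (+ 4) :* g := con (+ 8) :* g) refl G ⟩
    ⟦ 8 ⟧ * G                                       ∎
    where
    2N≡N+N : 2 ℕ.* N ≡ N ℕ.+ N
    2N≡N+N = cong (N ℕ.+_) (ℕ.+-identityʳ N)

  -- The two evaluations of the full sum give 8G ≡ 2G, hence 6G ≡ 0. At p = 3 one has G = 1/4, which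
  -- is not 0 modulo 3.
  G∼0 : Unit 3 → G ∼ ⟦ 0 ⟧
  G∼0 unit-3 = ∼-cancel-unit (unit-* unit-2 unit-3) (begin
    ⟦ 6 ⟧ * G                  ≡⟨ solve 1 (λ g → con (+ 6) :* g := con (+ 8) :* g :- con (+ 2) :* g) refl G ⟩
    ⟦ 8 ⟧ * G - ⟦ 2 ⟧ * G      ≈⟨ ∼-+ full-sum₂ (∼-neg full-sum₁) ⟨
    Σ q inv² - Σ q inv²        ≡⟨ solve 1 (λ g → g :- g := con (+ 6) :* k0) refl (Σ q inv²) ⟩
    ⟦ 6 ⟧ * ⟦ 0 ⟧              ∎)

  -- The remaining terms of the WZ sum and Euler numbers modulo p.

  α : ℕ → ℚ
  α = wzG (dbl N)

  -- Induction on k, the two sides having the same ratio modulo p. From k to k + 1 it is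
  -- -(2k+2)(2N-2k) / (2k+3)² on the left since p ≡ 0; on the right `v-descend` gives the same
  -- numerator over (2(N-k-1))², and 2(N-k-1) ≡ -(2k+3). The constant 4 is 1/N², from k = 0 and 2N ≡
  -- -1.
  α∼v : ∀ k → k ℕ.< N → ⟦ 4 ⟧ * α k ∼ sgn N * v N (N ∸ suc k)
  int-v : ∀ k → k ℕ.< N → Int (v N k)
  int-v k k<N = int-* (int-sgn (suc k)) (int-* (int-* i i) (int-inv (unit-C k<N (s≤s N≤q))))
    where i = int-inv (unit-suc (ℕ.<-≤-trans k<N N≤q))

  N²-inverse : inv N * inv N ∼ ⟦ 4 ⟧
  N²-inverse = ∼-cancel-unit unit-N (∼-cancel-unit unit-N (begin
    ⟦ N ⟧ * (⟦ N ⟧ * (inv N * inv N))     ≡⟨ solve 2 (λ n i → n :* (n :* (i :* i)) := (n :* i) :* (n :* i)) refl ⟦ N ⟧ (inv N) ⟩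
    (⟦ N ⟧ * inv N) * (⟦ N ⟧ * inv N)     ≡⟨ cong sq (*-inv N {{N≢0}}) ⟩
    ⟦ 1 ⟧ * ⟦ 1 ⟧                         ≡⟨ solve 0 (k1 :* k1 := :- k1 :* :- k1) refl ⟩
    - ⟦ 1 ⟧ * - ⟦ 1 ⟧                     ≈⟨ ∼-* (int-neg int-1) (int-neg int-1) 2N∼-1 2N∼-1 ⟨
    dbl N * dbl N                         ≡⟨ solve 1 (λ n → con (+ 2) :* n :* (con (+ 2) :* n) := n :* (n :* con (+ 4))) refl ⟦ N ⟧ ⟩
    ⟦ N ⟧ * (⟦ N ⟧ * ⟦ 4 ⟧)               ∎))
    where
    unit-N : Unit N
    unit-N = unit-< {N} {{N≢0}} (s≤s N≤q)
    2N∼-1 : dbl N ∼ - ⟦ 1 ⟧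
    2N∼-1 = ∼-trans (≡⇒∼ (trans (solve 1 (λ n → n := k1 :+ n :- k1) refl (dbl N)) (cong (_- ⟦ 1 ⟧) (sym P≡odd)))) P+

  α∼v zero    0<N = begin
    ⟦ 4 ⟧ * ⟦ 1 ⟧                                 ≡⟨ solve 0 (con (+ 4) :* k1 := k1 :* (con (+ 4) :* k1)) refl ⟩
    ⟦ 1 ⟧ * (⟦ 4 ⟧ * ⟦ 1 ⟧)                       ≡⟨ cong₂ (λ a b → a * (⟦ 4 ⟧ * b)) (sym (sgn² N)) (sym inv1) ⟩
    sgn N * sgn N * (⟦ 4 ⟧ * inv 1)
      ≈⟨ ∼-*ˡ (int-* (int-sgn N) (int-sgn N)) (∼-*ʳ (subst Int (sym inv1) int-1) N²-inverse) ⟨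
    sgn N * sgn N * (inv N * inv N * inv 1)       ≡⟨ ℚ.*-assoc (sgn N) (sgn N) (inv N * inv N * inv 1) ⟩
    sgn N * (sgn N * (inv N * inv N * inv 1))     ≡⟨ cong (sgn N *_) (last N {{N≢0}}) ⟨
    sgn N * v N (N ∸ 1)                           ∎
    where
    last : ∀ n .{{_ : ℕ.NonZero n}} → v n (n ∸ 1) ≡ sgn n * (inv n * inv n * inv 1)
    last (suc n) = cong (λ c → sgn (suc n) * (inv (suc n) * inv (suc n) * inv c)) (nCn≡1 (suc n))
  α∼v (suc k) 1+k<N = ∼-cancel-unit (unit-odd 1+k<N) (∼-cancel-unit (unit-odd 1+k<N) (begin
    ⟦o⟧ * (⟦o⟧ * (⟦ 4 ⟧ * (- (y * z * (i * i)) * α k)))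
      ≡⟨ cong (λ o → o * (o * (⟦ 4 ⟧ * (- (y * z * (i * i)) * α k)))) (⟨odd⟩ (suc k)) ⟩
    o * (o * (⟦ 4 ⟧ * (- (y * z * (i * i)) * α k)))
      ≡⟨ solve 5 (λ o y z i a → o :* (o :* (con (+ 4) :* (:- (y :* z :* (i :* i)) :* a))) := :- (y :* z) :* ((o :* i) :* (o :* i)) :* (con (+ 4) :* a)) refl o y z i (α k) ⟩
    - (y * z) * ((o * i) * (o * i)) * (⟦ 4 ⟧ * α k)
      ≡⟨ cong (λ e → - (y * z) * (e * e) * (⟦ 4 ⟧ * α k)) (odd-inv (suc k)) ⟩
    - (y * z) * (⟦ 1 ⟧ * ⟦ 1 ⟧) * (⟦ 4 ⟧ * α k)
      ≡⟨ solve 3 (λ y z a → :- (y :* z) :* (k1 :* k1) :* a := :- (y :* z) :* a) refl y z (⟦ 4 ⟧ * α k) ⟩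
    - (y * z) * (⟦ 4 ⟧ * α k)
      ≈⟨ ∼-* int-2k2z (int-* (int-sgn N) (int-v (N ∸ suc k) (∸suc< k<N))) (∼-neg (∼-*ʳ int-z y∼)) (α∼v k k<N) ⟩
    - (⟦ 2 ⟧ * ⟦ suc k ⟧ * z) * (sgn N * v N (N ∸ suc k))
      ≡⟨ cong₂ (λ a b → - (⟦ 2 ⟧ * ⟦ suc k ⟧ * a) * (sgn N * v N b)) z≡ m-suc ⟩
    - (⟦ 2 ⟧ * ⟦ suc k ⟧ * (⟦ 2 ⟧ * ⟦ suc (suc m) ⟧)) * (sgn N * v N (suc m))
      ≡⟨ solve 4 (λ k m s v → :- (con (+ 2) :* k :* (con (+ 2) :* m)) :* (s :* v) := con (+ 4) :* s :* :- (k :* m :* v)) refl ⟦ suc k ⟧ ⟦ suc (suc m) ⟧ (sgn N) (v N (suc m)) ⟩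
    ⟦ 4 ⟧ * sgn N * - (⟦ suc k ⟧ * ⟦ suc (suc m) ⟧ * v N (suc m))
      ≡⟨ cong (⟦ 4 ⟧ * sgn N *_) (trans (v-descend {N} {m} 1+m<N) (cong (λ d → - (d * ⟦ suc (suc m) ⟧ * v N (suc m))) N-m)) ⟨
    ⟦ 4 ⟧ * sgn N * (⟦ suc m ⟧ * ⟦ suc m ⟧ * v N m)
      ≡⟨ solve 3 (λ m s v → con (+ 4) :* s :* (m :* m :* v) := (con (+ 2) :* m) :* (con (+ 2) :* m) :* (s :* v)) refl ⟦ suc m ⟧ (sgn N) (v N m) ⟩
    (⟦ 2 ⟧ * ⟦ suc m ⟧) * (⟦ 2 ⟧ * ⟦ suc m ⟧) * (sgn N * v N m)
      ≈⟨ ∼-*ʳ (int-* (int-sgn N) (int-v m (ℕ.<-trans (ℕ.n<1+n m) 1+m<N))) (∼-neg-sq (int-odd (suc k)) 2m∼) ⟩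
    o * o * (sgn N * v N m)           ≡⟨ ℚ.*-assoc o o (sgn N * v N m) ⟩
    o * (o * (sgn N * v N m))         ≡⟨ cong (λ o → o * (o * (sgn N * v N m))) (⟨odd⟩ (suc k)) ⟨
    ⟦o⟧ * (⟦o⟧ * (sgn N * v N m))     ∎))
    where
    o ⟦o⟧ y z i : ℚ
    o = odd (suc k)
    ⟦o⟧ = ⟦ suc (2 ℕ.* suc k) ⟧
    y = dbl N + odd (suc k)
    z = dbl N - ⟦ 2 ⟧ * ⟦ k ⟧
    i = odd⁻¹ (suc k)
    m : ℕ
    m = N ∸ suc (suc k)
    k<N : k ℕ.< N
    k<N = ℕ.<⇒≤ 1+k<N
    m-suc : N ∸ suc k ≡ suc m
    m-suc = ℕ.+-∸-assoc 1 1+k<N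
    1+m<N : suc m ℕ.< N
    1+m<N = subst (ℕ._< N) m-suc (∸suc< k<N)
    ⟦1+m⟧ : ⟦ suc m ⟧ ≡ ⟦ N ⟧ - (⟦ 1 ⟧ + ⟦ k ⟧)
    ⟦1+m⟧ = trans (cong ⟦_⟧ (sym m-suc)) (trans (⟨∸⟩ k<N) (cong (λ s → ⟦ N ⟧ - s) (⟨suc⟩ k)))
    N-m : ⟦ N ⟧ - ⟦ suc m ⟧ ≡ ⟦ suc k ⟧
    N-m = trans (cong (λ s → ⟦ N ⟧ - s) ⟦1+m⟧) (trans (solve 2 (λ n s → n :- (n :- s) := s) refl ⟦ N ⟧ (⟦ 1 ⟧ + ⟦ k ⟧)) (sym (⟨suc⟩ k)))
    z≡ : z ≡ ⟦ 2 ⟧ * ⟦ suc (suc m) ⟧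
    z≡ = sym (trans (cong (⟦ 2 ⟧ *_) (trans (⟨suc⟩ (suc m)) (cong (λ s → ⟦ 1 ⟧ + s) ⟦1+m⟧)))
      (solve 2 (λ n k → con (+ 2) :* (k1 :+ (n :- (k1 :+ k))) := con (+ 2) :* n :- con (+ 2) :* k) refl ⟦ N ⟧ ⟦ k ⟧))
    int-z : Int z
    int-z = subst Int (sym z≡) (int-* (int-⟨⟩ 2) (int-⟨⟩ (suc (suc m))))
    int-2k2z : Int (- (⟦ 2 ⟧ * ⟦ suc k ⟧ * z))
    int-2k2z = int-neg (int-* (int-* (int-⟨⟩ 2) (int-⟨⟩ (suc k))) int-z)
    y∼ : y ∼ ⟦ 2 ⟧ * ⟦ suc k ⟧
    y∼ = ∼-trans (≡⇒∼ (trans (solve 2 (λ n s → con (+ 2) :* n :+ (k1 :+ con (+ 2) :* s) := (k1 :+ con (+ 2) :* n) :+ con (+ 2) :* s) refl ⟦ N ⟧ ⟦ suc k ⟧)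
      (cong (_+ ⟦ 2 ⟧ * ⟦ suc k ⟧) (sym P≡odd)))) P+
    2m∼ : ⟦ 2 ⟧ * ⟦ suc m ⟧ ∼ - o
    2m∼ = ∼-trans (≡⇒∼ (trans (cong (⟦ 2 ⟧ *_) ⟦1+m⟧)
      (trans (solve 2 (λ n k → con (+ 2) :* (n :- (k1 :+ k)) := k1 :+ con (+ 2) :* n :- (k1 :+ con (+ 2) :* (k1 :+ k))) refl ⟦ N ⟧ ⟦ k ⟧)
        (cong₂ (λ a s → a - (⟦ 1 ⟧ + ⟦ 2 ⟧ * s)) (sym P≡odd) (sym (⟨suc⟩ k)))))) P-∼

  T^-∼ : ∀ {y} r → y ∼ ⟦ 0 ⟧ → ∀ t → T^ y r Eℚ t ∼ Eℚ (r ℕ.+ t)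
  T^-∼ {y} zero    y∼0 t = ∼-refl
  T^-∼ {y} (suc r) y∼0 t = begin
    T^ y r Eℚ (suc t) + y * T^ y r Eℚ t       ≈⟨ ∼-+ (T^-∼ r y∼0 (suc t)) (∼-* (int-⟨⟩ 0) (int-ι (E (r ℕ.+ t))) y∼0 (T^-∼ r y∼0 t)) ⟩
    Eℚ (r ℕ.+ suc t) + ⟦ 0 ⟧ * Eℚ (r ℕ.+ t)   ≡⟨ cong (λ k → Eℚ k + ⟦ 0 ⟧ * Eℚ (r ℕ.+ t)) (ℕ.+-suc r t) ⟩
    Eℚ (suc r ℕ.+ t) + ⟦ 0 ⟧ * Eℚ (r ℕ.+ t)   ≡⟨ solve 2 (λ a b → a :+ k0 :* b := a) refl (Eℚ (suc r ℕ.+ t)) (Eℚ (r ℕ.+ t)) ⟩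
    Eℚ (suc r ℕ.+ t)                          ∎

  e∼E : ∀ {y} r → y ∼ ⟦ 0 ⟧ → e r y ∼ Eℚ r
  e∼E r y∼0 = ∼-trans (T^-∼ r y∼0 0) (≡⇒∼ (cong Eℚ (ℕ.+-identityʳ r)))

  -- The half sum for p > 3.

  module _ (m : ℕ) (N≡2+m : N ≡ suc (suc m)) where
    -- This is p - 3, in the visibly even and positive form on which `alternating-powers` relies.
    r : ℕ
    r = 2 ℕ.* suc m

    q≡2+r : q ≡ suc (suc r)
    q≡2+r = trans (cong (2 ℕ.*_) N≡2+m) (ℕ.*-suc 2 (suc m))

    pow-inverse : ∀ {k} → k ℕ.< N → pow (even k) r ∼ sq (even⁻¹ k)
    pow-inverse {k} k<N = ∼-cancel (even k) (even⁻¹ k) (int-even⁻¹ k<N) (even-inv k)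
      (∼-cancel (even k) (even⁻¹ k) (int-even⁻¹ k<N) (even-inv k) (begin
        pow (even k) (suc (suc r))                    ≡⟨ cong₂ pow (⟨even⟩ k) q≡2+r ⟨
        pow ⟦ 2 ℕ.* suc k ⟧ q                         ≈⟨ fermat-unit (unit-even k<N) ⟩
        ⟦ 1 ⟧                                         ≡⟨ solve 0 (k1 := k1 :* k1) refl ⟩
        ⟦ 1 ⟧ * ⟦ 1 ⟧                                 ≡⟨ cong sq (even-inv k) ⟨
        sq (even k * even⁻¹ k)                        ≡⟨ solve 2 (λ x y → x :* y :* (x :* y) := x :* (x :* (y :* y))) refl (even k) (even⁻¹ k) ⟩
        even k * (even k * sq (even⁻¹ k))             ∎))

    alternating-inv² : Σ N (λ k → sgn (suc k) * inv² k) ∼ sgn N * (⟦ 2 ⟧ * Eℚ r)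
    alternating-inv² = begin
      Σ N (λ k → sgn (suc k) * inv² k)                  ≡⟨ Σ-cong N (λ k _ → cong (sgn (suc k) *_) (inv²≡ k)) ⟩
      Σ N (λ k → sgn (suc k) * (⟦ 4 ⟧ * sq (even⁻¹ k)))
        ≈⟨ ∼-Σ N (λ k k<N → ∼-*ˡ (int-sgn (suc k)) (∼-*ˡ (int-⟨⟩ 4) (pow-inverse k<N))) ⟨
      Σ N (λ k → sgn (suc k) * (⟦ 4 ⟧ * pow (even k) r)) ≡⟨ alternating-powers m N ⟩
      sgn N * (e r (odd N) + e r (- odd N))
        ≈⟨ ∼-*ˡ (int-sgn N) (∼-+ (e∼E r oddN∼0) (e∼E r (∼-trans (∼-neg oddN∼0) (≡⇒∼ (solve 0 (:- k0 := k0) refl))))) ⟩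
      sgn N * (Eℚ r + Eℚ r)                             ≡⟨ cong (sgn N *_) (solve 1 (λ x → x :+ x := con (+ 2) :* x) refl (Eℚ r)) ⟩
      sgn N * (⟦ 2 ⟧ * Eℚ r)                            ∎
      where
      oddN∼0 : odd N ∼ ⟦ 0 ⟧
      oddN∼0 = ∼-trans (≡⇒∼ (sym P≡odd)) P∼0

    unit-3 : Unit 3
    unit-3 = unit-< {3} (s≤s (subst (3 ℕ.≤_) (sym q≡2+r) (s≤s (s≤s (s≤s z≤n)))))

    -- The non-alternating part of `Σ-v` is 4G ≡ 0. The alternating part carries its own (-1)^N,
    -- which cancels the one from `α∼v`.
    Σα∼E : Σ N α ∼ Eℚ r
    Σα∼E = ∼-cancel-unit (unit-* unit-2 unit-2) (begin
      ⟦ 4 ⟧ * Σ N α                                    ≡⟨ Σ-*ˡ N ⟦ 4 ⟧ α ⟨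
      Σ N (λ k → ⟦ 4 ⟧ * α k)                          ≈⟨ ∼-Σ N α∼v ⟩
      Σ N (λ k → sgn N * v N (N ∸ suc k))              ≡⟨ Σ-*ˡ N (sgn N) (λ k → v N (N ∸ suc k)) ⟩
      sgn N * Σ N (λ k → v N (N ∸ suc k))              ≡⟨ cong (sgn N *_) (trans (sym (Σ-reverse N (v N))) (Σ-v N)) ⟩
      sgn N * Σ N inv²-alt
        ≡⟨ cong (sgn N *_) (Σ-cong N λ k _ → solve 2 (λ s i → (k1 :+ con (+ 2) :* s) :* i := i :+ con (+ 2) :* (s :* i)) refl (sgn (suc k)) (inv² k)) ⟩
      sgn N * Σ N (λ k → inv² k + ⟦ 2 ⟧ * (sgn (suc k) * inv² k))
        ≡⟨ cong (sgn N *_) (trans (Σ-+ N inv² (λ k → ⟦ 2 ⟧ * (sgn (suc k) * inv² k)))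
             (cong₂ _+_ Σinv² (Σ-*ˡ N ⟦ 2 ⟧ (λ k → sgn (suc k) * inv² k)))) ⟩
      sgn N * (⟦ 4 ⟧ * G + ⟦ 2 ⟧ * Σ N (λ k → sgn (suc k) * inv² k))
        ≈⟨ ∼-*ˡ (int-sgn N) (∼-+ (∼-*ˡ (int-⟨⟩ 4) (G∼0 unit-3)) (∼-*ˡ (int-⟨⟩ 2) alternating-inv²)) ⟩
      sgn N * (⟦ 4 ⟧ * ⟦ 0 ⟧ + ⟦ 2 ⟧ * (sgn N * (⟦ 2 ⟧ * Eℚ r)))
        ≡⟨ solve 2 (λ s e → s :* (con (+ 4) :* k0 :+ con (+ 2) :* (s :* (con (+ 2) :* e))) := s :* s :* (con (+ 4) :* e)) refl (sgn N) (Eℚ r) ⟩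
      sgn N * sgn N * (⟦ 4 ⟧ * Eℚ r)                   ≡⟨ cong (_* (⟦ 4 ⟧ * Eℚ r)) (sgn² N) ⟩
      ⟦ 1 ⟧ * (⟦ 4 ⟧ * Eℚ r)                           ≡⟨ solve 1 (λ x → k1 :* x := x) refl (⟦ 4 ⟧ * Eℚ r) ⟩
      ⟦ 4 ⟧ * Eℚ r                                     ∎)

    -- Two contributions to z: the terms k < N give t(N) times their sum, congruent to the Euler
    -- number, and the p² part of the last term gives (-1)^N Y ≡ -(-1)^N G ≡ 0.
    half-sum : ∃ λ z → Σ (suc N) [4n+1]t ≡ P * sgn N + cube P * z × z ∼ Eℚ r
    half-sum = t N * Σ N α + sgn N * Y , exact , (begin
      t N * Σ N α + sgn N * Y         ≈⟨ ∼-+ (∼-* int-1 (int-ι (E r)) t∼1 Σα∼E) (∼-*ˡ (int-sgn N) (∼-trans Y∼ (∼-neg (G∼0 unit-3)))) ⟩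
      ⟦ 1 ⟧ * Eℚ r + sgn N * - ⟦ 0 ⟧  ≡⟨ solve 2 (λ e s → k1 :* e :+ s :* :- k0 := e) refl (Eℚ r) (sgn N) ⟩
      Eℚ r                            ∎)
      where
      expansion = Π-expand N (λ k → sq (even⁻¹ k)) (λ k k<N → int-* (int-even⁻¹ k<N) (int-even⁻¹ k<N))
      Y = proj₁ expansion
      eq = proj₁ (proj₂ expansion)
      Y∼ = proj₂ (proj₂ expansion)
      exact : Σ (suc N) [4n+1]t ≡ P * sgn N + cube P * (t N * Σ N α + sgn N * Y)
      exact = R.begin
        Σ (suc N) [4n+1]t                                     R.≡⟨ Σ-[4n+1]t N ⟩
        t N * cube (odd N) * (Σ N α + α N)               R.≡⟨ cong (λ o → t N * cube o * (Σ N α + α N)) P≡odd ⟨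
        t N * cube P * (Σ N α + α N)
          R.≡⟨ solve 4 (λ t c s a → t :* c :* (s :+ a) := c :* t :* a :+ c :* (t :* s)) refl (t N) (cube P) (Σ N α) (α N) ⟩
        cube P * t N * α N + cube P * (t N * Σ N α)
          R.≡⟨ cong (_+ cube P * (t N * Σ N α)) (trans last-term (cong (λ x → P * (sgn N * x)) eq)) ⟩
        P * (sgn N * (⟦ 1 ⟧ + sq P * Y)) + cube P * (t N * Σ N α)
          R.≡⟨ solve 4 (λ p s y a → p :* (s :* (k1 :+ p :* p :* y)) :+ p :* p :* p :* a := p :* s :+ p :* p :* p :* (a :+ s :* y)) refl P (sgn N) Y (t N * Σ N α) ⟩
        P * sgn N + cube P * (t N * Σ N α + sgn N * Y)   R.∎

  -- The upper range N < k < p.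

  int-ρ : ∀ {k} → suc k ℕ.< p → Int (ρ k)
  int-ρ {k} 1+k<p = int-* (int-odd k) (int-inv (unit-* unit-2 (unit-< 1+k<p)))

  int-t : ∀ k → k ℕ.< p → Int (t k)
  int-t zero    _     = int-1
  int-t (suc k) 1+k<p = int-* (int-neg (int-cube (int-ρ 1+k<p))) (int-t k (ℕ.<⇒≤ 1+k<p))

  int-[4n+1]t : ∀ k → k ℕ.< p → Int ([4n+1]t k)
  int-[4n+1]t k k<p = int-* (int-+ (int-* (int-⟨⟩ 2) (int-* (int-⟨⟩ 2) (int-⟨⟩ k))) int-1) (int-t k k<p)

  -- The quotient of t(N+1+i) by p³. Among the odd numbers 2k + 1 below 2p only the one at k = N is
  -- divisible by p, and it enters cubed; its factor p is left out of the initial value.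
  τ : ℕ → ℚ
  τ zero    = - cube (even⁻¹ N) * t N
  τ (suc i) = - cube (ρ (suc N ℕ.+ i)) * τ i

  t-upper : ∀ i → t (suc N ℕ.+ i) ≡ cube P * τ i
  t-upper zero    = trans (cong t (ℕ.+-identityʳ (suc N))) (trans (cong (λ o → - cube (o * even⁻¹ N) * t N) (sym P≡odd))
    (solve 3 (λ p e t → let c = λ x → x :* x :* x in :- c (p :* e) :* t := c p :* (:- c e :* t)) refl P (even⁻¹ N) (t N)))
  t-upper (suc i) = trans (cong t (ℕ.+-suc (suc N) i)) (trans (cong (- cube (ρ (suc N ℕ.+ i)) *_) (t-upper i))
    (solve 3 (λ a b c → a :* (b :* c) := b :* (a :* c)) refl (- cube (ρ (suc N ℕ.+ i))) (cube P) (τ i)))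

  p≡ : suc N ℕ.+ N ≡ p
  p≡ = cong suc (cong (N ℕ.+_) (sym (ℕ.+-identityʳ N)))

  upper< : ∀ {i} → i ℕ.< N → suc N ℕ.+ i ℕ.< p
  upper< {i} i<N = subst (suc N ℕ.+ i ℕ.<_) p≡ (ℕ.+-monoʳ-< (suc N) i<N)

  int-τ : ∀ i → i ℕ.< N → Int (τ i)
  int-τ zero    0<N = int-* (int-neg (int-cube (int-inv (unit-* unit-2 (unit-< {suc N} (subst (ℕ._< p) (ℕ.+-identityʳ (suc N)) (upper< 0<N)))))))
    (int-t N (s≤s N≤q))
  int-τ (suc i) 1+i<N = int-* (int-neg (int-cube (int-ρ (subst (ℕ._< p) (ℕ.+-suc (suc N) i) (upper< 1+i<N)))))
    (int-τ i (ℕ.<⇒≤ 1+i<N))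

  u : ℕ → ℚ
  u i = inv ((N ∸ 1) C i)

  N≡ : N ≡ suc (N ∸ 1)
  N≡ = sym (ℕ.m+[n∸m]≡n {1} {N} (ℕ.>-nonZero⁻¹ N {{N≢0}}))

  i≤N-1 : ∀ {i} → i ℕ.< N → i ℕ.≤ N ∸ 1
  i≤N-1 {i} i<N = ℕ.≤-pred (subst (suc i ℕ.≤_) N≡ i<N)

  ⟦N-1⟧ : ⟦ N ∸ 1 ⟧ ≡ ⟦ N ⟧ - ⟦ 1 ⟧
  ⟦N-1⟧ = ⟨∸⟩ (ℕ.>-nonZero⁻¹ N {{N≢0}})

  int-u : ∀ {i} → i ℕ.< N → Int (u i)
  int-u {i} i<N = int-inv (unit-C (i≤N-1 i<N) (s≤s (ℕ.≤-trans (ℕ.m∸n≤m N 1) N≤q)))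

  odd+N : ∀ i → odd (suc N ℕ.+ i) ≡ P + even i
  odd+N i = trans (cong (λ s → ⟦ 1 ⟧ + ⟦ 2 ⟧ * s) (trans (⟨+⟩ (suc N) i) (cong (_+ ⟦ i ⟧) (⟨suc⟩ N))))
    (trans (solve 2 (λ n i → k1 :+ con (+ 2) :* (k1 :+ n :+ i) := k1 :+ con (+ 2) :* n :+ (con (+ 2) :+ con (+ 2) :* i)) refl ⟦ N ⟧ ⟦ i ⟧)
      (cong (_+ even i) (sym P≡odd)))

  even+N : ∀ i → even (suc N ℕ.+ i) ≡ P + odd (suc i)
  even+N i = trans (cong (λ s → ⟦ 2 ⟧ + ⟦ 2 ⟧ * s) (trans (⟨+⟩ (suc N) i) (cong (_+ ⟦ i ⟧) (⟨suc⟩ N))))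
    (trans (solve 2 (λ n i → con (+ 2) :+ con (+ 2) :* (k1 :+ n :+ i) := k1 :+ con (+ 2) :* n :+ (k1 :+ con (+ 2) :* (k1 :+ i))) refl ⟦ N ⟧ ⟦ i ⟧)
      (cong₂ (λ o s → o + (⟦ 1 ⟧ + ⟦ 2 ⟧ * s)) (sym P≡odd) (sym (⟨suc⟩ i))))

  ρ-upper : ∀ {i} → suc i ℕ.< N → ρ (suc N ℕ.+ i) ∼ even i * odd⁻¹ (suc i)
  ρ-upper {i} 1+i<N = ∼-* (int-even i) (int-odd⁻¹ 1+i<N) (∼-trans (≡⇒∼ (odd+N i)) P+)
    (∼-inverse (even (suc N ℕ.+ i)) (even⁻¹ (suc N ℕ.+ i)) (odd (suc i)) (odd⁻¹ (suc i))
      (int-inv (unit-* unit-2 (unit-< {suc (suc N ℕ.+ i)} (subst (ℕ._< p) (ℕ.+-suc (suc N) i) (upper< 1+i<N))))) (int-odd⁻¹ 1+i<N)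
      (even-inv (suc N ℕ.+ i)) (odd-inv (suc i)) (∼-trans (≡⇒∼ (even+N i)) P+))

  -- The exact ratio of neighbouring reciprocals is (i+1) / (N-1-i), and 2(N-1-i) = p - (2i+3).
  u-step : ∀ {i} → suc i ℕ.< N → - (even i * odd⁻¹ (suc i)) * u i ∼ u (suc i)
  u-step {i} 1+i<N = ∼-cancel (odd (suc i)) (odd⁻¹ (suc i)) (int-odd⁻¹ 1+i<N) (odd-inv (suc i)) (begin
    o * (- (even i * odd⁻¹ (suc i)) * u i)
      ≡⟨ solve 4 (λ o e f u → o :* (:- (e :* f) :* u) := :- (o :* f :* e :* u)) refl o (even i) (odd⁻¹ (suc i)) (u i) ⟩
    - (o * odd⁻¹ (suc i) * even i * u i)     ≡⟨ cong (λ x → - (x * even i * u i)) (odd-inv (suc i)) ⟩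
    - (⟦ 1 ⟧ * even i * u i)                 ≡⟨ solve 2 (λ i u → :- (k1 :* (con (+ 2) :+ con (+ 2) :* i) :* u) := :- (con (+ 2) :* ((k1 :+ i) :* u))) refl ⟦ i ⟧ (u i) ⟩
    - (⟦ 2 ⟧ * ((⟦ 1 ⟧ + ⟦ i ⟧) * u i))      ≡⟨ cong (λ s → - (⟦ 2 ⟧ * (s * u i))) (⟨suc⟩ i) ⟨
    - (⟦ 2 ⟧ * (⟦ suc i ⟧ * u i))            ≡⟨ cong (λ x → - (⟦ 2 ⟧ * x)) exchange ⟩
    - (⟦ 2 ⟧ * ((⟦ n ⟧ - ⟦ i ⟧) * u (suc i))) ≡⟨ solve 3 (λ n i u → :- (con (+ 2) :* ((n :- i) :* u)) := :- (con (+ 2) :* (n :- i)) :* u) refl ⟦ n ⟧ ⟦ i ⟧ (u (suc i)) ⟩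
    - (⟦ 2 ⟧ * (⟦ n ⟧ - ⟦ i ⟧)) * u (suc i)  ≈⟨ ∼-*ʳ (int-u 1+i<N) (∼-neg 2n-2i) ⟩
    - - o * u (suc i)                        ≡⟨ solve 2 (λ o u → :- :- o :* u := o :* u) refl o (u (suc i)) ⟩
    o * u (suc i)                            ∎)
    where
    n : ℕ
    n = N ∸ 1
    o : ℚ
    o = odd (suc i)
    instance
      _ = C≢0 {n} {i} (i≤N-1 (ℕ.<⇒≤ 1+i<N))
      _ = C≢0 {n} {suc i} (i≤N-1 1+i<N)
    2n-2i : ⟦ 2 ⟧ * (⟦ n ⟧ - ⟦ i ⟧) ∼ - o
    2n-2i = ∼-trans (≡⇒∼ (trans (cong (λ x → ⟦ 2 ⟧ * (x - ⟦ i ⟧)) ⟦N-1⟧)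
      (trans (solve 2 (λ n i → con (+ 2) :* (n :- k1 :- i) := k1 :+ con (+ 2) :* n :- (k1 :+ con (+ 2) :* (k1 :+ i))) refl ⟦ N ⟧ ⟦ i ⟧)
        (cong₂ (λ a s → a - (⟦ 1 ⟧ + ⟦ 2 ⟧ * s)) (sym P≡odd) (sym (⟨suc⟩ i)))))) P-∼
    exchange : ⟦ suc i ⟧ * u i ≡ (⟦ n ⟧ - ⟦ i ⟧) * u (suc i)
    exchange = R.begin
      s * u i                                  R.≡⟨ solve 2 (λ s x → s :* x := s :* x :* k1) refl s (u i) ⟩
      s * u i * ⟦ 1 ⟧                          R.≡⟨ cong (s * u i *_) (*-inv (n C suc i)) ⟨
      s * u i * (B n (suc i) * u (suc i))      R.≡⟨ solve 4 (λ s x b y → s :* x :* (b :* y) := s :* b :* (x :* y)) refl s (u i) (B n (suc i)) (u (suc i)) ⟩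
      s * B n (suc i) * (u i * u (suc i))      R.≡⟨ cong (_* (u i * u (suc i))) (B-suc n i) ⟩
      d * B n i * (u i * u (suc i))            R.≡⟨ solve 4 (λ d b x y → d :* b :* (x :* y) := d :* (b :* x) :* y) refl d (B n i) (u i) (u (suc i)) ⟩
      d * (B n i * u i) * u (suc i)            R.≡⟨ cong (λ x → d * x * u (suc i)) (*-inv (n C i)) ⟩
      d * ⟦ 1 ⟧ * u (suc i)                    R.≡⟨ solve 2 (λ d y → d :* k1 :* y := d :* y) refl d (u (suc i)) ⟩
      d * u (suc i)                            R.∎
      where
      s d : ℚ
      s = ⟦ suc i ⟧
      d = ⟦ n ⟧ - ⟦ i ⟧

  τ∼u : ∀ i → i ℕ.< N → τ i ∼ τ 0 * cube (u i)
  τ∼u zero    0<N = ≡⇒∼ (trans (solve 1 (λ x → x := x :* (k1 :* k1 :* k1)) refl (τ 0)) (cong (λ x → τ 0 * cube x) (sym inv1)))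
  τ∼u (suc i) 1+i<N = begin
    - cube (ρ (suc N ℕ.+ i)) * τ i
      ≈⟨ ∼-* (int-neg (int-cube int-w)) (int-* int-τ0 (int-cube int-ui)) (∼-neg (∼-cube int-w (ρ-upper 1+i<N))) (τ∼u i i<N) ⟩
    - cube (even i * odd⁻¹ (suc i)) * (τ 0 * cube (u i))
      ≡⟨ solve 3 (λ w t u → let c = λ x → x :* x :* x in :- c w :* (t :* c u) := t :* c (:- w :* u)) refl (even i * odd⁻¹ (suc i)) (τ 0) (u i) ⟩
    τ 0 * cube (- (even i * odd⁻¹ (suc i)) * u i)
      ≈⟨ ∼-*ˡ int-τ0 (∼-cube (int-u 1+i<N) (u-step 1+i<N)) ⟩
    τ 0 * cube (u (suc i)) ∎
    where
    i<N = ℕ.<⇒≤ 1+i<N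
    int-w = int-* (int-even i) (int-odd⁻¹ 1+i<N)
    int-ui = int-u i<N
    int-τ0 = int-τ 0 (ℕ.≤-<-trans z≤n i<N)

  -- 4(N+1+i) + 1 with 2p removed.
  c : ℕ → ℚ
  c i = ⟦ 3 ⟧ + ⟦ 4 ⟧ * ⟦ i ⟧

  int-c : ∀ i → Int (c i)
  int-c i = int-+ (int-⟨⟩ 3) (int-* (int-⟨⟩ 4) (int-⟨⟩ i))

  2P+ : ∀ {x} → P + (P + x) ∼ x
  2P+ = ∼-trans P+ P+

  c-reverse : ∀ {i} → i ℕ.< N → c (N ∸ suc i) ∼ - c i
  c-reverse {i} i<N = ∼-trans (≡⇒∼ (trans (cong (λ s → ⟦ 3 ⟧ + ⟦ 4 ⟧ * s) (trans (⟨∸⟩ i<N) (cong (λ s → ⟦ N ⟧ - s) (⟨suc⟩ i))))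
    (trans (solve 2 (λ n i → let p = k1 :+ con (+ 2) :* n in con (+ 3) :+ con (+ 4) :* (n :- (k1 :+ i)) := p :+ (p :- (con (+ 3) :+ con (+ 4) :* i))) refl ⟦ N ⟧ ⟦ i ⟧)
      (cong (λ p → p + (p - c i)) (sym P≡odd))))) 2P+

  u-reverse : ∀ {i} → i ℕ.< N → u (N ∸ suc i) ≡ u i
  u-reverse {i} i<N = cong inv (trans (cong ((N ∸ 1) C_) (sym (ℕ.∸-+-assoc N 1 i))) (sym (nCk≡nC[n∸k] (i≤N-1 i<N))))

  Σcu∼0 : Σ N (λ i → c i * cube (u i)) ∼ ⟦ 0 ⟧
  Σcu∼0 = ∼-cancel-unit unit-2 (begin
    ⟦ 2 ⟧ * Z      ≡⟨ solve 1 (λ z → con (+ 2) :* z := z :+ z) refl Z ⟩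
    Z + Z          ≈⟨ ∼-+ (∼-refl {Z}) Z∼-Z ⟩
    Z + - ⟦ 1 ⟧ * Z ≡⟨ solve 1 (λ z → z :+ :- k1 :* z := con (+ 2) :* k0) refl Z ⟩
    ⟦ 2 ⟧ * ⟦ 0 ⟧  ∎)
    where
    Z = Σ N (λ i → c i * cube (u i))
    Z∼-Z : Z ∼ - ⟦ 1 ⟧ * Z
    Z∼-Z = begin
      Z                                                          ≡⟨ Σ-reverse N (λ i → c i * cube (u i)) ⟩
      Σ N (λ i → c (N ∸ suc i) * cube (u (N ∸ suc i)))
        ≈⟨ ∼-Σ N (λ i i<N → ∼-trans (∼-*ʳ (int-cube (int-u (∸suc< i<N))) (c-reverse i<N))
             (≡⇒∼ (trans (cong (λ x → - c i * cube x) (u-reverse i<N)) (solve 2 (λ a b → :- a :* b := :- k1 :* (a :* b)) refl (c i) (cube (u i)))))) ⟩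
      Σ N (λ i → - ⟦ 1 ⟧ * (c i * cube (u i)))                   ≡⟨ Σ-*ˡ N (- ⟦ 1 ⟧) (λ i → c i * cube (u i)) ⟩
      - ⟦ 1 ⟧ * Z                                                ∎

  upper-sum : ∃ λ z → Σ p [4n+1]t ≡ Σ (suc N) [4n+1]t + cube P * z × z ∼ ⟦ 0 ⟧
  upper-sum = Σ N (λ i → (P + (P + c i)) * τ i)
    , trans (cong (λ n → Σ n [4n+1]t) (sym p≡)) (trans (Σ-++ (suc N) N [4n+1]t) (cong (λ x → Σ (suc N) [4n+1]t + x)
        (trans (Σ-cong N λ i _ → summand i) (Σ-*ˡ N (cube P) (λ i → (P + (P + c i)) * τ i)))))
    , (begin
      Σ N (λ i → (P + (P + c i)) * τ i)
        ≈⟨ ∼-Σ N (λ i i<N → ∼-* (int-c i) (int-* (int-τ 0 (ℕ.≤-<-trans z≤n i<N)) (int-cube (int-u i<N))) 2P+ (τ∼u i i<N)) ⟩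
      Σ N (λ i → c i * (τ 0 * cube (u i)))
        ≡⟨ Σ-cong N (λ i _ → solve 3 (λ a b c → a :* (b :* c) := b :* (a :* c)) refl (c i) (τ 0) (cube (u i))) ⟩
      Σ N (λ i → τ 0 * (c i * cube (u i)))    ≡⟨ Σ-*ˡ N (τ 0) (λ i → c i * cube (u i)) ⟩
      τ 0 * Σ N (λ i → c i * cube (u i))      ≈⟨ ∼-*ˡ (int-τ 0 (ℕ.>-nonZero⁻¹ N {{N≢0}})) Σcu∼0 ⟩
      τ 0 * ⟦ 0 ⟧                             ≡⟨ solve 1 (λ x → x :* k0 := k0) refl (τ 0) ⟩
      ⟦ 0 ⟧                                   ∎)
    where
    summand : ∀ i → [4n+1]t (suc N ℕ.+ i) ≡ cube P * ((P + (P + c i)) * τ i)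
    summand i = trans (cong₂ _*_ factor (t-upper i)) (solve 3 (λ a b c → a :* (b :* c) := b :* (a :* c)) refl (P + (P + c i)) (cube P) (τ i))
      where
      factor : ⟦ 2 ⟧ * dbl (suc N ℕ.+ i) + ⟦ 1 ⟧ ≡ P + (P + c i)
      factor = trans (cong (λ s → ⟦ 2 ⟧ * (⟦ 2 ⟧ * s) + ⟦ 1 ⟧) (trans (⟨+⟩ (suc N) i) (cong (_+ ⟦ i ⟧) (⟨suc⟩ N))))
        (trans (solve 2 (λ n i → let p = k1 :+ con (+ 2) :* n in con (+ 2) :* (con (+ 2) :* (k1 :+ n :+ i)) :+ k1 := p :+ (p :+ (con (+ 3) :+ con (+ 4) :* i))) refl ⟦ N ⟧ ⟦ i ⟧)
          (cong (λ p → p + (p + c i)) (sym P≡odd)))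

  -- From congruence modulo p to congruence modulo p⁴.

  -- The common part c cancels, p³ factors out of the difference, and `x ∼ y` supplies the fourth
  -- power.
  congruent : ∀ c {a b x y} → Int a → Int b → a ≡ c + cube P * x → b ≡ c + cube P * y → x ∼ y → a ≈ b [mod p ^ 4 ]
  congruent c {a} {b} {x} {y} int-a int-b a≡ b≡ (mk∼ z int-z x-y≡Pz) = record
    { integralˡ        = int⇒integral int-a
    ; integralʳ        = int⇒integral int-b
    ; quotient         = z
    ; integralQuotient = int⇒integral int-z
    ; equality         = R.begin
        a - b                                  R.≡⟨ cong₂ _-_ a≡ b≡ ⟩
        c + cube P * x - (c + cube P * y)      R.≡⟨ solve 4 (λ c p x y → c :+ p :* x :- (c :+ p :* y) := p :* (x :- y)) refl c (cube P) x y ⟩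
        cube P * (x - y)                       R.≡⟨ cong (cube P *_) x-y≡Pz ⟩
        cube P * (P * z)                       R.≡⟨ solve 2 (λ p z → p :* p :* p :* (p :* z) := p :* (p :* (p :* (p :* k1))) :* z) refl P z ⟩
        P * (P * (P * (P * ⟦ 1 ⟧))) * z        R.≡⟨ cong (_* z) p⁴ ⟨
        ⟦ p ℕ.^ 4 ⟧ * z                        R.≡⟨ cong (_* z) (ι≡fromℤ (+ (p ℕ.^ 4))) ⟩
        fromℤ (+ (p ℕ.^ 4)) * z                R.∎
    }
    where
    p⁴ : ⟦ p ℕ.^ 4 ⟧ ≡ P * (P * (P * (P * ⟦ 1 ⟧)))
    p⁴ = trans (⟨*⟩ p (p ℕ.^ 3)) (cong (P *_) (trans (⟨*⟩ p (p ℕ.^ 2)) (cong (P *_) (trans (⟨*⟩ p (p ℕ.^ 1)) (cong (P *_) (⟨*⟩ p 1))))))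

  int-full-sum : Int (Σ p [4n+1]t)
  int-full-sum = int-Σ p int-[4n+1]t

  int-half-sum : Int (Σ (suc N) [4n+1]t)
  int-half-sum = int-Σ (suc N) λ k k≤N → int-[4n+1]t k (ℕ.<-≤-trans k≤N (s≤s N≤q))

  full≈half : Σ p [4n+1]t ≈ Σ (suc N) [4n+1]t [mod p ^ 4 ]
  full≈half = congruent (Σ (suc N) [4n+1]t) int-full-sum int-half-sum (proj₁ (proj₂ upper-sum))
    (solve 2 (λ x c → x := x :+ c :* k0) refl (Σ (suc N) [4n+1]t) (cube P)) (proj₂ (proj₂ upper-sum))

  half≈euler : ∀ m → N ≡ suc (suc m) →
    Σ (suc N) [4n+1]t ≈ fromℤ (+ p ℤ.* legendre -1ℤ p ℤ.+ (+ p) ℤ.^ 3 ℤ.* E (p ∸ 3)) [mod p ^ 4 ]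
  half≈euler m N≡2+m = congruent (P * sgn N) int-half-sum (subst Int (ι≡fromℤ target) (int-ι target))
    (proj₁ (proj₂ half)) target≡ (proj₂ (proj₂ half))
    where
    half = half-sum m N≡2+m
    target = + p ℤ.* legendre -1ℤ p ℤ.+ (+ p) ℤ.^ 3 ℤ.* E (p ∸ 3)
    p-3 : p ∸ 3 ≡ 2 ℕ.* suc m
    p-3 = cong (λ n → suc n ∸ 3) (q≡2+r m N≡2+m)
    ι-p³ : ι ((+ p) ℤ.^ 3) ≡ cube P
    ι-p³ = trans (ι-* (+ p) ((+ p) ℤ.^ 2)) (trans (cong (P *_) (trans (ι-* (+ p) ((+ p) ℤ.^ 1)) (cong (P *_) (ι-* (+ p) 1ℤ))))
      (solve 1 (λ p → p :* (p :* (p :* k1)) := p :* p :* p) refl P))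
    target≡ : fromℤ target ≡ P * sgn N + cube P * Eℚ (2 ℕ.* suc m)
    target≡ = R.begin
      fromℤ target                                               R.≡⟨ ι≡fromℤ target ⟨
      ι target                                                   R.≡⟨ ι-+ (+ p ℤ.* legendre -1ℤ p) ((+ p) ℤ.^ 3 ℤ.* E (p ∸ 3)) ⟩
      ι (+ p ℤ.* legendre -1ℤ p) + ι ((+ p) ℤ.^ 3 ℤ.* E (p ∸ 3))
        R.≡⟨ cong₂ _+_ (ι-* (+ p) (legendre -1ℤ p)) (ι-* ((+ p) ℤ.^ 3) (E (p ∸ 3))) ⟩
      P * ι (legendre -1ℤ p) + ι ((+ p) ℤ.^ 3) * Eℚ (p ∸ 3)
        R.≡⟨ cong₂ _+_ (cong (P *_) legendre≡sgn) (cong₂ _*_ ι-p³ (cong Eℚ p-3)) ⟩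
      P * sgn N + cube P * Eℚ (2 ℕ.* suc m)                      R.∎

open import Data.Integer.Base using (+_; -1ℤ; _+_; _*_; _^_)
open import Data.Nat.Base using (_/_)

-- Cases by the parity and the size of p.

private
  Claim : ℕ → Set
  Claim p =
    ∑ℚ[k≤ p ∸ 1 ] term ≈ ∑ℚ[k≤ (p ∸ 1) / 2 ] term [mod p ^ 4 ] ×
    (p ≢ 3 →
      ∑ℚ[k≤ (p ∸ 1) / 2 ] term
        ≈ fromℤ (+ p * legendre -1ℤ p + (+ p) ^ 3 * E (p ∸ 3)) [mod p ^ 4 ])

  odd-claim : ∀ N → Prime (suc (2 ℕ.* N)) → Claim (suc (2 ℕ.* N))
  odd-claim N p-prime = subst₂ (λ a b → a ≈ b [mod p ^ 4 ]) (sym (∑term (2 ℕ.* N))) (sym half) full≈half , second N refl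
    where
    open OddPrime N p-prime
    half : ∑ℚ[k≤ (2 ℕ.* N) / 2 ] term ≡ Σ (suc N) [4n+1]t
    half = trans (cong (λ n → ∑ℚ[k≤ n ] term) (trans (cong (_/ 2) (ℕ.*-comm 2 N)) (m*n/n≡m N 2))) (∑term N)
    second : ∀ n → N ≡ n → p ≢ 3 → ∑ℚ[k≤ (2 ℕ.* N) / 2 ] term
      ≈ fromℤ (+ p * legendre -1ℤ p + (+ p) ^ 3 * E (p ∸ 3)) [mod p ^ 4 ]
    second zero          N≡0 _   = contradiction N≡0 (ℕ.≢-nonZero⁻¹ N {{N≢0}})
    -- N = 1 is p = 3, the only odd prime for which 6 is not a unit.
    second (suc zero)    N≡1 p≢3 = contradiction (cong (λ n → suc (2 ℕ.* n)) N≡1) p≢3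
    second (suc (suc m)) N≡  _   = subst (_≈ fromℤ (+ p * legendre -1ℤ p + (+ p) ^ 3 * E (p ∸ 3)) [mod p ^ 4 ]) (sym half) (half≈euler m N≡)

  prime-claim : ∀ {p} → Prime p → p ≢ 2 → (∃ λ m → p ≡ 2 ℕ.* m) ⊎ (∃ λ m → p ≡ suc (2 ℕ.* m)) → Claim p
  prime-claim p-prime p≢2 (inj₁ (m , p≡2m)) = contradiction
    ([ (λ ()) , sym ]′ (prime⇒irreducible p-prime (divides m (trans p≡2m (ℕ.*-comm 2 m))))) p≢2
  prime-claim p-prime p≢2 (inj₂ (N , refl)) = odd-claim N p-prime

theorem1p1 : ∀ (p : ℕ) → Prime p → p ≢ 2 →
    ∑ℚ[k≤ p ∸ 1 ] term ≈ ∑ℚ[k≤ (p ∸ 1) / 2 ] term [mod p ^ 4 ] ×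
    (p ≢ 3 →
      ∑ℚ[k≤ (p ∸ 1) / 2 ] term
        ≈ fromℤ (+ p * legendre -1ℤ p + (+ p) ^ 3 * E (p ∸ 3)) [mod p ^ 4 ])
theorem1p1 p p-prime p≢2 = prime-claim p-prime p≢2 (parity p)
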